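{- For all $I,J\subseteq N$, $$\Psi_I\Psi_J\ge\Psi_{I\cup J}\Psi_{I\cap J}.$$ Let $\mathcal P(z)=\sum_{I\subseteq N}\Psi_I\prod_{i\in I}z_i$. After normalization by $\mathcal P(1,\dots,1)$, the coefficients define a strongly Rayleigh probability measure on subsets of $N$ (the measure assigning to $I\subseteq N$ the mass $\Psi_I/\mathcal P(1,\dots,1)$).
   Context: Network. $G=(V,E)$ is a finite connected simple undirected graph; each edge $e$ has a conductance $c_e\in\mathbb R_{>0}$. A spanning forest $F$ of $G$ is an acyclic subgraph with vertex set $V$ (isolated vertices allowed); $w(F)=\prod_{e\in F}c_e$; $\mathcal F_m$ is the set of spanning forests with exactly $m$ connected components. Superports. The boundary $M\subseteq V$ is nonempty and partitioned into nonempty superports $M=A_1\sqcup\cdots\sqcup A_p$. Choose a root $r_a\in A_a$ for each $a$; $R=\{r_1,\dots,r_p\}$, $N=M\setminus R$, $q=|N|$; $r(x)$ is the root of the superport containing $x$. Valid forests. A spanning forest is valid if identifying all boundary vertices within each superport (one vertex per superport) turns it into a spanning tree of the quotient network (loops and parallel edges count as cycles). $\Phi_{\mathrm{valid}}=\sum_{F\text{ valid}}w(F)$. Quotient port graph and principal numerators. For a spanning forest $F$, the quotient port multigraph $H_F$ has the connected components of $F$ as vertices, and each $x\in N$ gives a directed edge from the component containing $r(x)$ to the component containing $x$ (a loop if these coincide). For $I\subseteq N$ with $|I|=k$, $\Psi_I$ is the sum of $w(F)$ over those $F\in\mathcal F_{q-k+1}$ for which the edge set $N\setminus I$ is a spanning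 tree of $H_F$; $\Psi_\varnothing:=\Phi_{\mathrm{valid}}$. A probability measure $\mu$ on subsets of $N$ is strongly Rayleigh if its generating polynomial $\sum_{I\subseteq N}\mu(I)\prod_{i\in I}z_i$ is real stable, i.e. has no zero $z\in\mathbb C^N$ with $\operatorname{Im}z_i>0$ for all $i$. -}

module Defs where

open import Level using (Level; 0ℓ; _⊔_) renaming (suc to lsuc)
open import Algebra.Apartness.Bundles using (HeytingField; HeytingCommutativeRing)
open import Algebra.Bundles using (CommutativeRing; RawRing)
import Algebra.Definitions.RawMonoid as RawMonoidOps
open import Data.Bool.Base using (Bool; true; false; if_then_else_)
open import Data.Fin.Base using (Fin; zero; suc)
import Data.Fin.Base as Fin
import Data.Fin.Properties as Fin
open import Data.Fin.Subset using (Subset; inside; outside; _∈_; ∣_∣; ∁; ⊤)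
open import Data.Fin.Subset.Properties using (_∈?_; nonempty?)
open import Data.List.Base using (List; []; _∷_; length; map; filter; allFin; lookup)
open import Data.List.Properties using (length-map)
import Data.List.Relation.Unary.All as All
open import Data.List.Relation.Unary.All.Properties using (all-filter)
open import Data.List.Relation.Unary.Any using (here; there)
open import Data.List.Relation.Unary.AllPairs using (_∷_)
import Data.List.Membership.Propositional as List
open import Data.List.Membership.Propositional.Properties using (∈-allFin; ∈-filter⁺; ∈-lookup)
open import Data.List.Relation.Unary.Unique.Propositional using (Unique)
import Data.List.Relation.Unary.Unique.Setoid as UniqueSetoid
import Data.List.Relation.Unary.Unique.DecSetoid as UniqueDecSetoid
open import Data.Maybe.Base using (Maybe; just; maybe′)
import Data.Maybe.Properties as Maybe
open import Data.Nat.Base using (ℕ; zero; suc; _∸_; z≤n; s≤s)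
import Data.Nat.Base as ℕ
import Data.Nat.Properties as ℕ
open import Data.Product.Base using (∃; ∃₂; _×_; _,_; proj₁; proj₂)
open import Data.Sum.Base using (_⊎_; inj₁; inj₂)
import Data.Vec.Base as Vec
open import Data.Vec.Functional using (Vector)
open import Function.Bundles using (_⇔_; Equivalence)
open import Relation.Binary.Bundles using (DecSetoid)
open import Relation.Binary.Construct.Closure.Equivalence as EqClosure using (EqClosure)
import Relation.Binary.Construct.On as On
open import Relation.Binary.Core using (Rel)
open import Relation.Binary.Definitions using (Decidable)
open import Relation.Binary.PropositionalEquality
  using (_≡_; _≢_; refl; sym; trans; cong; subst)
import Relation.Binary.PropositionalEquality.Properties as ≡
open import Relation.Binary.Structures using (IsDecEquivalence; IsStrictPartialOrder)
open import Relation.Nullary using (¬_; Dec; yes; no; does; contradiction)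
open import Relation.Nullary.Decidable using (map′; _×-dec_; _⊎-dec_; _→-dec_; ¬?)
import Relation.Unary as U

-- The axioms of an Archimedean, Cauchy-complete ordered field.  Classically
-- they determine ℝ up to unique isomorphism; they are phrased (apartness,
-- inverses only for elements apart from 0) so that the constructive Cauchy
-- reals (regular sequences of rationals) satisfy them too.

record RealField (c ℓ₁ ℓ₂ : Level) : Set (lsuc (c ⊔ ℓ₁ ⊔ ℓ₂)) where
  infix 4 _<_ _≤_ _≥_
  field
    heytingField : HeytingField c ℓ₁ ℓ₂

  open HeytingField heytingField public
    hiding (apartnessRelation)

  commutativeRing : CommutativeRing c ℓ₁
  commutativeRing = HeytingCommutativeRing.commutativeRing heytingCommutativeRing

  open CommutativeRing commutativeRing public
    using (rawRing; +-rawMonoid)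
  open RawMonoidOps +-rawMonoid public
    using () renaming (_×_ to _·_)

  field
    _<_                  : Rel Carrier ℓ₂
    isStrictPartialOrder : IsStrictPartialOrder _≈_ _<_
    #⇔<⊎>                : ∀ x y → x # y ⇔ (x < y ⊎ y < x)
    +-monoʳ-<            : ∀ z {x y} → x < y → z + x < z + y
    *-pos                : ∀ {x y} → 0# < x → 0# < y → 0# < x * y
    archimedean          : ∀ x → ∃ λ n → x < n · 1#

  IsCauchy : (ℕ → Carrier) → Set ℓ₂
  IsCauchy s = ∀ k → ∃ λ N → ∀ m n → N ℕ.≤ m → N ℕ.≤ n → suc k · (s m - s n) < 1#

  _ConvergesTo_ : (ℕ → Carrier) → Carrier → Set ℓ₂
  s ConvergesTo l = ∀ k → ∃ λ N → ∀ n → N ℕ.≤ n →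
    (suc k · (s n - l) < 1#) × (suc k · (l - s n) < 1#)

  field
    complete : ∀ s → IsCauchy s → ∃ λ l → s ConvergesTo l

  _≤_ _≥_ : Rel Carrier ℓ₂
  x ≤ y = ¬ (y < x)
  x ≥ y = y ≤ x

  -- The inverse of x - 0#, hence of x.
  inverse : ∀ {x} → 0# < x → Carrier
  inverse {x} 0<x = proj₁ (#⇒invertible (Equivalence.from (#⇔<⊎> x 0#) (inj₂ 0<x)))

module Complex {c ℓ₁ ℓ₂} (ℝ : RealField c ℓ₁ ℓ₂) where
  open RealField ℝ

  record ℂ : Set c where
    constructor _+i_
    field
      re im : Carrier
  open ℂ public

  fromℝ : Carrier → ℂ
  fromℝ x = x +i 0#

  ℂ-rawRing : RawRing c ℓ₁
  ℂ-rawRing = record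
    { Carrier = ℂ
    ; _≈_     = λ z w → (re z ≈ re w) × (im z ≈ im w)
    ; _+_     = λ z w → (re z + re w) +i (im z + im w)
    ; _*_     = λ z w → (re z * re w - im z * im w) +i (re z * im w + im z * re w)
    ; -_      = λ z → (- re z) +i (- im z)
    ; 0#      = fromℝ 0#
    ; 1#      = fromℝ 1#
    }

module Sums {c ℓ} (R : RawRing c ℓ) where
  open RawRing R
  open RawMonoidOps *-rawMonoid using () renaming (sum to product)

  ∑ : ∀ {n} → (Subset n → Carrier) → Carrier
  ∑ {zero}  f = f Vec.[]
  ∑ {suc n} f = ∑ (λ I → f (outside Vec.∷ I)) + ∑ (λ I → f (inside Vec.∷ I))

  ∑[_] : ∀ {n p} {P : U.Pred (Subset n) p} → U.Decidable P → (Subset n → Carrier) → Carrier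
  ∑[ P? ] f = ∑ (λ I → if does (P? I) then f I else 0#)

  ∏[_] : ∀ {n} → Subset n → Vector Carrier n → Carrier
  ∏[ I ] x = product (λ i → if does (i ∈? I) then x i else 1#)

module Stability {c ℓ₁ ℓ₂} (ℝ : RealField c ℓ₁ ℓ₂) where
  open RealField ℝ
  open Complex ℝ
  private
    module ℝΣ = Sums rawRing
    module ℂΣ = Sums ℂ-rawRing
    module ℂR = RawRing ℂ-rawRing

  -- The multiaffine polynomial ∑_I a_I ∏_{i ∈ I} z_i, at a real and at a
  -- complex point.

  evalℝ : ∀ {q} → (Subset q → Carrier) → Vector Carrier q → Carrier
  evalℝ a x = ℝΣ.∑ (λ I → a I * ℝΣ.∏[ I ] x)

  evalℂ : ∀ {q} → (Subset q → Carrier) → Vector ℂ q → ℂ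
  evalℂ a z = ℂΣ.∑ (λ I → fromℝ (a I) ℂR.* ℂΣ.∏[ I ] z)

  RealStable : ∀ {q} → (Subset q → Carrier) → Set (c ⊔ ℓ₁ ⊔ ℓ₂)
  RealStable {q} a = (z : Vector ℂ q) → (∀ i → 0# < im (z i)) → ¬ (evalℂ a z ℂR.≈ ℂR.0#)

  record IsProbabilityMeasure {q} (μ : Subset q → Carrier) : Set (ℓ₁ ⊔ ℓ₂) where
    field
      nonNegative : ∀ I → 0# ≤ μ I
      total       : ℝΣ.∑ μ ≈ 1#

  record IsStronglyRayleigh {q} (μ : Subset q → Carrier) : Set (c ⊔ ℓ₁ ⊔ ℓ₂) where
    field
      isProbabilityMeasure : IsProbabilityMeasure μ
      realStable           : RealStable μ

private
  lookup-injective : ∀ {a} {A : Set a} {xs : List A} → Unique xs →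
                     ∀ i j → lookup xs i ≡ lookup xs j → i ≡ j
  lookup-injective (_ ∷ _) zero zero _ = refl
  lookup-injective {xs = _ ∷ xs} (x∉ ∷ _) zero (suc j) eq =
    contradiction eq (All.lookup x∉ (∈-lookup {xs = xs} j))
  lookup-injective {xs = _ ∷ xs} (x∉ ∷ _) (suc i) zero eq =
    contradiction (sym eq) (All.lookup x∉ (∈-lookup {xs = xs} i))
  lookup-injective (_ ∷ u) (suc i) (suc j) eq = cong suc (lookup-injective u i j eq)

  unique-length : ∀ {m} {es : List (Fin m)} → Unique es → length es ℕ.≤ m
  unique-length u = Fin.injective⇒≤ (λ {i} {j} → lookup-injective u i j)

  anyBounded? : {A : Set} →
    (∀ {Q : A → Set} → U.Decidable Q → Dec (∃ Q)) →
    ∀ k {P : List A → Set} → U.Decidable P →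
    Dec (∃ λ xs → length xs ℕ.≤ k × P xs)
  anyBounded? any zero P? =
    map′ (λ p → [] , z≤n , p) (λ { ([] , _ , p) → p }) (P? [])
  anyBounded? any (suc k) P? =
    map′ (λ { (inj₁ p) → [] , z≤n , p
            ; (inj₂ (x , xs , l , p)) → x ∷ xs , s≤s l , p })
         (λ { ([] , _ , p) → inj₁ p
            ; (x ∷ xs , s≤s l , p) → inj₂ (x , xs , l , p) })
         (P? [] ⊎-dec any (λ x → anyBounded? any k (λ xs → P? (x ∷ xs))))

-- The vertices are the classes of Fin n under _∼_, so that quotients of a
-- graph are represented by a coarser _∼_.  Loops and parallel edges are
-- allowed.  Edge e joins src e and tgt e; the
-- orientation plays no role below.

record Multigraph (n m : ℕ) : Set₁ where
  infix 4 _∼_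
  field
    _∼_              : Rel (Fin n) 0ℓ
    isDecEquivalence : IsDecEquivalence _∼_
    src tgt          : Fin m → Fin n

  module ∼ = IsDecEquivalence isDecEquivalence

  vertices : DecSetoid 0ℓ 0ℓ
  vertices = record { isDecEquivalence = isDecEquivalence }

  data Link (T : Subset m) : Rel (Fin n) 0ℓ where
    same : ∀ {u v} → u ∼ v → Link T u v
    edge : ∀ {e} → e ∈ T → Link T (src e) (tgt e)

  Joined : Subset m → Rel (Fin n) 0ℓ
  Joined T = EqClosure (Link T)

  Connected : Subset m → Set
  Connected T = ∀ u v → Joined T u v

  -- An edge with a direction of traversal.
  Dart : Set
  Dart = Bool × Fin m

  start end : Dart → Fin n
  start (true  , e) = src e
  start (false , e) = tgt e
  end   (true  , e) = tgt e
  end   (false , e) = src e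

  IsWalk : Subset m → Fin n → List Dart → Fin n → Set
  IsWalk T u []       v = u ∼ v
  IsWalk T u (d ∷ ds) v = (u ∼ start d) × (proj₂ d ∈ T) × IsWalk T (end d) ds v

  -- A nonempty closed walk in T with distinct edges and distinct vertices.
  IsCycle : Subset m → List Dart → Set
  IsCycle T ds = (∃ λ u → IsWalk T u ds u) × (ds ≢ [])
               × Unique (map proj₂ ds)
               × UniqueSetoid.Unique (DecSetoid.setoid vertices) (map start ds)

  Acyclic : Subset m → Set
  Acyclic T = ¬ ∃ (IsCycle T)

  IsSpanningTree : Subset m → Set
  IsSpanningTree T = Connected T × Acyclic T

  -- Joined is decided by a union-find labelling of the vertices.

  private
    module DecJoined (T : Subset m) where
      label : List (Fin m) → Fin n → Fin n
      label []       v = v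
      label (e ∷ es) v with label es v ∼.≟ label es (src e)
      ... | yes _ = label es (tgt e)
      ... | no  _ = label es v

      label-cong : ∀ es {u v} → label es u ∼ label es v →
                   ∀ e → label (e ∷ es) u ∼ label (e ∷ es) v
      label-cong es {u} {v} u∼v e
        with label es u ∼.≟ label es (src e) | label es v ∼.≟ label es (src e)
      ... | yes _ | yes _ = ∼.refl
      ... | yes p | no ¬q = contradiction (∼.trans (∼.sym u∼v) p) ¬q
      ... | no ¬p | yes q = contradiction (∼.trans u∼v q) ¬p
      ... | no  _ | no  _ = u∼v

      label-same : ∀ es {u v} → u ∼ v → label es u ∼ label es v
      label-same []       u∼v = u∼v
      label-same (e ∷ es) u∼v = label-cong es (label-same es u∼v) e

      label-head : ∀ e es → label (e ∷ es) (src e) ∼ label (e ∷ es) (tgt e)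
      label-head e es
        with label es (src e) ∼.≟ label es (src e) | label es (tgt e) ∼.≟ label es (src e)
      ... | no ¬p | _     = contradiction ∼.refl ¬p
      ... | yes _ | yes _ = ∼.refl
      ... | yes _ | no  _ = ∼.refl

      label-edge : ∀ {e} es → e List.∈ es → label es (src e) ∼ label es (tgt e)
      label-edge (e ∷ es) (here refl) = label-head e es
      label-edge (f ∷ es) (there e∈)  = label-cong es (label-edge es e∈) f

      label-joined : ∀ es → All.All (_∈ T) es → ∀ v → Joined T v (label es v)
      label-joined []       _ v = EqClosure.reflexive _
      label-joined (e ∷ es) (e∈T All.∷ es⊆T) v with label es v ∼.≟ label es (src e)
      ... | no  _ = label-joined es es⊆T v
      ... | yes p = tr (label-joined es es⊆T v)
                   (tr (EqClosure.return (same p))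
                   (tr (EqClosure.symmetric _ (label-joined es es⊆T (src e)))
                   (tr (EqClosure.return (edge e∈T))
                       (label-joined es es⊆T (tgt e)))))
        where tr = EqClosure.transitive (Link T)

      edges : List (Fin m)
      edges = filter (_∈? T) (allFin m)

      sound : ∀ {u v} → label edges u ∼ label edges v → Joined T u v
      sound {u} {v} p =
        tr (label-joined edges (all-filter (_∈? T) (allFin m)) u)
        (tr (EqClosure.return (same p))
            (EqClosure.symmetric _ (label-joined edges (all-filter (_∈? T) (allFin m)) v)))
        where tr = EqClosure.transitive (Link T)

      complete : ∀ {u v} → Joined T u v → label edges u ∼ label edges v
      complete = EqClosure.fold (On.isEquivalence (label edges) ∼.isEquivalence)
        λ { (same p)   → label-same edges p
          ; (edge e∈T) → label-edge edges (∈-filter⁺ (_∈? T) (∈-allFin _) e∈T) }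

    isWalk? : ∀ T u ds v → Dec (IsWalk T u ds v)
    isWalk? T u []       v = u ∼.≟ v
    isWalk? T u (d ∷ ds) v = (u ∼.≟ start d) ×-dec (proj₂ d ∈? T) ×-dec isWalk? T (end d) ds v

    isCycle? : ∀ T → U.Decidable (IsCycle T)
    isCycle? T ds = Fin.any? (λ u → isWalk? T u ds u)
             ×-dec ¬? (nil? ds)
             ×-dec UniqueDecSetoid.unique? (≡.decSetoid Fin._≟_) (map proj₂ ds)
             ×-dec UniqueDecSetoid.unique? vertices (map start ds)
      where
      nil? : (ds : List Dart) → Dec (ds ≡ [])
      nil? []      = yes refl
      nil? (_ ∷ _) = no λ ()

    anyDart? : {Q : Dart → Set} → U.Decidable Q → Dec (∃ Q)
    anyDart? Q? = map′ (λ { (inj₁ (e , q)) → (true , e) , q ; (inj₂ (e , q)) → (false , e) , q })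
                       (λ { ((true , e) , q) → inj₁ (e , q) ; ((false , e) , q) → inj₂ (e , q) })
                       (Fin.any? (λ e → Q? (true , e)) ⊎-dec Fin.any? (λ e → Q? (false , e)))

  joined? : ∀ T → Decidable (Joined T)
  joined? T u v = map′ sound complete (label edges u ∼.≟ label edges v)
    where open DecJoined T

  connected? : U.Decidable Connected
  connected? T = Fin.all? λ u → Fin.all? λ v → joined? T u v

  acyclic? : U.Decidable Acyclic
  acyclic? T = ¬? (map′ (λ { (ds , _ , c) → ds , c })
                        (λ { (ds , c@(_ , _ , u , _)) →
                             ds , subst (ℕ._≤ m) (length-map proj₂ ds) (unique-length u) , c })
                        (anyBounded? anyDart? m (isCycle? T)))

  isSpanningTree? : U.Decidable IsSpanningTree
  isSpanningTree? T = connected? T ×-dec acyclic? T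

  -- Each component is counted through its least representative.
  componentCount : Subset m → ℕ
  componentCount T =
    length (filter (λ v → Fin.all? λ u → joined? T v u →-dec (v Fin.≤? u)) (allFin n))

  joined-isDecEquivalence : ∀ T → IsDecEquivalence (Joined T)
  joined-isDecEquivalence T = record
    { isEquivalence = EqClosure.isEquivalence (Link T)
    ; _≟_           = joined? T
    }

-- Simple graphs on Fin n with m edges; the edge {u , v} is stored with u < v.

record SimpleGraph (n m : ℕ) : Set where
  field
    src tgt : Fin m → Fin n
    src<tgt : ∀ e → src e Fin.< tgt e
    simple  : ∀ {e f} → src e ≡ src f → tgt e ≡ tgt f → e ≡ f

  multigraph : Multigraph n m
  multigraph = record
    { _∼_ = _≡_ ; isDecEquivalence = ≡.isDecEquivalence Fin._≟_ ; src = src ; tgt = tgt }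

record Network {c ℓ₁ ℓ₂} (ℝ : RealField c ℓ₁ ℓ₂) : Set (c ⊔ ℓ₂) where
  private module ℝ = RealField ℝ
  field
    n m   : ℕ
    graph : SimpleGraph n m

  open SimpleGraph graph using (src; tgt) renaming (multigraph to G) public

  field
    connected       : Multigraph.Connected G ⊤
    conductance     : Fin m → ℝ.Carrier
    conductance-pos : ∀ e → ℝ.0# ℝ.< conductance e

    -- port x ≡ just a means x ∈ A_a; the vertices outside the boundary are
    -- sent to nothing.  Each superport is nonempty as it contains its root.
    p        : ℕ
    port     : Fin n → Maybe (Fin p)
    boundary : ∃₂ λ x a → port x ≡ just a
    root     : Fin p → Fin n
    root∈    : ∀ a → port (root a) ≡ just a

  -- N, listed in increasing order; subsets of N are elements of Subset q.

  NonRoot : Fin n → Set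
  NonRoot x = ∃ λ a → (port x ≡ just a) × (x ≢ root a)

  nonRoot? : U.Decidable NonRoot
  nonRoot? x = Fin.any? λ a → Maybe.≡-dec Fin._≟_ (port x) (just a) ×-dec ¬? (x Fin.≟ root a)

  N : List (Fin n)
  N = filter nonRoot? (allFin n)

  q : ℕ
  q = length N

  nonRoot : Fin q → Fin n
  nonRoot = lookup N

  -- r(x); the value at vertices outside the boundary is irrelevant.
  r : Fin n → Fin n
  r x = maybe′ root x (port x)

  -- Identify all boundary vertices within each superport.

  data SamePort : Rel (Fin n) 0ℓ where
    same : ∀ {x} → SamePort x x
    glue : ∀ {x y} a → port x ≡ just a → port y ≡ just a → SamePort x y

  samePort? : Decidable SamePort
  samePort? x y =
    map′ (λ { (inj₁ refl) → same ; (inj₂ (a , p , q)) → glue a p q })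
         (λ { same → inj₁ refl ; (glue a p q) → inj₂ (a , p , q) })
         ((x Fin.≟ y) ⊎-dec Fin.any? λ a →
            Maybe.≡-dec Fin._≟_ (port x) (just a) ×-dec Maybe.≡-dec Fin._≟_ (port y) (just a))

  quotient : Multigraph n m
  quotient = record
    { _∼_              = SamePort
    ; isDecEquivalence = record
      { isEquivalence = record { refl = same ; sym = symm ; trans = tran }
      ; _≟_           = samePort?
      }
    ; src = src
    ; tgt = tgt
    }
    where
    symm : ∀ {x y} → SamePort x y → SamePort y x
    symm same         = same
    symm (glue a p q) = glue a q p
    tran : ∀ {x y z} → SamePort x y → SamePort y z → SamePort x z
    tran same         s            = s
    tran (glue a p q) same         = glue a p q
    tran (glue a p q) (glue b s t) =
      glue a p (trans t (trans (sym s) q))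

  IsForest : Subset m → Set
  IsForest = Multigraph.Acyclic G

  IsValid : Subset m → Set
  IsValid F = IsForest F × Multigraph.IsSpanningTree quotient F

  isValid? : U.Decidable IsValid
  isValid? F = Multigraph.acyclic? G F ×-dec Multigraph.isSpanningTree? quotient F

  IsForestWith : ℕ → Subset m → Set
  IsForestWith k F = IsForest F × (Multigraph.componentCount G F ≡ k)

  -- The quotient port multigraph H_F.
  H : Subset m → Multigraph n q
  H F = record
    { _∼_              = Multigraph.Joined G F
    ; isDecEquivalence = Multigraph.joined-isDecEquivalence G F
    ; src              = λ j → r (nonRoot j)
    ; tgt              = nonRoot
    }

  IsCounted : Subset q → Subset m → Set
  IsCounted I F =
    IsForestWith (q ∸ ∣ I ∣ ℕ.+ 1) F × Multigraph.IsSpanningTree (H F) (∁ I)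

  isCounted? : ∀ I → U.Decidable (IsCounted I)
  isCounted? I F =
    (Multigraph.acyclic? G F ×-dec (Multigraph.componentCount G F ℕ.≟ (q ∸ ∣ I ∣ ℕ.+ 1)))
    ×-dec Multigraph.isSpanningTree? (H F) (∁ I)

  open Sums ℝ.rawRing

  weight : Subset m → ℝ.Carrier
  weight F = ∏[ F ] conductance

  Φ-valid : ℝ.Carrier
  Φ-valid = ∑[ isValid? ] weight

  Ψ : Subset q → ℝ.Carrier
  Ψ I = if does (nonempty? I) then ∑[ isCounted? I ] weight else Φ-valid

  𝒫[1,…,1] : ℝ.Carrier
  𝒫[1,…,1] = Stability.evalℝ ℝ Ψ (λ _ → ℝ.1#)

  normalised : ℝ.0# ℝ.< 𝒫[1,…,1] → Subset q → ℝ.Carrier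
  normalised pos I = Ψ I ℝ.* ℝ.inverse pos

{-# OPTIONS --safe #-}

-- Adding an edge from r(x) to x for every x ∈ N turns Ψ_I into the weighted
-- count of spanning trees of the enlarged network that use exactly the new
-- edges in N \ I, so 𝒫 arises from f(π), the spanning tree sum of G with the
-- classes of a partition π identified, by deletion and contraction of the new
-- edges.  Adding the edges one at a time shows that f(π / ab) / f(π) is the
-- effective resistance between a and b.  Rayleigh monotonicity of resistances
-- is then the lattice condition.  For stability, give x the impedance z_x: were
-- 𝒫 to vanish on adding x, the resistance already present across x would be
-- - z_x, which the sign of the imaginary part of the energy excludes.
module Submission where

open import Algebra.Bundles using (CommutativeRing)
open import Data.Bool.Base using (Bool; true; false; if_then_else_)
import Data.Bool.Properties as Bool
open import Data.Empty using (⊥; ⊥-elim)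
open import Data.Fin.Base as Fin using (Fin; zero; suc)
import Data.Fin.Induction as Fin
import Data.Fin.Properties as Fin
open import Data.Fin.Subset as Subset using (Subset; inside; outside; ∣_∣; ∁; _∈_; _∪_; _∩_)
import Data.Fin.Subset.Properties as Subset
open import Data.Integer.Base as ℤ using (ℤ; +_; -[1+_]; _⊖_)
import Data.Integer.Properties as ℤ
open import Data.List.Base using (List; []; _∷_; _++_; length; filter; allFin; map; tabulate)
import Data.List.Membership.Propositional as List
open import Data.List.Membership.Propositional.Properties using (∈-allFin; ∈-filter⁺)
import Data.List.Properties as List
open import Data.List.Relation.Binary.Permutation.Propositional as ↭ using (_↭_; ↭-sym; ↭-trans; ↭-reflexive)
open import Data.List.Relation.Binary.Permutation.Propositional.Properties using (shift; ++⁺ˡ; ++-comm)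
open import Data.List.Relation.Unary.All as All using (All; []; _∷_)
import Data.List.Relation.Unary.All.Properties as All
open import Data.List.Relation.Unary.AllPairs using (AllPairs; []; _∷_)
open import Data.List.Relation.Unary.Any using (Any; here; there)
open import Data.List.Relation.Unary.Unique.Propositional using (Unique)
import Data.List.Relation.Unary.Unique.Propositional.Properties as Unique
open import Data.Maybe.Base as Maybe using (Maybe; just)
open import Data.Maybe.Properties using (just-injective)
open import Data.Nat.Base as ℕ using (ℕ; zero; suc)
import Data.Nat.Properties as ℕ
open import Data.Product using (Σ; _×_; _,_; proj₁; proj₂; ∃)
open import Data.Sum using (_⊎_; inj₁; inj₂)
open import Data.Unit.Base using (⊤; tt)
open import Data.Vec.Base using ([]; _∷_; here; there)
open import Defs
open import Function.Base using (_∘_)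
open import Function.Bundles using (Equivalence)
open import Induction.WellFounded using (Acc; acc)
open import Level using (0ℓ; _⊔_) renaming (suc to lsuc)
open import Relation.Binary.Consequences using (dec⇒weaklyDec)
open import Relation.Binary.Construct.Closure.Equivalence as EqClosure using (EqClosure)
import Relation.Binary.Construct.On as On
open import Relation.Binary.Core using (Rel)
open import Relation.Binary.Definitions using (DecidableEquality; tri<; tri≈; tri>)
open import Relation.Binary.PropositionalEquality as ≡ using (_≡_; _≢_)
import Relation.Binary.PropositionalEquality.Properties as ≡
import Relation.Binary.Reasoning.Setoid as SetoidReasoning
open import Relation.Binary.Structures using (IsDecEquivalence; IsStrictPartialOrder)
open import Relation.Nullary using (¬_; Dec; yes; no; does; contradiction)
open import Relation.Nullary.Decidable using (¬?; _×-dec_; _⊎-dec_; _→-dec_; dec-true; dec-false)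
import Relation.Unary as U

-- Everything is phrased for functions `Θ` on the partitions of a fixed vertex set. An edge acts on
-- them by deletion and contraction, `extend`, with two weights: conductors use `1#` and the
-- conductance, ports use `z` and `1#`. The ports thus stay polynomial, and one superposition
-- argument over any commutative ring (`green-link`) serves real and complex networks alike.
-- Contraction changes the partition, so each induction carries all partitions at once. The obstacle
-- is that `green-link` inverts the new tree sum and uses the potential across the new edge before
-- it is added. Building a connected network edge by edge passes through disconnected ones, where
-- the tree sum is 0 and that potential does not exist; `Bridge` treats this case. Once ports are
-- added, nonvanishing is known only as a negation, which yields an inverse under double negation;
-- this suffices, as stability is itself a negation. The definitions speak of cycles as closed
-- walks, while tree sums see only contractions that meet no loop. The two are reconciled by lifting
-- a cycle through a contracted edge.

module IntegerSolver {c ℓ} (R : CommutativeRing c ℓ) where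
  open CommutativeRing R
  open import Algebra.Properties.Ring ring
  open import Algebra.Properties.Semiring.Mult.TCOptimised semiring using (×-homo-+; ×1-homo-*; 1+×) renaming (_×_ to _·_)
  open import Algebra.Solver.Ring.AlmostCommutativeRing
    using (fromCommutativeRing; _-Raw-AlmostCommutative⟶_)
  open SetoidReasoning setoid
  import Algebra.Solver.Ring.NaturalCoefficients.Default commutativeSemiring as ℕSolver

  private
    -- Integers serve as coefficients because their equality is decidable, which that of the carrier
    -- need not be, and because they map to every commutative ring; numerals then cancel during
    -- normalisation.
    ⟦_⟧ : ℤ → Carrier
    ⟦ + n ⟧      = n · 1#
    ⟦ -[1+ n ] ⟧ = - (suc n · 1#)

    ⊖-homo : ∀ m n → ⟦ m ⊖ n ⟧ ≈ m · 1# - n · 1#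
    ⊖-homo zero    zero    = sym (-‿inverseʳ 0#)
    ⊖-homo zero    (suc n) = sym (+-identityˡ _)
    ⊖-homo (suc m) zero    = sym (trans (+-congˡ -0#≈0#) (+-identityʳ _))
    ⊖-homo (suc m) (suc n) = begin
      ⟦ suc m ⊖ suc n ⟧                    ≡⟨ ≡.cong ⟦_⟧ (ℤ.[1+m]⊖[1+n]≡m⊖n m n) ⟩
      ⟦ m ⊖ n ⟧                            ≈⟨ ⊖-homo m n ⟩
      m · 1# - n · 1#                      ≈⟨ +-identityˡ _ ⟨
      0# + (m · 1# - n · 1#)               ≈⟨ +-congʳ (-‿inverseʳ 1#) ⟨
      (1# - 1#) + (m · 1# - n · 1#)        ≈⟨ ℕSolver.solve 4 (λ a b x y → (a ℕSolver.:+ b) ℕSolver.:+ (x ℕSolver.:+ y) ℕSolver.:= (a ℕSolver.:+ x) ℕSolver.:+ (b ℕSolver.:+ y)) refl _ _ _ _ ⟩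
      (1# + m · 1#) + (- 1# + - (n · 1#))  ≈⟨ +-congˡ (-‿+-comm _ _) ⟩
      (1# + m · 1#) - (1# + n · 1#)        ≈⟨ +-cong (1+× m 1#) (-‿cong (1+× n 1#)) ⟨
      suc m · 1# - suc n · 1#              ∎

    +-homo : ∀ i j → ⟦ i ℤ.+ j ⟧ ≈ ⟦ i ⟧ + ⟦ j ⟧
    +-homo (+ m)    (+ n)    = ×-homo-+ 1# m n
    +-homo (+ m)    -[1+ n ] = ⊖-homo m (suc n)
    +-homo -[1+ m ] (+ n)    = trans (⊖-homo n (suc m)) (+-comm _ _)
    +-homo -[1+ m ] -[1+ n ] = begin
      - (suc (suc (m ℕ.+ n)) · 1#)     ≡⟨ ≡.cong (λ k → - (k · 1#)) (ℕ.+-suc (suc m) n) ⟨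
      - ((suc m ℕ.+ suc n) · 1#)       ≈⟨ -‿cong (×-homo-+ 1# (suc m) (suc n)) ⟩
      - (suc m · 1# + suc n · 1#)      ≈⟨ -‿+-comm _ _ ⟨
      - (suc m · 1#) - suc n · 1#      ∎

    neg-homo : ∀ i → ⟦ ℤ.- i ⟧ ≈ - ⟦ i ⟧
    neg-homo (+ zero)  = sym -0#≈0#
    neg-homo (+ suc n) = refl
    neg-homo -[1+ n ]  = sym (-‿involutive _)

    *-homo-+- : ∀ m j → ⟦ + m ℤ.* j ⟧ ≈ ⟦ + m ⟧ * ⟦ j ⟧
    *-homo-+- m (+ n) = begin
      ⟦ + m ℤ.* + n ⟧      ≡⟨ ≡.cong ⟦_⟧ (ℤ.pos-* m n) ⟨
      (m ℕ.* n) · 1#       ≈⟨ ×1-homo-* m n ⟩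
      m · 1# * (n · 1#)    ∎
    *-homo-+- m -[1+ n ] = begin
      ⟦ + m ℤ.* -[1+ n ] ⟧          ≡⟨ ≡.cong ⟦_⟧ (ℤ.neg-distribʳ-* (+ m) (+ suc n)) ⟨
      ⟦ ℤ.- (+ m ℤ.* + suc n) ⟧     ≈⟨ neg-homo (+ m ℤ.* + suc n) ⟩
      - ⟦ + m ℤ.* + suc n ⟧         ≈⟨ -‿cong (*-homo-+- m (+ suc n)) ⟩
      - (m · 1# * (suc n · 1#))     ≈⟨ -‿distribʳ-* _ _ ⟩
      m · 1# * - (suc n · 1#)       ∎

    *-homo : ∀ i j → ⟦ i ℤ.* j ⟧ ≈ ⟦ i ⟧ * ⟦ j ⟧
    *-homo (+ m)    j = *-homo-+- m j
    *-homo -[1+ m ] j = begin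
      ⟦ -[1+ m ] ℤ.* j ⟧            ≡⟨ ≡.cong ⟦_⟧ (ℤ.neg-distribˡ-* (+ suc m) j) ⟨
      ⟦ ℤ.- (+ suc m ℤ.* j) ⟧       ≈⟨ neg-homo (+ suc m ℤ.* j) ⟩
      - ⟦ + suc m ℤ.* j ⟧           ≈⟨ -‿cong (*-homo-+- (suc m) j) ⟩
      - (suc m · 1# * ⟦ j ⟧)        ≈⟨ -‿distribˡ-* _ _ ⟩
      - (suc m · 1#) * ⟦ j ⟧        ∎

    morphism : ℤ.+-*-rawRing -Raw-AlmostCommutative⟶ fromCommutativeRing R
    morphism = record
      { ⟦_⟧ = ⟦_⟧ ; +-homo = +-homo ; *-homo = *-homo ; -‿homo = neg-homo
      ; 0-homo = refl ; 1-homo = refl }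

    _coeff≟_ : ∀ i j → Maybe (⟦ i ⟧ ≈ ⟦ j ⟧)
    i coeff≟ j = Maybe.map (λ { ≡.refl → refl }) (dec⇒weaklyDec ℤ._≟_ i j)

  open import Algebra.Solver.Ring ℤ.+-*-rawRing (fromCommutativeRing R) morphism _coeff≟_ public
    using (solve; _:+_; _:*_; _:-_; :-_; _:=_; con)

-- Arithmetic and order

module OrderedField {c ℓ₁ ℓ₂} (ℝ : RealField c ℓ₁ ℓ₂) where
  open RealField ℝ
  open IntegerSolver commutativeRing
  open import Algebra.Apartness.Properties.HeytingCommutativeRing heytingCommutativeRing
    using (1#0)
  open import Algebra.Properties.Ring (CommutativeRing.ring commutativeRing)
    using (-0#≈0#)
  open IsStrictPartialOrder isStrictPartialOrder public
    using () renaming (trans to <-trans; irrefl to <-irrefl)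
  private module < = IsStrictPartialOrder isStrictPartialOrder

  <-respʳ : ∀ {x y z} → y ≈ z → x < y → x < z
  <-respʳ = proj₁ <.<-resp-≈

  <-respˡ : ∀ {x y z} → y ≈ z → y < x → z < x
  <-respˡ = proj₂ <.<-resp-≈

  -- Stands in for trichotomy. As `≤` is a negated `<`, comparison with a third point is what turns
  -- a weak inequality next to a strict one into a strict one.
  <-cotrans : ∀ {x y} → x < y → ∀ z → x < z ⊎ z < y
  <-cotrans {x} {y} x<y z with #-cotrans (Equivalence.from (#⇔<⊎> x y) (inj₁ x<y)) z
  ... | inj₁ x#z with Equivalence.to (#⇔<⊎> x z) x#z
  ...   | inj₁ x<z = inj₁ x<z
  ...   | inj₂ z<x = inj₂ (<-trans z<x x<y)
  <-cotrans {x} {y} x<y z | inj₂ z#y with Equivalence.to (#⇔<⊎> z y) z#y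
  ...   | inj₁ z<y = inj₂ z<y
  ...   | inj₂ y<z = inj₁ (<-trans x<y y<z)

  ≤-refl : ∀ {x} → x ≤ x
  ≤-refl = <-irrefl refl

  ≤-reflexive : ∀ {x y} → x ≈ y → x ≤ y
  ≤-reflexive x≈y y<x = <-irrefl (sym x≈y) y<x

  <⇒≤ : ∀ {x y} → x < y → x ≤ y
  <⇒≤ x<y y<x = <-irrefl refl (<-trans x<y y<x)

  <-≤-trans : ∀ {x y z} → x < y → y ≤ z → x < z
  <-≤-trans {z = z} x<y y≤z with <-cotrans x<y z
  ... | inj₁ x<z = x<z
  ... | inj₂ z<y = ⊥-elim (y≤z z<y)

  ≤-<-trans : ∀ {x y z} → x ≤ y → y < z → x < z
  ≤-<-trans {x} x≤y y<z with <-cotrans y<z x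
  ... | inj₁ y<x = ⊥-elim (x≤y y<x)
  ... | inj₂ x<z = x<z

  ≤-trans : ∀ {x y z} → x ≤ y → y ≤ z → x ≤ z
  ≤-trans x≤y y≤z z<x = x≤y (≤-<-trans y≤z z<x)

  ≤-resp : ∀ {x x′ y y′} → x ≈ x′ → y ≈ y′ → x ≤ y → x′ ≤ y′
  ≤-resp x≈ y≈ x≤y = ≤-trans (≤-reflexive (sym x≈)) (≤-trans x≤y (≤-reflexive y≈))

  ≤-antisym : ∀ {x y} → x ≤ y → y ≤ x → x ≈ y
  ≤-antisym {x} {y} x≤y y≤x = proj₁ (tight x y) λ x#y → absurd (Equivalence.to (#⇔<⊎> x y) x#y)
    where
    absurd : x < y ⊎ y < x → ⊥
    absurd (inj₁ x<y) = y≤x x<y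
    absurd (inj₂ y<x) = x≤y y<x

  +-monoˡ-< : ∀ z {x y} → x < y → x + z < y + z
  +-monoˡ-< z x<y = <-respˡ (+-comm z _) (<-respʳ (+-comm z _) (+-monoʳ-< z x<y))

  +-cancelˡ-< : ∀ z {x y} → z + x < z + y → x < y
  +-cancelˡ-< z {x} {y} l = <-respˡ (e x) (<-respʳ (e y) (+-monoʳ-< (- z) l))
    where
    e : ∀ x → - z + (z + x) ≈ x
    e x = solve 2 (λ z x → :- z :+ (z :+ x) := x) refl z x

  +-monoʳ-≤ : ∀ z {x y} → x ≤ y → z + x ≤ z + y
  +-monoʳ-≤ z x≤y l = x≤y (+-cancelˡ-< z l)

  +-mono-≤ : ∀ {x y u v} → x ≤ y → u ≤ v → x + u ≤ y + v
  +-mono-≤ x≤y u≤v = ≤-trans (+-monoʳ-≤ _ u≤v)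
    (≤-resp (+-comm _ _) (+-comm _ _) (+-monoʳ-≤ _ x≤y))

  +-pos-nonNeg : ∀ {x y} → 0# < x → 0# ≤ y → 0# < x + y
  +-pos-nonNeg {x} {y} 0<x 0≤y =
    <-≤-trans 0<x (≤-resp (+-identityʳ x) refl (+-monoʳ-≤ x 0≤y))

  +-nonNeg-pos : ∀ {x y} → 0# ≤ x → 0# < y → 0# < x + y
  +-nonNeg-pos 0≤x 0<y = <-respʳ (+-comm _ _) (+-pos-nonNeg 0<y 0≤x)

  +-nonNeg : ∀ {x y} → 0# ≤ x → 0# ≤ y → 0# ≤ x + y
  +-nonNeg 0≤x 0≤y = ≤-resp (+-identityˡ 0#) refl (+-mono-≤ 0≤x 0≤y)

  neg-pos : ∀ {x} → x < 0# → 0# < - x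
  neg-pos {x} x<0 = <-respˡ (-‿inverseˡ x) (<-respʳ (+-identityʳ _) (+-monoʳ-< (- x) x<0))

  *-negneg : ∀ {x y} → x < 0# → y < 0# → 0# < x * y
  *-negneg {x} {y} x<0 y<0 =
    <-respʳ (solve 2 (λ x y → :- x :* :- y := x :* y) refl x y) (*-pos (neg-pos x<0) (neg-pos y<0))

  1-pos : 0# < 1#
  1-pos with Equivalence.to (#⇔<⊎> 1# 0#) 1#0
  ... | inj₁ 1<0 = <-respʳ (*-identityˡ 1#) (*-negneg 1<0 1<0)
  ... | inj₂ 0<1 = 0<1

  -- The sign of `x` is not decidable, but a case distinction on it is allowed when the goal is a
  -- negation, and every `≤` is one.
  trichotomy : ∀ x {ℓ} {A : Set ℓ} → (x < 0# → ¬ A) → (x ≈ 0# → ¬ A) → (0# < x → ¬ A) → ¬ A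
  trichotomy x n z p a = z (≤-antisym (λ l → p l a) (λ l → n l a)) a

  sq-nonNeg : ∀ x → 0# ≤ x * x
  sq-nonNeg x = trichotomy x (λ l → <⇒≤ (*-negneg l l))
    (λ e → ≤-reflexive (sym (trans (*-congˡ e) (solve 1 (λ x → x :* con (+ 0) := con (+ 0)) refl x))))
    (λ l → <⇒≤ (*-pos l l))

  *-nonNeg : ∀ {x y} → 0# ≤ x → 0# ≤ y → 0# ≤ x * y
  *-nonNeg {x} {y} 0≤x 0≤y = trichotomy x (λ l → ⊥-elim (0≤x l))
    (λ e → ≤-reflexive (sym (trans (*-congʳ e) (solve 1 (λ y → con (+ 0) :* y := con (+ 0)) refl y))))
    (λ 0<x → trichotomy y (λ l → ⊥-elim (0≤y l))
      (λ e → ≤-reflexive (sym (trans (*-congˡ e) (solve 1 (λ y → y :* con (+ 0) := con (+ 0)) refl x))))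
      (λ 0<y → <⇒≤ (*-pos 0<x 0<y)))

  x≤y⇒0≤y-x : ∀ {x y} → x ≤ y → 0# ≤ y - x
  x≤y⇒0≤y-x {x} {y} x≤y = ≤-resp (-‿inverseˡ x) (+-comm _ _) (+-monoʳ-≤ (- x) x≤y)

  0≤y-x⇒x≤y : ∀ {x y} → 0# ≤ y - x → x ≤ y
  0≤y-x⇒x≤y {x} {y} l = ≤-resp (+-identityʳ x)
    (solve 2 (λ x y → x :+ (y :- x) := y) refl x y) (+-monoʳ-≤ x l)

  *-monoˡ-≤ : ∀ {z x y} → 0# ≤ z → x ≤ y → z * x ≤ z * y
  *-monoˡ-≤ {z} {x} {y} 0≤z x≤y = 0≤y-x⇒x≤y
    (≤-resp refl (solve 3 (λ x y z → z :* (y :- x) := z :* y :- z :* x) refl x y z)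
      (*-nonNeg 0≤z (x≤y⇒0≤y-x x≤y)))

  *-cancelˡ-≤ : ∀ {z x y} → 0# < z → z * x ≤ z * y → x ≤ y
  *-cancelˡ-≤ {z} {x} {y} 0<z l y<x = l (<-respˡ (+-identityˡ _)
    (<-respʳ (solve 3 (λ x y z → z :* (x :- y) :+ z :* y := z :* x) refl x y z)
      (+-monoˡ-< (z * y) (*-pos 0<z 0<x-y))))
    where
    0<x-y : 0# < x - y
    0<x-y = <-respˡ (-‿inverseʳ y) (+-monoˡ-< (- y) y<x)

  inverseˡ : ∀ {x} (0<x : 0# < x) → inverse 0<x * x ≈ 1#
  inverseˡ {x} 0<x = trans (*-congˡ (sym (trans (+-congˡ -0#≈0#) (+-identityʳ x))))
    (proj₁ (proj₂ (#⇒invertible (Equivalence.from (#⇔<⊎> x 0#) (inj₂ 0<x)))))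

  -- Invertible elements are apart from 0, so the inverse has a sign; a negative one would make `1#`
  -- negative.
  inverse-pos : ∀ {x} (0<x : 0# < x) → 0# < inverse 0<x
  inverse-pos {x} 0<x = sign (Equivalence.to (#⇔<⊎> i 0#) i#0)
    where
    i = inverse 0<x
    i-0≈i : i - 0# ≈ i
    i-0≈i = trans (+-congˡ -0#≈0#) (+-identityʳ i)
    i#0 : i # 0#
    i#0 = invertible⇒# (x , trans (*-congˡ i-0≈i) (trans (*-comm x i) (inverseˡ 0<x))
                          , trans (*-congʳ i-0≈i) (inverseˡ 0<x))
    sign : i < 0# ⊎ 0# < i → 0# < i
    sign (inj₂ 0<i) = 0<i
    sign (inj₁ i<0) = ⊥-elim (<⇒≤ 1-pos (<-respˡ (trans (solve 2 (λ i x → :- (:- i :* x) := i :* x) refl i x) (inverseˡ 0<x))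
      (<-respʳ -0#≈0# (neg-mono (*-pos (neg-pos i<0) 0<x)))))
      where
      neg-mono : ∀ {y} → 0# < y → - y < - 0#
      neg-mono {y} l = <-respˡ (+-identityʳ (- y))
        (<-respʳ (trans (-‿inverseˡ y) (sym -0#≈0#)) (+-monoʳ-< (- y) l))

-- Partitions, contraction and Green functions

-- Identifying vertices coarsens the relation and leaves `Fin n` alone, so potentials on different
-- quotients are functions on one set and can be tested against each other.
record Partition (n : ℕ) : Set₁ where
  field
    _∼_              : Rel (Fin n) 0ℓ
    isDecEquivalence : IsDecEquivalence _∼_
  open IsDecEquivalence isDecEquivalence public

module _ {n : ℕ} where
  open Partition using () renaming (_∼_ to _⊢_∼_)

  infix 4 _⊑_ _≋_
  _⊑_ _≋_ : Partition n → Partition n → Set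
  π ⊑ ρ = ∀ {u v} → π ⊢ u ∼ v → ρ ⊢ u ∼ v
  π ≋ ρ = π ⊑ ρ × ρ ⊑ π

  Total : Partition n → Set
  Total π = ∀ u v → π ⊢ u ∼ v

  total? : ∀ π → Dec (Total π)
  total? π = Fin.all? λ u → Fin.all? λ v → Partition._≟_ π u v

  -- The generated equivalence in closed form, which keeps it decidable: two vertices are newly
  -- related when both lie in the union of the classes of `a` and `b`.
  contract : Partition n → Fin n → Fin n → Partition n
  contract π a b = record
    { _∼_              = λ u v → u ∼ v ⊎ (Merged u × Merged v)
    ; isDecEquivalence = record
      { isEquivalence = record
        { refl  = inj₁ refl
        ; sym   = λ { (inj₁ p) → inj₁ (sym p) ; (inj₂ (p , q)) → inj₂ (q , p) }
        ; trans = λ { (inj₁ p) (inj₁ q) → inj₁ (trans p q)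
                    ; (inj₁ p) (inj₂ (q , r)) → inj₂ (merged p q , r)
                    ; (inj₂ (p , q)) (inj₁ r) → inj₂ (p , merged (sym r) q)
                    ; (inj₂ (p , _)) (inj₂ (_ , q)) → inj₂ (p , q) }
        }
      ; _≟_ = λ u v → (u ≟ v) ⊎-dec (merged? u ×-dec merged? v)
      }
    }
    where
    open Partition π
    Merged : Fin n → Set
    Merged u = u ∼ a ⊎ u ∼ b
    merged? : ∀ u → Dec (Merged u)
    merged? u = (u ≟ a) ⊎-dec (u ≟ b)
    merged : ∀ {u v} → u ∼ v → Merged v → Merged u
    merged p (inj₁ q) = inj₁ (trans p q)
    merged p (inj₂ q) = inj₂ (trans p q)

  module _ (π : Partition n) where
    open Partition π

    contract-⊒ : ∀ a b → π ⊑ contract π a b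
    contract-⊒ a b = inj₁

    contract-joins : ∀ a b → contract π a b ⊢ a ∼ b
    contract-joins a b = inj₂ (inj₁ refl , inj₂ refl)

    -- The universal property of contraction; monotonicity, commutation and the effect of a loop are
    -- read off from it without inspecting classes.
    contract-least : ∀ {ρ a b} → π ⊑ ρ → ρ ⊢ a ∼ b → contract π a b ⊑ ρ
    contract-least π⊑ρ a∼b (inj₁ p) = π⊑ρ p
    contract-least {ρ} π⊑ρ a∼b (inj₂ (p , q)) = ρ.trans (to-a p) (ρ.sym (to-a q))
      where
      module ρ = Partition ρ
      to-a : ∀ {u} → u ∼ _ ⊎ u ∼ _ → u ρ.∼ _
      to-a (inj₁ p) = π⊑ρ p
      to-a (inj₂ p) = ρ.trans (π⊑ρ p) (ρ.sym a∼b)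

  contract-mono : ∀ {π ρ} a b → π ⊑ ρ → contract π a b ⊑ contract ρ a b
  contract-mono {π} {ρ} a b π⊑ρ =
    contract-least π {contract ρ a b} (λ p → inj₁ (π⊑ρ p)) (contract-joins ρ a b)

  contract-cong : ∀ {π ρ} a b → π ≋ ρ → contract π a b ≋ contract ρ a b
  contract-cong {π} {ρ} a b (p , q) = contract-mono {π} {ρ} a b p , contract-mono {ρ} {π} a b q

  contract-loop : ∀ π {a b} → π ⊢ a ∼ b → contract π a b ≋ π
  contract-loop π a∼b = contract-least π {π} (λ p → p) a∼b , inj₁

  contract-comm-⊑ : ∀ π a b c d → contract (contract π a b) c d ⊑ contract (contract π c d) a b
  contract-comm-⊑ π a b c d = contract-least (contract π a b) {ρ}
    (contract-least π {ρ} (λ p → inj₁ (inj₁ p)) (contract-joins (contract π c d) a b))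
    (inj₁ (contract-joins π c d))
    where ρ = contract (contract π c d) a b

  contract-comm : ∀ π a b c d → contract (contract π a b) c d ≋ contract (contract π c d) a b
  contract-comm π a b c d = contract-comm-⊑ π a b c d , contract-comm-⊑ π c d a b

  -- If `c` and `d` become joined only through `a` and `b`, one lies in the class of `a` and the
  -- other in that of `b`. The two edges are then parallel, a symmetric relation.
  parallel-sym : ∀ π {a b c d} → ¬ π ⊢ c ∼ d → contract π a b ⊢ c ∼ d → contract π c d ⊢ a ∼ b
  parallel-sym π {a} {b} {c} {d} c≁d = parallel
    where
    open Partition π
    parallel : contract π a b ⊢ c ∼ d → contract π c d ⊢ a ∼ b
    parallel (inj₁ c∼d) = contradiction c∼d c≁d
    parallel (inj₂ (inj₁ c∼a , inj₁ d∼a)) = contradiction (trans c∼a (sym d∼a)) c≁d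
    parallel (inj₂ (inj₂ c∼b , inj₂ d∼b)) = contradiction (trans c∼b (sym d∼b)) c≁d
    parallel (inj₂ (inj₁ c∼a , inj₂ d∼b)) = inj₂ (inj₁ (sym c∼a) , inj₂ (sym d∼b))
    parallel (inj₂ (inj₂ c∼b , inj₁ d∼a)) = inj₂ (inj₂ (sym d∼a) , inj₁ (sym c∼b))

module Contraction {c ℓ} (K : CommutativeRing c ℓ) {n : ℕ} where
  open CommutativeRing K
  private module π = Partition
  open π using () renaming (_∼_ to _⊢_∼_)

  -- The value 0 at a loop is essential: contracting a loop changes nothing, yet no spanning tree
  -- uses it.
  contracted : (Partition n → Carrier) → Partition n → Fin n → Fin n → Carrier
  contracted Θ π a b = if does (π._≟_ π a b) then 0# else Θ (contract π a b)

  Congruent : (Partition n → Carrier) → Set (lsuc 0ℓ ⊔ ℓ)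
  Congruent Θ = ∀ π ρ → π ≋ ρ → Θ π ≈ Θ ρ

  module _ (Θ : Partition n → Carrier) where

    contracted-loop : ∀ π {a b} → π ⊢ a ∼ b → contracted Θ π a b ≈ 0#
    contracted-loop π {a} {b} a∼b rewrite dec-true (π._≟_ π a b) a∼b = refl

    contracted-link : ∀ π {a b} → ¬ π ⊢ a ∼ b → contracted Θ π a b ≈ Θ (contract π a b)
    contracted-link π {a} {b} a≁b rewrite dec-false (π._≟_ π a b) a≁b = refl

    contracted-cong : Congruent Θ → ∀ a b → Congruent (λ π → contracted Θ π a b)
    contracted-cong cong a b π ρ π≋ρ = go (π._≟_ π a b)
      where
      go : Dec (π ⊢ a ∼ b) → contracted Θ π a b ≈ contracted Θ ρ a b
      go (yes p) = trans (contracted-loop π p) (sym (contracted-loop ρ (proj₁ π≋ρ p)))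
      go (no ¬p) = trans (contracted-link π ¬p)
        (trans (cong _ _ (contract-cong {π = π} {ρ} a b π≋ρ)) (sym (contracted-link ρ (λ q → ¬p (proj₂ π≋ρ q)))))

    contracted-comm : Congruent Θ → ∀ π {a b c d} → ¬ π ⊢ a ∼ b → ¬ π ⊢ c ∼ d →
                      contracted Θ (contract π a b) c d ≈ contracted Θ (contract π c d) a b
    contracted-comm cong π {a} {b} {c} {d} a≁b c≁d = go (π._≟_ (contract π a b) c d)
      where
      go : Dec (contract π a b ⊢ c ∼ d) →
           contracted Θ (contract π a b) c d ≈ contracted Θ (contract π c d) a b
      go (yes p) = trans (contracted-loop (contract π a b) p)
        (sym (contracted-loop (contract π c d) (parallel-sym π c≁d p)))
      go (no ¬p) = trans (contracted-link (contract π a b) ¬p)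
        (trans (cong _ _ (contract-comm π a b c d))
          (sym (contracted-link (contract π c d) (λ q → ¬p (parallel-sym π a≁b q)))))

  -- Deletion and contraction of a new edge: `α` weights the trees avoiding it, `β` those using it.
  -- The electrical conductance of the edge is the ratio of `β` to `α`.
  extend : (Partition n → Carrier) → Carrier → Carrier → Fin n → Fin n → Partition n → Carrier
  extend Θ α β s t π = α * Θ π + β * contracted Θ π s t

  extend-cong : ∀ {Θ} → Congruent Θ → ∀ α β s t → Congruent (extend Θ α β s t)
  extend-cong {Θ} cong α β s t π ρ π≋ρ =
    +-cong (*-congˡ (cong π ρ π≋ρ)) (*-congˡ (contracted-cong Θ cong s t π ρ π≋ρ))

module Potential {c ℓ} (K : CommutativeRing c ℓ) {n : ℕ} where
  open CommutativeRing K
  open Contraction K {n}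
  open IntegerSolver K
  open SetoidReasoning setoid
  private module π = Partition
  open π using () renaming (_∼_ to _⊢_∼_)

  Respects : Partition n → (Fin n → Carrier) → Set ℓ
  Respects π u = ∀ {i j} → π ⊢ i ∼ j → u i ≈ u j

  infix 8 _⟨_,_⟩
  _⟨_,_⟩ : (Fin n → Carrier) → Fin n → Fin n → Carrier
  u ⟨ a , b ⟩ = u a - u b

  ⟨⟩-respects : ∀ {π u a b} → Respects π u → π ⊢ a ∼ b → u ⟨ a , b ⟩ ≈ 0#
  ⟨⟩-respects resp a∼b = trans (+-congʳ (resp a∼b)) (-‿inverseʳ _)

  -- Linearity in the second argument comes from `form-sym`. `form-cong` is a field because
  -- pointwise equal potentials need not be equal functions.
  record SymmetricForm : Set (c ⊔ ℓ) where
    field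
      form     : (u w : Fin n → Carrier) → Carrier
      form-cong : ∀ {u v} w → (∀ i → u i ≈ v i) → form u w ≈ form v w
      form-sym : ∀ u w → form u w ≈ form w u
      form-lin : ∀ x u y v w → form (λ i → x * u i + y * v i) w ≈ x * form u w + y * form v w
  open SymmetricForm public

  zeroForm : SymmetricForm
  zeroForm = record
    { form     = λ _ _ → 0#
    ; form-cong = λ _ _ → refl
    ; form-sym = λ _ _ → refl
    ; form-lin = λ x _ y _ _ → solve 2 (λ x y → con (+ 0) := x :* con (+ 0) :+ y :* con (+ 0)) refl x y
    }

  module _ (Q : SymmetricForm) (s t : Fin n) (y : Carrier) where
    private
      form′ : (u w : Fin n → Carrier) → Carrier
      form′ u w = form Q u w + y * (u ⟨ s , t ⟩ * w ⟨ s , t ⟩)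

      abstract
        form′-lin : ∀ x u x′ v w → form′ (λ i → x * u i + x′ * v i) w ≈ x * form′ u w + x′ * form′ v w
        form′-lin x u x′ v w = trans (+-congʳ (form-lin Q x u x′ v w))
          (solve 11 (λ x x′ q q′ y us ut vs vt ws wt →
             (x :* q :+ x′ :* q′) :+ y :* (((x :* us :+ x′ :* vs) :- (x :* ut :+ x′ :* vt)) :* (ws :- wt))
             := x :* (q :+ y :* ((us :- ut) :* (ws :- wt))) :+ x′ :* (q′ :+ y :* ((vs :- vt) :* (ws :- wt))))
           refl x x′ (form Q u w) (form Q v w) y (u s) (u t) (v s) (v t) (w s) (w t))

    addEdge : SymmetricForm
    addEdge = record
      { form      = form′
      ; form-cong = λ w e → +-cong (form-cong Q w e) (*-congˡ (*-congʳ (+-cong (e s) (-‿cong (e t)))))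
      ; form-sym  = λ u w → +-cong (form-sym Q u w) (*-congˡ (*-comm _ _))
      ; form-lin  = form′-lin
      }

  -- A potential driving a unit current from a to b through the network with
  -- energy form Q and classes of π short-circuited; Θ is its spanning tree
  -- polynomial, so that the voltage drop is the ratio Θ (π / ab) / Θ π.
  record Green (Θ : Partition n → Carrier) (Q : SymmetricForm) (π : Partition n) (a b : Fin n) : Set (c ⊔ ℓ) where
    field
      potential : Fin n → Carrier
      respects  : Respects π potential
      weak      : ∀ w → Respects π w → form Q potential w ≈ w ⟨ a , b ⟩
      drop      : Θ π * potential ⟨ a , b ⟩ ≈ contracted Θ π a b
  open Green public

  form-zeroˡ : ∀ Q w → form Q (λ _ → 0#) w ≈ 0#
  form-zeroˡ Q w = begin
    form Q z w                             ≈⟨ form-cong Q w (λ _ → solve 0 (con (+ 0) := con (+ 0) :* con (+ 0) :+ con (+ 0) :* con (+ 0)) refl) ⟩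
    form Q (λ i → 0# * z i + 0# * z i) w   ≈⟨ form-lin Q 0# z 0# z w ⟩
    0# * form Q z w + 0# * form Q z w      ≈⟨ solve 1 (λ q → con (+ 0) :* q :+ con (+ 0) :* q := con (+ 0)) refl _ ⟩
    0#                                     ∎
    where z = λ (_ : Fin n) → 0#

  green-trivial : ∀ {Θ Q π a b} → π ⊢ a ∼ b → Green Θ Q π a b
  green-trivial {Θ} {Q} {π} a∼b = record
    { potential = λ _ → 0#
    ; respects  = λ _ → refl
    ; weak      = λ w resp → trans (form-zeroˡ Q w) (sym (⟨⟩-respects {π} resp a∼b))
    ; drop      = trans (solve 1 (λ x → x :* (con (+ 0) :- con (+ 0)) := con (+ 0)) refl _)
                    (sym (contracted-loop Θ π a∼b))
    }

  -- Each potential is an admissible test function for the other, and the form is symmetric.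
  reciprocity : ∀ {Θ Θ′ Q π a b c d} (G : Green Θ Q π a b) (H : Green Θ′ Q π c d) →
                potential G ⟨ c , d ⟩ ≈ potential H ⟨ a , b ⟩
  reciprocity {Q = Q} G H = begin
    potential G ⟨ _ , _ ⟩            ≈⟨ weak H _ (respects G) ⟨
    form Q (potential H) (potential G) ≈⟨ form-sym Q _ _ ⟩
    form Q (potential G) (potential H) ≈⟨ weak G _ (respects H) ⟩
    potential H ⟨ _ , _ ⟩            ∎

  module _ {Θ : Partition n → Carrier} (cong : Congruent Θ) (Q : SymmetricForm)
           (π : Partition n) (α β y : Carrier) (s t : Fin n) where
    private
      Θ′ = extend Θ α β s t
      Q′ = addEdge Q s t y

    -- The old potential takes equal values at `s` and `t`, so no current enters the new edge; the
    -- edge remains a loop after `a` and `b` are joined, so both tree sums are just scaled by `α`.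
    green-loop : ∀ {a b} → π ⊢ s ∼ t → Green Θ Q π a b → Green Θ′ Q′ π a b
    green-loop {a} {b} s∼t G = go (π._≟_ π a b)
      where
      u = potential G
      go : Dec (π ⊢ a ∼ b) → Green Θ′ Q′ π a b
      go (yes a∼b) = green-trivial a∼b
      go (no a≁b) = record
        { potential = potential G
        ; respects  = respects G
        ; weak      = λ w resp → begin
            form Q u w + y * (u ⟨ s , t ⟩ * w ⟨ s , t ⟩)  ≈⟨ +-cong (weak G w resp) (*-congˡ (*-congʳ (⟨⟩-respects {π} (respects G) s∼t))) ⟩
            w ⟨ a , b ⟩ + y * (0# * w ⟨ s , t ⟩)          ≈⟨ solve 3 (λ l y v → l :+ y :* (con (+ 0) :* v) := l) refl _ y _ ⟩
            w ⟨ a , b ⟩                                   ∎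
        ; drop      = begin
            (α * Θ π + β * contracted Θ π s t) * u ⟨ a , b ⟩  ≈⟨ *-congʳ (+-congˡ (*-congˡ (contracted-loop Θ π s∼t))) ⟩
            (α * Θ π + β * 0#) * u ⟨ a , b ⟩                  ≈⟨ solve 4 (λ α A β l → (α :* A :+ β :* con (+ 0)) :* l := α :* (A :* l) :+ β :* con (+ 0)) refl α _ β _ ⟩
            α * (Θ π * u ⟨ a , b ⟩) + β * 0#                  ≈⟨ +-cong (*-congˡ (trans (drop G) (contracted-link Θ π a≁b))) (*-congˡ (sym (contracted-loop Θ (contract π a b) (contract-⊒ π a b s∼t)))) ⟩
            extend Θ α β s t (contract π a b)                 ≈⟨ contracted-link Θ′ π a≁b ⟨
            contracted Θ′ π a b                               ∎
        }

    private
      -- Short-circuiting `s` and `t` lowers the resistance between `a` and `b` by the square of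
      -- `potential G ⟨ s , t ⟩` over the resistance `r` between `s` and `t`. Multiplying by the
      -- tree sums removes the division by `r`, for which no inverse is at hand.
      contracted-link-drop : ∀ {a b} → ¬ π ⊢ s ∼ t →
        (G : Green Θ Q π a b) (E : Green Θ Q π s t) (G″ : Green Θ Q (contract π s t) a b) →
        contracted Θ (contract π s t) a b ≈
        contracted Θ π s t * potential G ⟨ a , b ⟩ - Θ π * (potential G ⟨ s , t ⟩ * potential G ⟨ s , t ⟩)
      contracted-link-drop {a} {b} s≁t G E G″ = begin
        contracted Θ (contract π s t) a b     ≈⟨ drop G″ ⟨
        Θ (contract π s t) * lu″              ≈⟨ *-congʳ (trans (drop E) (contracted-link Θ π s≁t)) ⟨
        (Θ π * r) * lu″                       ≈⟨ *-assoc _ _ _ ⟩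
        Θ π * (r * lu″)                       ≈⟨ *-congˡ pairing ⟩
        Θ π * (r * lu - vu * potential E ⟨ a , b ⟩) ≈⟨ *-congˡ (+-congˡ (-‿cong (*-congˡ (reciprocity E G)))) ⟩
        Θ π * (r * lu - vu * vu)              ≈⟨ solve 4 (λ A r l v → A :* (r :* l :- v :* v) := (A :* r) :* l :- A :* (v :* v)) refl _ _ _ _ ⟩
        (Θ π * r) * lu - Θ π * (vu * vu)      ≈⟨ +-congʳ (*-congʳ (drop E)) ⟩
        contracted Θ π s t * lu - Θ π * (vu * vu) ∎
        where
        u   = potential G
        u″  = potential G″
        r   = potential E ⟨ s , t ⟩
        lu  = u ⟨ a , b ⟩
        lu″ = u″ ⟨ a , b ⟩
        vu  = u ⟨ s , t ⟩
        -- r u − v(u) e vanishes across the edge, hence is an admissible test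
        -- function for u″.
        w : Fin n → Carrier
        w i = r * u i + (- vu) * potential E i
        w-st : w s ≈ w t
        w-st = begin
          r * u s + (- vu) * potential E s ≈⟨ solve 4 (λ us ut es et → (es :- et) :* us :+ (:- (us :- ut)) :* es := (es :- et) :* ut :+ (:- (us :- ut)) :* et) refl (u s) (u t) (potential E s) (potential E t) ⟩
          r * u t + (- vu) * potential E t ∎
        w-π : Respects π w
        w-π p = +-cong (*-congˡ (respects G p)) (*-congˡ (respects E p))
        w-respects : Respects (contract π s t) w
        w-respects (inj₁ p) = w-π p
        w-respects (inj₂ (p , q)) = trans (to-s p) (sym (to-s q))
          where
          to-s : ∀ {i} → π ⊢ i ∼ s ⊎ π ⊢ i ∼ t → w i ≈ w s
          to-s (inj₁ p) = w-π p
          to-s (inj₂ p) = trans (w-π p) (sym w-st)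
        pairing : r * lu″ ≈ r * lu - vu * potential E ⟨ a , b ⟩
        -- The pairing of `w` with `u″` is computed twice: with `u″` as test function for `G` and
        -- `E`, and with `w` as test function for `G″`.
        pairing = begin
          r * lu″                                  ≈⟨ solve 3 (λ r l v → r :* l := r :* l :+ (:- v) :* con (+ 0)) refl r lu″ vu ⟩
          r * lu″ + (- vu) * 0#                    ≈⟨ +-congˡ (*-congˡ (⟨⟩-respects {contract π s t} (respects G″) (contract-joins π s t))) ⟨
          r * lu″ + (- vu) * u″ ⟨ s , t ⟩          ≈⟨ +-cong (*-congˡ (weak G u″ resp″)) (*-congˡ (weak E u″ resp″)) ⟨
          r * form Q u u″ + (- vu) * form Q (potential E) u″ ≈⟨ form-lin Q r u (- vu) (potential E) u″ ⟨
          form Q w u″                              ≈⟨ form-sym Q w u″ ⟩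
          form Q u″ w                              ≈⟨ weak G″ w w-respects ⟩
          w ⟨ a , b ⟩                              ≈⟨ solve 6 (λ r v ua ub ea eb → (r :* ua :+ (:- v) :* ea) :- (r :* ub :+ (:- v) :* eb) := r :* (ua :- ub) :- v :* (ea :- eb)) refl r vu (u a) (u b) (potential E a) (potential E b) ⟩
          r * lu - vu * potential E ⟨ a , b ⟩      ∎
          where
          resp″ : Respects π u″
          resp″ p = respects G″ (inj₁ p)

    -- Superposition: seen from the old network, a new edge carrying current `κ` from `s` to `t` is
    -- a source withdrawing `κ` there, so the new potential is that of `G` minus `κ` times that of
    -- `E`. `G″` enters only through the tree sum with both pairs contracted.
    green-link : ∀ {a b} → ¬ π ⊢ s ∼ t → β ≈ α * y → ∀ i → i * Θ′ π ≈ 1# →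
      Green Θ Q π a b → Green Θ Q π s t → Green Θ Q (contract π s t) a b → Green Θ′ Q′ π a b
    green-link {a} {b} s≁t β≈αy i iΘ′≈1 G E G″ = go (π._≟_ π a b)
      where
      A  = Θ π
      B  = contracted Θ π s t
      u  = potential G
      e  = potential E
      r  = e ⟨ s , t ⟩
      vu = u ⟨ s , t ⟩
      lu = u ⟨ a , b ⟩
      -- The current through the new edge satisfies `κ * (1# + y * r) ≈ y * vu`. The factor
      -- `1# + y * r` is inverted through `Θ′ π`, which is `α * A` times it.
      κ  = (y * vu) * (α * A) * i
      u′st = (1# * u s + (- κ) * e s) - (1# * u t + (- κ) * e t)
      κΘ′ : κ * Θ′ π ≈ (y * vu) * (α * A)
      κΘ′ = trans (*-assoc _ _ _) (trans (*-congˡ iΘ′≈1) (*-identityʳ _))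
      Θ′-eq : (α * A) * (1# + y * r) ≈ Θ′ π
      Θ′-eq = begin
        (α * A) * (1# + y * r)       ≈⟨ solve 4 (λ α A y r → (α :* A) :* (con (+ 1) :+ y :* r) := α :* A :+ (α :* y) :* (A :* r)) refl α A y r ⟩
        α * A + (α * y) * (A * r)    ≈⟨ +-congˡ (*-cong (sym β≈αy) (drop E)) ⟩
        Θ′ π                         ∎
      κ-eq : κ * (1# + y * r) ≈ y * vu
      κ-eq = begin
        (y * vu) * (α * A) * i * (1# + y * r)    ≈⟨ solve 4 (λ x z i d → x :* z :* i :* d := x :* (i :* (z :* d))) refl (y * vu) (α * A) i (1# + y * r) ⟩
        y * vu * (i * ((α * A) * (1# + y * r)))  ≈⟨ *-congˡ (trans (*-congˡ Θ′-eq) iΘ′≈1) ⟩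
        y * vu * 1#                              ≈⟨ *-identityʳ _ ⟩
        y * vu                                   ∎
      go : Dec (π ⊢ a ∼ b) → Green Θ′ Q′ π a b
      go (yes a∼b) = green-trivial a∼b
      go (no a≁b) = record
        { potential = λ v → 1# * u v + (- κ) * e v
        ; respects  = λ p → +-cong (*-congˡ (respects G p)) (*-congˡ (respects E p))
        ; weak      = λ w resp → begin
            form Q (λ v → 1# * u v + (- κ) * e v) w + y * (u′st * w ⟨ s , t ⟩)
              ≈⟨ +-congʳ (trans (form-lin Q 1# u (- κ) e w) (+-cong (*-congˡ (weak G w resp)) (*-congˡ (weak E w resp)))) ⟩
            1# * w ⟨ a , b ⟩ + (- κ) * w ⟨ s , t ⟩ + y * (u′st * w ⟨ s , t ⟩)
              ≈⟨ solve 8 (λ l v κ y us ut es et →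
                   con (+ 1) :* l :+ (:- κ) :* v :+ y :* (((con (+ 1) :* us :+ (:- κ) :* es) :- (con (+ 1) :* ut :+ (:- κ) :* et)) :* v)
                   := l :+ (y :* (us :- ut) :- κ :* (con (+ 1) :+ y :* (es :- et))) :* v) refl
                   (w ⟨ a , b ⟩) (w ⟨ s , t ⟩) κ y (u s) (u t) (e s) (e t) ⟩
            w ⟨ a , b ⟩ + (y * vu - κ * (1# + y * r)) * w ⟨ s , t ⟩
              ≈⟨ +-congˡ (*-congʳ (+-congˡ (-‿cong κ-eq))) ⟩
            w ⟨ a , b ⟩ + (y * vu - y * vu) * w ⟨ s , t ⟩
              ≈⟨ solve 3 (λ l x v → l :+ (x :- x) :* v := l) refl _ _ _ ⟩
            w ⟨ a , b ⟩ ∎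
        ; drop      = begin
            Θ′ π * ((1# * u a + (- κ) * e a) - (1# * u b + (- κ) * e b))
              ≈⟨ solve 6 (λ T κ ua ub ea eb → T :* ((con (+ 1) :* ua :+ (:- κ) :* ea) :- (con (+ 1) :* ub :+ (:- κ) :* eb))
                   := T :* (ua :- ub) :- (κ :* T) :* (ea :- eb)) refl (Θ′ π) κ (u a) (u b) (e a) (e b) ⟩
            Θ′ π * u ⟨ a , b ⟩ - (κ * Θ′ π) * e ⟨ a , b ⟩
              ≈⟨ +-congˡ (-‿cong (*-cong κΘ′ (reciprocity E G))) ⟩
            (α * A + β * B) * lu - ((y * vu) * (α * A)) * vu
              ≈⟨ solve 7 (λ α A β B l y v → (α :* A :+ β :* B) :* l :- ((y :* v) :* (α :* A)) :* v
                   := α :* (A :* l) :+ (β :* (B :* l) :- (α :* y) :* (A :* (v :* v)))) refl α A β B lu y vu ⟩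
            α * (A * lu) + (β * (B * lu) - (α * y) * (A * (vu * vu)))
              ≈⟨ +-congˡ (+-congˡ (-‿cong (*-congʳ (sym β≈αy)))) ⟩
            α * (A * lu) + (β * (B * lu) - β * (A * (vu * vu)))
              ≈⟨ +-cong (*-congˡ (drop G)) (solve 3 (λ β x y → β :* x :- β :* y := β :* (x :- y)) refl β _ _) ⟩
            α * contracted Θ π a b + β * (B * lu - A * (vu * vu))
              ≈⟨ +-congˡ (*-congˡ (contracted-link-drop s≁t G E G″)) ⟨
            α * contracted Θ π a b + β * contracted Θ (contract π s t) a b
              ≈⟨ +-cong (*-congˡ (contracted-link Θ π a≁b)) (*-congˡ (contracted-comm Θ cong π s≁t a≁b)) ⟩
            extend Θ α β s t (contract π a b)
              ≈⟨ contracted-link Θ′ π a≁b ⟨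
            contracted Θ′ π a b ∎
        }

-- Matrix-tree theorem

kernel : ∀ {n} {A : Set} → DecidableEquality A → (Fin n → A) → Partition n
kernel _≟_ f = record { isDecEquivalence = On.isDecEquivalence f (≡.isDecEquivalence _≟_) }

module Closure {n : ℕ} {e} {E : Set e} (src tgt : E → Fin n) where
  open Partition using () renaming (_∼_ to _⊢_∼_)

  closure : Partition n → List E → Partition n
  closure π []       = π
  closure π (e ∷ es) = closure (contract π (src e) (tgt e)) es

  closure-mono : ∀ es {π ρ} → π ⊑ ρ → closure π es ⊑ closure ρ es
  closure-mono []       π⊑ρ = π⊑ρ
  closure-mono (e ∷ es) {π} {ρ} π⊑ρ =
    closure-mono es {contract π _ _} {contract ρ _ _} (contract-mono {π = π} {ρ} _ _ π⊑ρ)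

  closure-⊒ : ∀ es π → π ⊑ closure π es
  closure-⊒ []       π p = p
  closure-⊒ (e ∷ es) π p = closure-⊒ es (contract π _ _) (inj₁ p)

  closure-edges : ∀ es π → All (λ e → closure π es ⊢ src e ∼ tgt e) es
  closure-edges []       π = []
  closure-edges (e ∷ es) π =
    closure-⊒ es (contract π _ _) (contract-joins π _ _) ∷ closure-edges es (contract π _ _)

  closure-least : ∀ es {π} ρ → π ⊑ ρ → All (λ e → ρ ⊢ src e ∼ tgt e) es → closure π es ⊑ ρ
  closure-least []       ρ π⊑ρ []      = π⊑ρ
  closure-least (e ∷ es) {π} ρ π⊑ρ (p ∷ ps) =
    closure-least es {contract π _ _} ρ (contract-least π {ρ} π⊑ρ p) ps

module TreeSum {c ℓ₁ ℓ₂} (ℝ : RealField c ℓ₁ ℓ₂) {n : ℕ} where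
  open RealField ℝ
  open OrderedField ℝ
  open IntegerSolver commutativeRing
  open Contraction commutativeRing {n}
  open Potential commutativeRing {n}
  open SetoidReasoning (CommutativeRing.setoid commutativeRing)
  private module π = Partition
  open π using () renaming (_∼_ to _⊢_∼_)

  record Resistor : Set c where
    constructor resistor
    field
      src tgt     : Fin n
      conductance : Carrier
  open Resistor public

  open Closure src tgt public

  totality : Partition n → Carrier
  totality π = if does (total? π) then 1# else 0#

  treeSum : List Resistor → Partition n → Carrier
  treeSum []                    = totality
  treeSum (resistor s t g ∷ es) = extend (treeSum es) 1# g s t

  energy : List Resistor → SymmetricForm
  energy []                    = zeroForm
  energy (resistor s t g ∷ es) = addEdge (energy es) s t g

  totality-yes : ∀ {π} → Total π → totality π ≈ 1#
  totality-yes {π} p rewrite dec-true (total? π) p = refl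

  totality-no : ∀ {π} → ¬ Total π → totality π ≈ 0#
  totality-no {π} p rewrite dec-false (total? π) p = refl

  totality-⇔ : ∀ π ρ → (Total π → Total ρ) → (Total ρ → Total π) → totality π ≈ totality ρ
  totality-⇔ π ρ f g = go (total? π)
    where
    go : Dec (Total π) → totality π ≈ totality ρ
    go (yes p) = trans (totality-yes {π} p) (sym (totality-yes {ρ} (f p)))
    go (no ¬p) = trans (totality-no {π} ¬p) (sym (totality-no {ρ} (λ q → ¬p (g q))))

  treeSum-cong : ∀ es → Congruent (treeSum es)
  treeSum-cong []       π ρ (p , q) = totality-⇔ π ρ (λ f u v → p (f u v)) (λ f u v → q (f u v))
  treeSum-cong (e ∷ es) = extend-cong (treeSum-cong es) 1# (conductance e) (src e) (tgt e)

  treeSum-disconnected : ∀ es π → ¬ Total (closure π es) → treeSum es π ≈ 0#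
  treeSum-disconnected []                    π ¬t = totality-no {π} ¬t
  treeSum-disconnected (resistor s t g ∷ es) π ¬t = begin
    1# * treeSum es π + g * contracted (treeSum es) π s t
      ≈⟨ +-cong (*-congˡ (treeSum-disconnected es π λ f → ¬t λ u v → closure-mono es {π} {contract π s t} inj₁ (f u v)))
                (*-congˡ (go (π._≟_ π s t))) ⟩
    1# * 0# + g * 0#
      ≈⟨ solve 1 (λ g → con (+ 1) :* con (+ 0) :+ g :* con (+ 0) := con (+ 0)) refl g ⟩
    0# ∎
    where
    go : Dec (π ⊢ s ∼ t) → contracted (treeSum es) π s t ≈ 0#
    go (yes p) = contracted-loop (treeSum es) π p
    go (no ¬p) = trans (contracted-link (treeSum es) π ¬p) (treeSum-disconnected es (contract π s t) ¬t)

  module _ (χ : Fin n → Bool) where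
    private
      -- Every class of `π` lies on one side of the cut, so contracting across it merges one class
      -- from each side and joins no further vertices within a side.
      two-sided : ∀ π {a b x y} → π ⊑ kernel Bool._≟_ χ → χ a ≢ χ b → χ x ≡ χ y →
                  contract π a b ⊢ x ∼ y → π ⊢ x ∼ y
      two-sided π π⊑χ a≢b x≡y (inj₁ p) = p
      two-sided π π⊑χ a≢b x≡y (inj₂ (inj₁ p , inj₁ q)) = π.trans π p (π.sym π q)
      two-sided π π⊑χ a≢b x≡y (inj₂ (inj₂ p , inj₂ q)) = π.trans π p (π.sym π q)
      two-sided π π⊑χ a≢b x≡y (inj₂ (inj₁ p , inj₂ q)) =
        contradiction (≡.trans (≡.sym (π⊑χ p)) (≡.trans x≡y (π⊑χ q))) a≢b
      two-sided π π⊑χ a≢b x≡y (inj₂ (inj₂ p , inj₁ q)) =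
        contradiction (≡.trans (≡.sym (π⊑χ q)) (≡.trans (≡.sym x≡y) (π⊑χ p))) a≢b

      total-transfer : ∀ π {a b s t} → π ⊑ kernel Bool._≟_ χ → χ s ≢ χ t →
                       Total (contract π a b) → Total (contract π s t)
      total-transfer π {a} {b} {s} {t} π⊑χ s≢t tot u v =
        contract-least π {contract π s t} inj₁ (swap (tot s t)) (tot u v)
        where
        swap : contract π a b ⊢ s ∼ t → contract π s t ⊢ a ∼ b
        swap = parallel-sym π (λ p → s≢t (π⊑χ p))

    -- Once a and b, and s and t, lie on opposite sides of a cut containing no
    -- edge, joining a to b or s to t has the same effect.
    treeSum-across : ∀ es π {a b s t} → π ⊑ kernel Bool._≟_ χ →
      All (λ e → χ (src e) ≡ χ (tgt e)) es → χ a ≢ χ b → χ s ≢ χ t →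
      treeSum es (contract π a b) ≈ treeSum es (contract π s t)
    treeSum-across [] π {a} {b} {s} {t} π⊑χ [] a≢b s≢t =
      totality-⇔ (contract π a b) (contract π s t)
        (total-transfer π π⊑χ s≢t) (total-transfer π π⊑χ a≢b)
    treeSum-across (resistor x y g ∷ es) π {a} {b} {s} {t} π⊑χ (x≡y ∷ es≡) a≢b s≢t =
      +-cong (*-congˡ (treeSum-across es π π⊑χ es≡ a≢b s≢t)) (*-congˡ (go (π._≟_ π x y)))
      where
      Θ = treeSum es
      go : Dec (π ⊢ x ∼ y) → contracted Θ (contract π a b) x y ≈ contracted Θ (contract π s t) x y
      go (yes p) = trans (contracted-loop Θ (contract π a b) (inj₁ p))
                         (sym (contracted-loop Θ (contract π s t) (inj₁ p)))
      go (no ¬p) = trans (to a≢b) (trans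
        (treeSum-across es (contract π x y)
          (contract-least π {kernel Bool._≟_ χ} π⊑χ x≡y) es≡ a≢b s≢t)
        (sym (to s≢t)))
        where
        to : ∀ {i j} → χ i ≢ χ j → contracted Θ (contract π i j) x y ≈ Θ (contract (contract π x y) i j)
        to {i} {j} i≢j = trans (contracted-link Θ (contract π i j) λ q → ¬p (two-sided π π⊑χ i≢j x≡y q))
          (treeSum-cong es _ _ (contract-comm π i j x y))

  energy-constant : ∀ es {u} w → All (λ e → u (src e) ≈ u (tgt e)) es → form (energy es) u w ≈ 0#
  energy-constant []                    w []       = refl
  energy-constant (resistor s t g ∷ es) {u} w (p ∷ ps) = begin
    form (energy es) u w + g * (u ⟨ s , t ⟩ * w ⟨ s , t ⟩) ≈⟨ +-cong (energy-constant es w ps) (*-congˡ (*-congʳ (trans (+-congʳ p) (-‿inverseʳ (u t))))) ⟩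
    0# + g * (0# * w ⟨ s , t ⟩)  ≈⟨ solve 2 (λ g v → con (+ 0) :+ g :* (con (+ 0) :* v) := con (+ 0)) refl g _ ⟩
    0#                           ∎

  -- Without the edge the tree sum vanishes and no potential drives a current from `s` to `t`, so
  -- `green-link` does not apply. The potential is taken from the network with `s` and `t`
  -- short-circuited and then corrected by a step across the bridge.
  module Bridge (es : List Resistor) (π : Partition n) (s t : Fin n) {g : Carrier} (0<g : 0# < g)
    (¬total : ¬ Total (closure π es)) (total : Total (closure (contract π s t) es)) where
    private
      Θ = treeSum es
      Q = energy es
      J = closure π es

      s≁ᴶt : ¬ J ⊢ s ∼ t
      s≁ᴶt p = ¬total λ u v →
        closure-least es {contract π s t} J
          (contract-least π {J} (closure-⊒ es π) p) (closure-edges es π) (total u v)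

      χ : Fin n → Bool
      χ v = does (π._≟_ J v s)

      χs : χ s ≡ true
      χs = dec-true (π._≟_ J s s) (π.refl J)

      χt : χ t ≡ false
      χt = dec-false (π._≟_ J t s) (λ p → s≁ᴶt (π.sym J p))

      J⊑χ : J ⊑ kernel Bool._≟_ χ
      J⊑χ {u} {v} p with π._≟_ J v s
      ... | yes q = dec-true (π._≟_ J u s) (π.trans J p q)
      ... | no ¬q = dec-false (π._≟_ J u s) (λ r → ¬q (π.trans J (π.sym J p) r))

      s≢t : χ s ≢ χ t
      s≢t p with () ← ≡.trans (≡.sym χs) (≡.trans p χt)

      indicator : Bool → Carrier
      indicator b = if b then 1# else 0#

      -- The step: constant along every edge of `es`, hence invisible to `Q`, with drop `1#` from
      -- `s` to `t`.
      h : Fin n → Carrier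
      h v = indicator (χ v)

      h-const : All (λ e → h (src e) ≈ h (tgt e)) es
      h-const = All.map (λ p → reflexive (≡.cong indicator (J⊑χ p))) (closure-edges es π)

      h-st : h ⟨ s , t ⟩ ≈ 1#
      h-st rewrite χs | χt = solve 0 (con (+ 1) :- con (+ 0) := con (+ 1)) refl

      h-respects : Respects π h
      h-respects p = reflexive (≡.cong indicator (J⊑χ (closure-⊒ es π p)))

      -- The square is 0 or 1. If `a` and `b` lie on the same side, joining them leaves the network
      -- disconnected; otherwise joining them is as good as joining `s` and `t`.
      drop-across : ∀ a b → Θ (contract π a b) ≈ Θ (contract π s t) * (h ⟨ a , b ⟩ * h ⟨ a , b ⟩)
      drop-across a b = go (χ a Bool.≟ χ b)
        where
        unit : ∀ x y → x ≢ y → (indicator x - indicator y) * (indicator x - indicator y) ≈ 1#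
        unit true  true  p = contradiction ≡.refl p
        unit false false p = contradiction ≡.refl p
        unit true  false _ = solve 0 ((con (+ 1) :- con (+ 0)) :* (con (+ 1) :- con (+ 0)) := con (+ 1)) refl
        unit false true  _ = solve 0 ((con (+ 0) :- con (+ 1)) :* (con (+ 0) :- con (+ 1)) := con (+ 1)) refl
        go : Dec (χ a ≡ χ b) → Θ (contract π a b) ≈ Θ (contract π s t) * (h ⟨ a , b ⟩ * h ⟨ a , b ⟩)
        go (yes a≡b) = begin
          Θ (contract π a b)  ≈⟨ treeSum-disconnected es (contract π a b) (λ tot → s≢t
                                   (closure-least es {contract π a b} (kernel Bool._≟_ χ)
                                     (contract-least π {kernel Bool._≟_ χ} (λ p → J⊑χ (closure-⊒ es π p)) a≡b)
                                     (All.map J⊑χ (closure-edges es π)) (tot s t))) ⟩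
          0#                  ≈⟨ solve 1 (λ B → con (+ 0) := B :* (con (+ 0) :* con (+ 0))) refl _ ⟩
          Θ (contract π s t) * (0# * 0#)
            ≈⟨ *-congˡ (*-cong h0 h0) ⟨
          Θ (contract π s t) * (h ⟨ a , b ⟩ * h ⟨ a , b ⟩) ∎
          where
          h0 : h ⟨ a , b ⟩ ≈ 0#
          h0 = trans (+-congʳ (reflexive (≡.cong indicator a≡b))) (-‿inverseʳ _)
        go (no a≢b) = trans
          (treeSum-across χ es π (λ p → J⊑χ (closure-⊒ es π p)) (All.map J⊑χ (closure-edges es π)) a≢b s≢t)
          (sym (trans (*-congˡ (unit (χ a) (χ b) a≢b)) (*-identityʳ _)))

      s≁t : ¬ π ⊢ s ∼ t
      s≁t p = s≁ᴶt (closure-⊒ es π p)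

    treeSum-bridge : treeSum (resistor s t g ∷ es) π ≈ g * Θ (contract π s t)
    treeSum-bridge = begin
      1# * Θ π + g * contracted Θ π s t ≈⟨ +-cong (*-congˡ (treeSum-disconnected es π ¬total)) (*-congˡ (contracted-link Θ π s≁t)) ⟩
      1# * 0# + g * Θ (contract π s t)  ≈⟨ solve 2 (λ g B → con (+ 1) :* con (+ 0) :+ g :* B := g :* B) refl g _ ⟩
      g * Θ (contract π s t)            ∎

    green-bridge : ∀ a b → Green Θ Q (contract π s t) a b → Green (treeSum (resistor s t g ∷ es)) (energy (resistor s t g ∷ es)) π a b
    green-bridge a b G = go (π._≟_ π a b)
      where
      Θ′ = treeSum (resistor s t g ∷ es)
      B = Θ (contract π s t)
      u = potential G
      lh = h ⟨ a , b ⟩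
      g⁻¹ = inverse 0<g
      -- Ohm's law: the bridge carries current `lh`, which is 0 or of modulus 1 according to the
      -- sides of `a` and `b`, so the step must have height `lh` over `g`.
      k = lh * g⁻¹
      gk≈lh : g * k ≈ lh
      gk≈lh = trans (solve 3 (λ g l i → g :* (l :* i) := l :* (i :* g)) refl g lh g⁻¹)
        (trans (*-congˡ (inverseˡ 0<g)) (*-identityʳ lh))
      u-st : u ⟨ s , t ⟩ ≈ 0#
      u-st = ⟨⟩-respects {contract π s t} (respects G) (contract-joins π s t)
      u-weak : ∀ w → Respects π w → form Q u w ≈ w ⟨ a , b ⟩ - w ⟨ s , t ⟩ * lh
      u-weak w resp = begin
        form Q u w
          ≈⟨ solve 2 (λ q v → q := con (+ 1) :* q :+ (:- v) :* con (+ 0)) refl _ vw ⟩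
        1# * form Q u w + (- vw) * 0#
          ≈⟨ +-cong (*-congˡ (form-sym Q u w)) (*-congˡ (sym (energy-constant es u h-const))) ⟩
        1# * form Q w u + (- vw) * form Q h u
          ≈⟨ form-lin Q 1# w (- vw) h u ⟨
        form Q w′ u
          ≈⟨ form-sym Q w′ u ⟩
        form Q u w′
          ≈⟨ weak G w′ w′-respects ⟩
        w′ ⟨ a , b ⟩
          ≈⟨ solve 5 (λ wa wb v ha hb → (con (+ 1) :* wa :+ (:- v) :* ha) :- (con (+ 1) :* wb :+ (:- v) :* hb)
               := (wa :- wb) :- v :* (ha :- hb)) refl (w a) (w b) vw (h a) (h b) ⟩
        w ⟨ a , b ⟩ - vw * lh ∎
        where
        vw = w ⟨ s , t ⟩
        -- A test function for `π` may drop across the bridge; subtracting that multiple of `h`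
        -- makes it admissible for `G` without changing its pairing with `u`.
        w′ : Fin n → Carrier
        w′ i = 1# * w i + (- vw) * h i
        w′-π : Respects π w′
        w′-π p = +-cong (*-congˡ (resp p)) (*-congˡ (h-respects p))
        w′-st : w′ s ≈ w′ t
        w′-st = begin
          1# * w s + (- vw) * h s
            ≈⟨ solve 4 (λ ws wt hs ht → con (+ 1) :* ws :+ (:- (ws :- wt)) :* hs
                 := con (+ 1) :* ws :+ (:- (ws :- wt)) :* (hs :- ht) :+ (:- (ws :- wt)) :* ht) refl (w s) (w t) (h s) (h t) ⟩
          1# * w s + (- vw) * (h ⟨ s , t ⟩) + (- vw) * h t
            ≈⟨ +-congʳ (+-congˡ (*-congˡ h-st)) ⟩
          1# * w s + (- vw) * 1# + (- vw) * h t
            ≈⟨ solve 4 (λ ws wt hs ht → con (+ 1) :* ws :+ (:- (ws :- wt)) :* con (+ 1) :+ (:- (ws :- wt)) :* ht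
                 := con (+ 1) :* wt :+ (:- (ws :- wt)) :* ht) refl (w s) (w t) (h s) (h t) ⟩
          1# * w t + (- vw) * h t ∎
        w′-respects : Respects (contract π s t) w′
        w′-respects (inj₁ p) = w′-π p
        w′-respects (inj₂ (p , q)) = trans (to-s p) (sym (to-s q))
          where
          to-s : ∀ {i} → π ⊢ i ∼ s ⊎ π ⊢ i ∼ t → w′ i ≈ w′ s
          to-s (inj₁ p) = w′-π p
          to-s (inj₂ p) = trans (w′-π p) (sym w′-st)
      go : Dec (π ⊢ a ∼ b) → Green Θ′ (energy (resistor s t g ∷ es)) π a b
      go (yes p) = green-trivial p
      go (no a≁b) = record
        { potential = u′
        ; respects  = λ p → +-cong (*-congˡ (respects G (inj₁ p))) (*-congˡ (h-respects p))
        ; weak      = λ w resp → begin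
            form Q u′ w + g * (u′ ⟨ s , t ⟩ * w ⟨ s , t ⟩)
              ≈⟨ +-cong (trans (form-lin Q 1# u k h w)
                   (+-cong (*-congˡ (u-weak w resp)) (*-congˡ (energy-constant es w h-const))))
                 (*-congˡ (*-congʳ (trans (solve 5 (λ us ut k hs ht → (con (+ 1) :* us :+ k :* hs) :- (con (+ 1) :* ut :+ k :* ht)
                     := (us :- ut) :+ k :* (hs :- ht)) refl (u s) (u t) k (h s) (h t))
                   (+-cong u-st (*-congˡ h-st))))) ⟩
            1# * (w ⟨ a , b ⟩ - w ⟨ s , t ⟩ * lh) + k * 0# + g * ((0# + k * 1#) * w ⟨ s , t ⟩)
              ≈⟨ solve 5 (λ l v h k g → con (+ 1) :* (l :- v :* h) :+ k :* con (+ 0) :+ g :* ((con (+ 0) :+ k :* con (+ 1)) :* v)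
                   := l :+ (g :* k :- h) :* v) refl (w ⟨ a , b ⟩) (w ⟨ s , t ⟩) lh k g ⟩
            w ⟨ a , b ⟩ + (g * k - lh) * w ⟨ s , t ⟩
              ≈⟨ +-congˡ (*-congʳ (trans (+-congʳ gk≈lh) (-‿inverseʳ lh))) ⟩
            w ⟨ a , b ⟩ + 0# * w ⟨ s , t ⟩
              ≈⟨ solve 2 (λ l v → l :+ con (+ 0) :* v := l) refl _ _ ⟩
            w ⟨ a , b ⟩ ∎
        ; drop      = begin
            Θ′ π * u′ ⟨ a , b ⟩
              ≈⟨ *-cong treeSum-bridge (solve 5 (λ us ut k hs ht → (con (+ 1) :* us :+ k :* hs) :- (con (+ 1) :* ut :+ k :* ht)
                     := (us :- ut) :+ k :* (hs :- ht)) refl (u a) (u b) k (h a) (h b)) ⟩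
            (g * B) * (u ⟨ a , b ⟩ + k * lh)
              ≈⟨ solve 5 (λ g B l k h → (g :* B) :* (l :+ k :* h) := B :* ((g :* k) :* h) :+ g :* (B :* l)) refl g B _ k lh ⟩
            B * ((g * k) * lh) + g * (B * u ⟨ a , b ⟩)
              ≈⟨ +-cong (*-congˡ (*-congʳ gk≈lh)) (*-congˡ (drop G)) ⟩
            B * (lh * lh) + g * contracted Θ (contract π s t) a b
              ≈⟨ +-cong (trans (sym (drop-across a b)) (sym (*-identityˡ _)))
                        (*-congˡ (contracted-comm Θ (treeSum-cong es) π s≁t a≁b)) ⟩
            1# * Θ (contract π a b) + g * contracted Θ (contract π a b) s t
              ≈⟨ contracted-link Θ′ π a≁b ⟨
            contracted Θ′ π a b ∎
        }
        where
        u′ : Fin n → Carrier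
        u′ i = 1# * u i + k * h i

  -- Positivity and potentials are proved together, as `green-link` inverts the tree sum. The head
  -- edge is a loop, a link between already connected parts, or a bridge; the latter two need the
  -- induction hypothesis at the contracted partition.
  treeSum-green : ∀ es → All (λ e → 0# < conductance e) es → ∀ π → Total (closure π es) →
    0# < treeSum es π × (∀ a b → Green (treeSum es) (energy es) π a b)
  treeSum-green [] [] π tot =
    <-respʳ (sym (totality-yes {π} tot)) 1-pos , λ a b → green-trivial (tot a b)
  treeSum-green (resistor s t g ∷ es) (0<g ∷ pos) π tot = go (π._≟_ π s t) (total? (closure π es))
    where
    Θ = treeSum es
    link = treeSum-green es pos (contract π s t) tot
    go : Dec (π ⊢ s ∼ t) → Dec (Total (closure π es)) →
      0# < treeSum (resistor s t g ∷ es) π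
      × (∀ a b → Green (treeSum (resistor s t g ∷ es)) (energy (resistor s t g ∷ es)) π a b)
    go (yes s∼t) _ =
      <-respʳ (sym (trans (+-congˡ (*-congˡ (contracted-loop Θ π s∼t)))
        (solve 2 (λ A g → con (+ 1) :* A :+ g :* con (+ 0) := A) refl (Θ π) g))) (proj₁ rest)
      , λ a b → green-loop {Θ} (treeSum-cong es) (energy es) π 1# g g s t s∼t (proj₂ rest a b)
      where
      rest = treeSum-green es pos π λ u v →
        closure-mono es {contract π s t} {π} (proj₁ (contract-loop π s∼t)) (tot u v)
    go (no s≁t) (yes tot′) = 0<Θ′ , λ a b →
      green-link {Θ} (treeSum-cong es) (energy es) π 1# g g s t s≁t (sym (*-identityˡ g))
        (inverse 0<Θ′) (inverseˡ 0<Θ′) (proj₂ rest a b) (proj₂ rest s t) (proj₂ link a b)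
      where
      rest = treeSum-green es pos π tot′
      0<Θ′ : 0# < treeSum (resistor s t g ∷ es) π
      0<Θ′ = +-pos-nonNeg (<-respʳ (sym (*-identityˡ _)) (proj₁ rest))
        (<⇒≤ (*-pos 0<g (<-respʳ (sym (contracted-link Θ π s≁t)) (proj₁ link))))
    go (no s≁t) (no ¬tot) =
      <-respʳ (sym (Bridge.treeSum-bridge es π s t 0<g ¬tot tot)) (*-pos 0<g (proj₁ link))
      , λ a b → Bridge.green-bridge es π s t 0<g ¬tot tot a b (proj₂ link a b)

-- Rayleigh monotonicity

included omitted : ∀ {q} {E : Set} → (Fin q → E) → Subset q → List E
included e []            = []
included e (inside  ∷ S) = e zero ∷ included (e ∘ suc) S
included e (outside ∷ S) = included (e ∘ suc) S
omitted e I = included e (∁ I)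

module Chain {c ℓ} (K : CommutativeRing c ℓ) {n : ℕ} where
  open CommutativeRing K
  open Contraction K {n}
  open Partition using (_≟_) renaming (_∼_ to _⊢_∼_)

  -- The part of `Θ` belonging to trees that use every listed edge; it vanishes once an edge closes
  -- a cycle with those before it.
  chain : (Partition n → Carrier) → List (Fin n × Fin n) → Partition n → Carrier
  chain Θ []             π = Θ π
  chain Θ ((a , b) ∷ xs) π = contracted (chain Θ xs) π a b

  contracted-resp : ∀ {Θ Θ′} → (∀ π → Θ π ≈ Θ′ π) → ∀ π a b → contracted Θ π a b ≈ contracted Θ′ π a b
  contracted-resp {Θ} {Θ′} e π a b = go (_≟_ π a b)
    where
    go : Dec (π ⊢ a ∼ b) → contracted Θ π a b ≈ contracted Θ′ π a b
    go (yes p) = trans (contracted-loop Θ π p) (sym (contracted-loop Θ′ π p))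
    go (no ¬p) = trans (contracted-link Θ π ¬p) (trans (e _) (sym (contracted-link Θ′ π ¬p)))

  module _ {Θ : Partition n → Carrier} (cong : Congruent Θ) where

    chain-cong : ∀ xs → Congruent (chain Θ xs)
    chain-cong []             = cong
    chain-cong ((a , b) ∷ xs) = contracted-cong (chain Θ xs) (chain-cong xs) a b

    private
      Θ-swap : ∀ {Θ : Partition n → Carrier} → Congruent Θ → ∀ π a b c d →
        contracted (λ π → contracted Θ π c d) π a b ≈ contracted (λ π → contracted Θ π a b) π c d
      Θ-swap {Θ} cong π a b c d = go (_≟_ π a b) (_≟_ π c d)
        where
        Θcd = λ π → contracted Θ π c d
        Θab = λ π → contracted Θ π a b
        go : Dec (π ⊢ a ∼ b) → Dec (π ⊢ c ∼ d) → contracted Θcd π a b ≈ contracted Θab π c d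
        go (yes p) (yes q) = trans (contracted-loop Θcd π p) (sym (contracted-loop Θab π q))
        go (yes p) (no ¬q) = trans (contracted-loop Θcd π p)
          (sym (trans (contracted-link Θab π ¬q) (contracted-loop Θ (contract π c d) (contract-⊒ π c d p))))
        go (no ¬p) (yes q) =
          trans (trans (contracted-link Θcd π ¬p) (contracted-loop Θ (contract π a b) (contract-⊒ π a b q)))
            (sym (contracted-loop Θab π q))
        go (no ¬p) (no ¬q) = trans (contracted-link Θcd π ¬p)
          (trans (contracted-comm Θ cong π ¬p ¬q) (sym (contracted-link Θab π ¬q)))

    -- Order is immaterial since two contractions commute, also when one of the edges is or becomes
    -- a loop. Choosing which edges come first later yields different descriptions of the same
    -- coefficient.
    chain-↭ : ∀ {xs ys} → xs ↭ ys → ∀ π → chain Θ xs π ≈ chain Θ ys π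
    chain-↭ ↭.refl                 π = refl
    chain-↭ (↭.prep (a , b) p)     π = contracted-resp (chain-↭ p) π a b
    chain-↭ (↭.swap {xs} {ys} (a , b) (c , d) p) π =
      trans (contracted-resp (λ π → contracted-resp (chain-↭ p) π c d) π a b)
        (Θ-swap (chain-cong ys) π a b c d)
    chain-↭ (↭.trans p q)          π = trans (chain-↭ p π) (chain-↭ q π)

module Rayleigh {c ℓ₁ ℓ₂} (ℝ : RealField c ℓ₁ ℓ₂) {n : ℕ} where
  open RealField ℝ hiding (zero)
  open OrderedField ℝ
  open IntegerSolver commutativeRing
  open Contraction commutativeRing {n}
  open Chain commutativeRing {n}
  open Potential commutativeRing {n}
  open TreeSum ℝ {n} using (resistor; energy; conductance)
  open SetoidReasoning (CommutativeRing.setoid commutativeRing)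
  open Partition using (_≟_) renaming (_∼_ to _⊢_∼_)

  energy-nonNeg : ∀ es → All (λ e → 0# < conductance e) es → ∀ u → 0# ≤ form (energy es) u u
  energy-nonNeg []                    []          u = ≤-refl
  energy-nonNeg (resistor s t g ∷ es) (0<g ∷ pos) u =
    +-nonNeg (energy-nonNeg es pos u) (*-nonNeg (<⇒≤ 0<g) (sq-nonNeg _))

  module _ (Θ : Partition n → Carrier) (cong : Congruent Θ) (Θ-pos : ∀ π → 0# < Θ π)
           (Q : SymmetricForm) (Q-nonNeg : ∀ u → 0# ≤ form Q u u)
           (green : ∀ π a b → Green Θ Q π a b) where

    -- The resistances differ by the energy of the difference of the potentials. The potential `u′`
    -- for the coarser `ρ` is admissible for both problems, so its pairings with `u` and with itself
    -- both equal `R′`.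
    resistance-mono : ∀ π ρ a b → π ⊑ ρ →
      potential (green ρ a b) ⟨ a , b ⟩ ≤ potential (green π a b) ⟨ a , b ⟩
    resistance-mono π ρ a b π⊑ρ = 0≤y-x⇒x≤y (≤-resp refl energy-gap (Q-nonNeg w))
      where
      u = potential (green π a b)
      u′ = potential (green ρ a b)
      R = u ⟨ a , b ⟩
      R′ = u′ ⟨ a , b ⟩
      w : Fin n → Carrier
      w i = 1# * u i + (- 1#) * u′ i
      u′-π : Respects π u′
      u′-π p = respects (green ρ a b) (π⊑ρ p)
      Quw : form Q u w ≈ w ⟨ a , b ⟩
      Quw = weak (green π a b) w λ p → +-cong (*-congˡ (respects (green π a b) p)) (*-congˡ (u′-π p))
      Qu′w : form Q u′ w ≈ 0#
      Qu′w = begin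
        form Q u′ w                             ≈⟨ form-sym Q u′ w ⟩
        form Q w u′                             ≈⟨ form-lin Q 1# u (- 1#) u′ u′ ⟩
        1# * form Q u u′ + (- 1#) * form Q u′ u′ ≈⟨ +-cong (*-congˡ (weak (green π a b) u′ u′-π)) (*-congˡ (weak (green ρ a b) u′ (respects (green ρ a b)))) ⟩
        1# * R′ + (- 1#) * R′                   ≈⟨ solve 1 (λ r → con (+ 1) :* r :+ (:- con (+ 1)) :* r := con (+ 0)) refl R′ ⟩
        0#                                      ∎
      energy-gap : form Q w w ≈ R - R′
      energy-gap = begin
        form Q w w                              ≈⟨ form-lin Q 1# u (- 1#) u′ w ⟩
        1# * form Q u w + (- 1#) * form Q u′ w  ≈⟨ +-cong (*-congˡ Quw) (*-congˡ Qu′w) ⟩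
        1# * w ⟨ a , b ⟩ + (- 1#) * 0#          ≈⟨ solve 4 (λ ua ub va vb → con (+ 1) :* ((con (+ 1) :* ua :+ (:- con (+ 1)) :* va) :- (con (+ 1) :* ub :+ (:- con (+ 1)) :* vb)) :+ (:- con (+ 1)) :* con (+ 0)
                                                     := (ua :- ub) :- (va :- vb)) refl (u a) (u b) (u′ a) (u′ b) ⟩
        R - R′                                  ∎

    contracted-mono : ∀ π ρ a b → π ⊑ ρ → contracted Θ ρ a b * Θ π ≤ contracted Θ π a b * Θ ρ
    contracted-mono π ρ a b π⊑ρ = ≤-resp
      (trans (solve 3 (λ p r x → (p :* r) :* x := (r :* x) :* p) refl (Θ π) (Θ ρ) _) (*-congʳ (drop (green ρ a b))))
      (trans (solve 3 (λ p r x → (p :* r) :* x := (p :* x) :* r) refl (Θ π) (Θ ρ) _) (*-congʳ (drop (green π a b))))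
      (*-monoˡ-≤ (<⇒≤ (*-pos (Θ-pos π) (Θ-pos ρ))) (resistance-mono π ρ a b π⊑ρ))

    chain-nonNeg : ∀ xs π → 0# ≤ chain Θ xs π
    chain-nonNeg []             π = <⇒≤ (Θ-pos π)
    chain-nonNeg ((a , b) ∷ xs) π = go (_≟_ π a b)
      where
      go : Dec (π ⊢ a ∼ b) → 0# ≤ contracted (chain Θ xs) π a b
      go (yes p) = ≤-reflexive (sym (contracted-loop (chain Θ xs) π p))
      go (no ¬p) = ≤-resp refl (sym (contracted-link (chain Θ xs) π ¬p)) (chain-nonNeg xs (contract π a b))

    -- Divided by the tree sums, both sides are products of resistances met while contracting `xs`
    -- one edge at a time, and each factor is larger over the finer partition. The intermediate tree
    -- sum at `πab` is positive and cancels.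
    chain-mono : ∀ xs π ρ → π ⊑ ρ → chain Θ xs ρ * Θ π ≤ chain Θ xs π * Θ ρ
    chain-mono []             π ρ π⊑ρ = ≤-reflexive (*-comm _ _)
    chain-mono ((a , b) ∷ xs) π ρ π⊑ρ = go (_≟_ ρ a b)
      where
      f = chain Θ xs
      πab = contract π a b
      ρab = contract ρ a b
      go : Dec (ρ ⊢ a ∼ b) → contracted f ρ a b * Θ π ≤ contracted f π a b * Θ ρ
      go (yes p) = ≤-resp
        (sym (trans (*-congʳ (contracted-loop f ρ p)) (solve 1 (λ x → con (+ 0) :* x := con (+ 0)) refl _))) refl
        (*-nonNeg (chain-nonNeg ((a , b) ∷ xs) π) (<⇒≤ (Θ-pos ρ)))
      go (no ρ≁) = ≤-resp (sym (*-congʳ (contracted-link f ρ ρ≁))) (sym (*-congʳ (contracted-link f π π≁)))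
        (*-cancelˡ-≤ (Θ-pos πab) (≤-trans
          (≤-resp (solve 3 (λ x y z → x :* (y :* z) := z :* (y :* x)) refl (Θ π) (f ρab) (Θ πab))
                  (solve 3 (λ x y z → x :* (y :* z) := y :* (z :* x)) refl (Θ π) (f πab) (Θ ρab))
            (*-monoˡ-≤ (<⇒≤ (Θ-pos π)) (chain-mono xs πab ρab (contract-mono {π = π} {ρ} a b π⊑ρ))))
          (≤-resp refl (solve 3 (λ x y z → x :* (y :* z) := y :* (x :* z)) refl (f πab) (Θ πab) (Θ ρ))
            (*-monoˡ-≤ (chain-nonNeg xs πab) (≤-resp
              (*-congʳ (contracted-link Θ ρ ρ≁)) (*-congʳ (contracted-link Θ π π≁))
              (contracted-mono π ρ a b π⊑ρ))))))
        where
        π≁ : ¬ π ⊢ a ∼ b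
        π≁ p = ρ≁ (π⊑ρ p)

    -- The edges of `ys` are contracted in `ρ` alone, so `ρ` coarsens away from the fixed `π` until
    -- `chain-mono` applies. For equal partitions this says that a weighted random spanning tree
    -- contains `xs` and `ys` with negative correlation.
    chain-++ : ∀ xs ys π ρ → π ⊑ ρ → chain Θ (ys ++ xs) ρ * Θ π ≤ chain Θ xs π * chain Θ ys ρ
    chain-++ xs []             π ρ π⊑ρ = chain-mono xs π ρ π⊑ρ
    chain-++ xs ((a , b) ∷ ys) π ρ π⊑ρ = go (_≟_ ρ a b)
      where
      f = chain Θ ys
      g = chain Θ (ys ++ xs)
      go : Dec (ρ ⊢ a ∼ b) → contracted g ρ a b * Θ π ≤ chain Θ xs π * contracted f ρ a b
      go (yes p) = ≤-resp
        (sym (trans (*-congʳ (contracted-loop g ρ p)) (solve 1 (λ x → con (+ 0) :* x := con (+ 0)) refl _))) refl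
        (*-nonNeg (chain-nonNeg xs π) (chain-nonNeg ((a , b) ∷ ys) ρ))
      go (no ¬p) = ≤-resp (sym (*-congʳ (contracted-link g ρ ¬p))) (sym (*-congˡ (contracted-link f ρ ¬p)))
        (chain-++ xs ys π (contract ρ a b) (λ p → inj₁ (π⊑ρ p)))
        where open import Data.Sum using (inj₁)

    -- The accumulators xs and ys collect the edges omitted from exactly one of
    -- the two sets; edges omitted from both are contracted in all four terms.
    omitted-submodular : ∀ {q} (e : Fin q → Fin n × Fin n) I J xs ys π →
      chain Θ (omitted e (I ∪ J)) π * chain Θ (xs ++ ys ++ omitted e (I ∩ J)) π
      ≤ chain Θ (xs ++ omitted e I) π * chain Θ (ys ++ omitted e J) π
    -- With all shared contractions made, the claim is the negative correlation of the accumulated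
    -- lists.
    omitted-submodular e [] [] xs ys π = ≤-resp
      (trans (*-comm _ _) (*-congˡ (chain-↭ cong (↭-trans (++-comm ys xs) (++⁺ˡ xs (↭-reflexive (≡.sym (List.++-identityʳ ys))))) π)))
      (*-cong (chain-↭ cong (↭-reflexive (≡.sym (List.++-identityʳ xs))) π)
              (chain-↭ cong (↭-reflexive (≡.sym (List.++-identityʳ ys))) π))
      (chain-++ xs ys π π (λ p → p))
    omitted-submodular e (inside ∷ I) (inside ∷ J) xs ys π = omitted-submodular (e ∘ suc) I J xs ys π
    omitted-submodular e (inside ∷ I) (outside ∷ J) xs ys π = ≤-resp
      (*-congˡ (chain-↭ cong (++⁺ˡ xs (↭-sym (shift (e zero) ys _))) π))
      (*-congˡ (chain-↭ cong (↭-sym (shift (e zero) ys _)) π))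
      (omitted-submodular (e ∘ suc) I J xs (e zero ∷ ys) π)
    omitted-submodular e (outside ∷ I) (inside ∷ J) xs ys π = ≤-resp
      (*-congˡ (chain-↭ cong (↭-sym (shift-++ (e zero) xs ys _)) π))
      (*-congʳ (chain-↭ cong (↭-sym (shift (e zero) xs _)) π))
      (omitted-submodular (e ∘ suc) I J (e zero ∷ xs) ys π)
      where
      shift-++ : ∀ x (xs ys zs : List (Fin n × Fin n)) → xs ++ ys ++ x ∷ zs ↭ x ∷ xs ++ ys ++ zs
      shift-++ x xs ys zs = ↭-trans (++⁺ˡ xs (shift x ys zs)) (shift x xs (ys ++ zs))
    omitted-submodular e (outside ∷ I) (outside ∷ J) xs ys π = ≤-resp
      (*-congˡ (chain-↭ cong (↭-sym (↭-trans (++⁺ˡ xs (shift (e zero) ys _)) (shift (e zero) xs _))) π))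
      (*-cong (chain-↭ cong (↭-sym (shift (e zero) xs _)) π) (chain-↭ cong (↭-sym (shift (e zero) ys _)) π))
      (go (_≟_ π a b))
      where
      a = proj₁ (e zero)
      b = proj₂ (e zero)
      P = chain Θ (omitted (e ∘ suc) (I ∪ J))
      M = chain Θ (xs ++ ys ++ omitted (e ∘ suc) (I ∩ J))
      X = chain Θ (xs ++ omitted (e ∘ suc) I)
      Y = chain Θ (ys ++ omitted (e ∘ suc) J)
      go : Dec (π ⊢ a ∼ b) → contracted P π a b * contracted M π a b ≤ contracted X π a b * contracted Y π a b
      go (yes p) = ≤-reflexive (trans (*-cong (contracted-loop P π p) (contracted-loop M π p))
                                 (sym (*-cong (contracted-loop X π p) (contracted-loop Y π p))))
      go (no ¬p) = ≤-resp (sym (*-cong (contracted-link P π ¬p) (contracted-link M π ¬p)))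
                          (sym (*-cong (contracted-link X π ¬p) (contracted-link Y π ¬p)))
        (omitted-submodular (e ∘ suc) I J xs ys (contract π a b))

-- Spanning trees by successive contraction

module _ {n : ℕ} where
  open Partition using (_≟_) renaming (_∼_ to _⊢_∼_)
  open Closure {n} {E = Fin n × Fin n} proj₁ proj₂

  -- Acyclicity tested edge by edge, following the recursion of `chain`, so that it decides when a
  -- `chain` vanishes for lack of trees.
  Independent : Partition n → List (Fin n × Fin n) → Set
  Independent π []             = ⊤
  Independent π ((a , b) ∷ xs) = ¬ π ⊢ a ∼ b × Independent (contract π a b) xs

  independent? : ∀ π xs → Dec (Independent π xs)
  independent? π []             = yes tt
  independent? π ((a , b) ∷ xs) = ¬? (_≟_ π a b) ×-dec independent? (contract π a b) xs

  independent-mono : ∀ xs {π ρ} → π ⊑ ρ → Independent ρ xs → Independent π xs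
  independent-mono []             π⊑ρ tt        = tt
  independent-mono ((a , b) ∷ xs) {π} {ρ} π⊑ρ (p , i) =
    (λ q → p (π⊑ρ q)) , independent-mono xs {contract π a b} {contract ρ a b} (contract-mono {π = π} {ρ} a b π⊑ρ) i

  partition : ∀ {k} → Multigraph n k → Partition n
  partition M = record { isDecEquivalence = Multigraph.isDecEquivalence M }

  joined : ∀ {k} → Multigraph n k → Subset k → Partition n
  joined M S = record { isDecEquivalence = Multigraph.joined-isDecEquivalence M S }

  ends : ∀ {k} → Multigraph n k → Fin k → Fin n × Fin n
  ends M e = Multigraph.src M e , Multigraph.tgt M e

  module _ {k} (M : Multigraph n (suc k)) where
    open Multigraph M

    delete₀ contract₀ : Multigraph n k
    delete₀ = record
      { isDecEquivalence = isDecEquivalence ; src = src ∘ suc ; tgt = tgt ∘ suc }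
    contract₀ = record
      { isDecEquivalence = Partition.isDecEquivalence (contract (partition M) (src zero) (tgt zero))
      ; src = src ∘ suc ; tgt = tgt ∘ suc }

    private
      module D = Multigraph delete₀
      module C = Multigraph contract₀
      s = src zero
      t = tgt zero

    joined-outside : ∀ S → joined delete₀ S ≋ joined M (outside ∷ S)
    joined-outside S =
        EqClosure.fold (EqClosure.isEquivalence (Link (outside ∷ S)))
          (λ { (D.same p) → EqClosure.return (same p) ; (D.edge e) → EqClosure.return (edge (there e)) })
      , EqClosure.fold (EqClosure.isEquivalence (D.Link S))
          (λ { (same p) → EqClosure.return (D.same p) ; (edge (there e)) → EqClosure.return (D.edge e) })

    joined-inside : ∀ S → joined contract₀ S ≋ joined M (inside ∷ S)
    joined-inside S =
        EqClosure.fold (EqClosure.isEquivalence (Link (inside ∷ S)))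
          (λ { (C.same p) → contract-least (partition M) {joined M (inside ∷ S)} (λ q → EqClosure.return (same q)) (EqClosure.return (edge here)) p
             ; (C.edge e) → EqClosure.return (edge (there e)) })
      , EqClosure.fold (EqClosure.isEquivalence (C.Link S))
          (λ { (same p)         → EqClosure.return (C.same (inj₁ p))
             ; (edge here)      → EqClosure.return (C.same (contract-joins (partition M) s t))
             ; (edge (there e)) → EqClosure.return (C.edge e) })

  joined-closure : ∀ {k} (M : Multigraph n k) S → joined M S ≋ closure (partition M) (included (ends M) S)
  joined-closure M [] =
      EqClosure.fold (Multigraph.∼.isEquivalence M) (λ { (Multigraph.same p) → p })
    , (λ p → EqClosure.return (Multigraph.same p))
  joined-closure M (inside ∷ S) with joined-inside M S | joined-closure (contract₀ M) S
  ... | f , g | h , i = (λ p → h (g p)) , (λ p → f (i p))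
  joined-closure M (outside ∷ S) with joined-outside M S | joined-closure (delete₀ M) S
  ... | f , g | h , i = (λ p → h (g p)) , (λ p → f (i p))

  walk-from : ∀ {k} (M : Multigraph n k) S {u u′ v} ds → Multigraph._∼_ M u u′ →
              Multigraph.IsWalk M S u′ ds v → Multigraph.IsWalk M S u ds v
  walk-from M S []       p w             = Multigraph.∼.trans M p w
  walk-from M S (d ∷ ds) p (q , d∈S , w) = Multigraph.∼.trans M p q , d∈S , w

  -- A cycle without the requirement of distinct vertices: contraction can merge vertices of a cycle
  -- but leaves its edges distinct.
  IsTrail : ∀ {k} → Multigraph n k → Subset k → List (Bool × Fin k) → Set
  IsTrail M S ds = (∃ λ u → Multigraph.IsWalk M S u ds u) × ds ≢ [] × AllPairs _≢_ (map proj₂ ds)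

  strip : ∀ {k} → List (Bool × Fin (suc k)) → List (Bool × Fin k)
  strip []                 = []
  strip ((_ , zero)  ∷ ds) = strip ds
  strip ((b , suc e) ∷ ds) = (b , e) ∷ strip ds

  strip-avoids : ∀ {k} {e : Fin k} ds → All (suc e ≢_) (map proj₂ ds) → All (e ≢_) (map proj₂ (strip ds))
  strip-avoids []                 []       = []
  strip-avoids ((_ , zero)  ∷ ds) (_ ∷ ps) = strip-avoids ds ps
  strip-avoids ((_ , suc _) ∷ ds) (p ∷ ps) = (λ q → p (≡.cong suc q)) ∷ strip-avoids ds ps

  strip-unique : ∀ {k} (ds : List (Bool × Fin (suc k))) → AllPairs _≢_ (map proj₂ ds) → AllPairs _≢_ (map proj₂ (strip ds))
  strip-unique []                 []       = []
  strip-unique ((_ , zero)  ∷ ds) (_ ∷ ps) = strip-unique ds ps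
  strip-unique ((_ , suc _) ∷ ds) (p ∷ ps) = strip-avoids ds p ∷ strip-unique ds ps

  module _ {k} (M : Multigraph n (suc k)) where
    open Multigraph M
    private
      module D = Multigraph (delete₀ M)
      module C = Multigraph (contract₀ M)
      s = src zero
      t = tgt zero

    strip-outside : ∀ S u ds v → IsWalk (outside ∷ S) u ds v → D.IsWalk S u (strip ds) v
    strip-outside S u []                     v w               = w
    strip-outside S u ((true  , suc e) ∷ ds) v (p , there e∈ , w) = p , e∈ , strip-outside S _ ds v w
    strip-outside S u ((false , suc e) ∷ ds) v (p , there e∈ , w) = p , e∈ , strip-outside S _ ds v w

    strip-inside : ∀ S u ds v → IsWalk (inside ∷ S) u ds v → C.IsWalk S u (strip ds) v
    strip-inside S u []                     v w = inj₁ w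
    strip-inside S u ((true  , zero)  ∷ ds) v (p , _ , w) =
      walk-from (contract₀ M) S (strip ds) (inj₂ (inj₁ p , inj₂ ∼.refl)) (strip-inside S _ ds v w)
    strip-inside S u ((false , zero)  ∷ ds) v (p , _ , w) =
      walk-from (contract₀ M) S (strip ds) (inj₂ (inj₂ p , inj₁ ∼.refl)) (strip-inside S _ ds v w)
    strip-inside S u ((true  , suc e) ∷ ds) v (p , there e∈ , w) = inj₁ p , e∈ , strip-inside S _ ds v w
    strip-inside S u ((false , suc e) ∷ ds) v (p , there e∈ , w) = inj₁ p , e∈ , strip-inside S _ ds v w

    trail-outside : ∀ S ds → IsTrail M (outside ∷ S) ds → IsTrail (delete₀ M) S (strip ds)
    trail-outside S ds ((u , w) , ne , uniq) =
      (u , strip-outside S u ds u w) , nonempty ds w ne , strip-unique ds uniq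
      where
      nonempty : ∀ ds → IsWalk (outside ∷ S) u ds u → ds ≢ [] → strip ds ≢ []
      nonempty []                 w ne = λ _ → ne ≡.refl
      nonempty ((_ , suc _) ∷ ds) w ne = λ ()
      nonempty ((_ , zero)  ∷ ds) (_ , () , _) ne

    trail-inside : ∀ S → ¬ s ∼ t → ∀ ds → IsTrail M (inside ∷ S) ds → IsTrail (contract₀ M) S (strip ds)
    trail-inside S s≁t ds ((u , w) , ne , uniq) =
      (u , strip-inside S u ds u w) , nonempty ds w ne uniq , strip-unique ds uniq
      where
      nonempty : ∀ ds → IsWalk (inside ∷ S) u ds u → ds ≢ [] → AllPairs _≢_ (map proj₂ ds) → strip ds ≢ []
      nonempty []                 w ne _ = λ _ → ne ≡.refl
      nonempty ((_ , suc _) ∷ ds) w ne _ = λ ()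
      nonempty ((_ , zero) ∷ (_ , suc _) ∷ ds) w ne _ = λ ()
      -- A closed walk along edge zero alone would make that edge a loop.
      nonempty ((true  , zero) ∷ []) (p , _ , q) ne _ = λ _ → s≁t (∼.trans (∼.sym p) (∼.sym q))
      nonempty ((false , zero) ∷ []) (p , _ , q) ne _ = λ _ → s≁t (∼.trans q p)
      nonempty ((_ , zero) ∷ (_ , zero) ∷ ds) w ne ((z≢z ∷ _) ∷ _) = λ _ → z≢z ≡.refl

  independent⇒no-trail : ∀ {k} (M : Multigraph n k) S → Independent (partition M) (included (ends M) S) →
                         ∀ ds → ¬ IsTrail M S ds
  independent⇒no-trail M []            tt      []             (_ , ne , _) = ne ≡.refl
  independent⇒no-trail M []            tt      ((_ , ()) ∷ _) _
  independent⇒no-trail M (outside ∷ S) i       ds tr =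
    independent⇒no-trail (delete₀ M) S i (strip ds) (trail-outside M S ds tr)
  independent⇒no-trail M (inside ∷ S)  (p , i) ds tr =
    independent⇒no-trail (contract₀ M) S i (strip ds) (trail-inside M S p ds tr)

  -- Lifting cycles through a deleted or contracted edge

  raise : ∀ {k} → Bool × Fin k → Bool × Fin (suc k)
  raise (b , e) = b , suc e

  raise-avoids₀ : ∀ {k} (ds : List (Bool × Fin k)) → All (zero ≢_) (map proj₂ (map raise ds))
  raise-avoids₀ []       = []
  raise-avoids₀ (_ ∷ ds) = (λ ()) ∷ raise-avoids₀ ds

  raise-avoids : ∀ {k} {e : Fin k} ds → All (e ≢_) (map proj₂ ds) → All (suc e ≢_) (map proj₂ (map raise ds))
  raise-avoids []       []       = []
  raise-avoids (_ ∷ ds) (p ∷ ps) = (λ { ≡.refl → p ≡.refl }) ∷ raise-avoids ds ps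

  raise-unique : ∀ {k} (ds : List (Bool × Fin k)) → AllPairs _≢_ (map proj₂ ds) → AllPairs _≢_ (map proj₂ (map raise ds))
  raise-unique []       []       = []
  raise-unique (_ ∷ ds) (p ∷ ps) = raise-avoids ds p ∷ raise-unique ds ps

  module _ {k} (M : Multigraph n (suc k)) where
    open Multigraph M
    private
      module D = Multigraph (delete₀ M)
      module C = Multigraph (contract₀ M)
      s = src zero
      t = tgt zero

    raise-outside : ∀ S u ds v → D.IsWalk S u ds v → IsWalk (outside ∷ S) u (map raise ds) v
    raise-outside S u []                 v w            = w
    raise-outside S u ((true  , _) ∷ ds) v (p , e∈ , w) = p , there e∈ , raise-outside S _ ds v w
    raise-outside S u ((false , _) ∷ ds) v (p , e∈ , w) = p , there e∈ , raise-outside S _ ds v w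

    raise-starts : ∀ ds → map start (map raise ds) ≡ map C.start ds
    raise-starts []                 = ≡.refl
    raise-starts ((true  , _) ∷ ds) = ≡.cong (_ ∷_) (raise-starts ds)
    raise-starts ((false , _) ∷ ds) = ≡.cong (_ ∷_) (raise-starts ds)

    cycle-outside : ∀ S ds → D.IsCycle S ds → IsCycle (outside ∷ S) (map raise ds)
    cycle-outside S ds ((u , w) , ne , edges , starts) =
        (u , raise-outside S u ds u w) , nonempty ds ne , raise-unique ds edges
      , ≡.subst (AllPairs (λ u v → ¬ u ∼ v)) (≡.sym (raise-starts ds)) (starts′ ds starts)
      where
      nonempty : ∀ (ds : List (Bool × Fin k)) → ds ≢ [] → map raise ds ≢ []
      nonempty []       ne _ = ne ≡.refl
      nonempty (_ ∷ _)  ne ()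
      starts′ : ∀ ds → AllPairs (λ u v → ¬ u ∼ v) (map D.start ds) → AllPairs (λ u v → ¬ u ∼ v) (map C.start ds)
      starts′ ds = ≡.subst (AllPairs _) (eq ds)
        where
        eq : ∀ ds → map D.start ds ≡ map C.start ds
        eq []                 = ≡.refl
        eq ((true  , _) ∷ ds) = ≡.cong (_ ∷_) (eq ds)
        eq ((false , _) ∷ ds) = ≡.cong (_ ∷_) (eq ds)

    module _ (S : Subset k) (s≁t : ¬ s ∼ t) where
      private
        Merged : Fin n → Set
        Merged u = u ∼ s ⊎ u ∼ t

        Unique∼ Unique/ : List (Fin n) → Set
        Unique∼ = AllPairs (λ u v → ¬ u ∼ v)
        Unique/ = AllPairs (λ u v → ¬ C._∼_ u v)

      -- Two vertices equal in the contraction either agree already or are bridged by edge zero,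
      -- traversed in direction `b`. The last two arguments of `detour` later show that the inserted
      -- starting vertex is new.
      data Junction (u v : Fin n) : Set where
        direct : u ∼ v → Junction u v
        detour : ∀ b → u ∼ start (b , zero) → end (b , zero) ∼ v → ¬ start (b , zero) ∼ v →
                 Merged v → Junction u v

      junction : ∀ {u v} → C._∼_ u v → Junction u v
      junction (inj₁ p)               = direct p
      junction (inj₂ (inj₁ p , inj₁ q)) = direct (∼.trans p (∼.sym q))
      junction (inj₂ (inj₂ p , inj₂ q)) = direct (∼.trans p (∼.sym q))
      junction (inj₂ (inj₁ p , inj₂ q)) = detour true p (∼.sym q) (λ r → s≁t (∼.trans r q)) (inj₂ q)
      junction (inj₂ (inj₂ p , inj₁ q)) = detour false p (∼.sym q) (λ r → s≁t (∼.sym (∼.trans r q))) (inj₁ q)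

      start₀-merged : ∀ b → Merged (start (b , zero))
      start₀-merged true  = inj₁ ∼.refl
      start₀-merged false = inj₂ ∼.refl

      -- A walk with distinct vertices in the contraction meets the merged class at most once; after
      -- the detour there, every junction is direct.
      raise-direct : ∀ u ds v → ¬ Merged v → All (λ x → ¬ Merged x) (map C.start ds) →
                     C.IsWalk S u ds v → IsWalk (inside ∷ S) u (map raise ds) v
      raise-direct u [] v ¬v [] (inj₁ p) = p
      raise-direct u [] v ¬v [] (inj₂ (_ , q)) = ⊥-elim (¬v q)
      raise-direct u ((true  , _) ∷ ds) v ¬v (¬p ∷ ¬ps) (inj₁ p , e∈ , w) = p , there e∈ , raise-direct _ ds v ¬v ¬ps w
      raise-direct u ((false , _) ∷ ds) v ¬v (¬p ∷ ¬ps) (inj₁ p , e∈ , w) = p , there e∈ , raise-direct _ ds v ¬v ¬ps w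
      raise-direct u ((true  , _) ∷ ds) v ¬v (¬p ∷ ¬ps) (inj₂ (_ , q) , _) = ⊥-elim (¬p q)
      raise-direct u ((false , _) ∷ ds) v ¬v (¬p ∷ ¬ps) (inj₂ (_ , q) , _) = ⊥-elim (¬p q)

      -- `covered` traces each new starting vertex to a class already on the walk, and `avoids`
      -- traces the edges; with these invariants a dart can be prepended without losing
      -- distinctness.
      record Lift (u : Fin n) (ds : List C.Dart) (v : Fin n) : Set where
        field
          darts   : List Dart
          walk    : IsWalk (inside ∷ S) u darts v
          starts  : Unique∼ (v ∷ map start darts)
          covered : All (λ x → Any (C._∼_ x) (v ∷ map C.start ds)) (map start darts)
          edges   : AllPairs _≢_ (map proj₂ darts)
          avoids  : ∀ {f} → All (f ≢_) (map proj₂ ds) → All (suc f ≢_) (map proj₂ darts)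

      private
        apart : ∀ {x y} → Merged x → ¬ Merged y → ¬ x ∼ y
        apart (inj₁ p) ¬q r = ¬q (inj₁ (∼.trans (∼.sym r) p))
        apart (inj₂ p) ¬q r = ¬q (inj₂ (∼.trans (∼.sym r) p))

        start-raise : ∀ d → start (raise d) ≡ C.start d
        start-raise (true  , _) = ≡.refl
        start-raise (false , _) = ≡.refl

        consWalk : ∀ {u v} d ds → u ∼ C.start d → proj₂ d ∈ S → IsWalk (inside ∷ S) (C.end d) ds v →
                   IsWalk (inside ∷ S) u (raise d ∷ ds) v
        consWalk (true  , _) ds p e∈ w = p , there e∈ , w
        consWalk (false , _) ds p e∈ w = p , there e∈ , w

        coarse : ∀ {x y xs} → All (λ z → ¬ C._∼_ x z) xs → Any (C._∼_ y) xs → ¬ x ∼ y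
        coarse (¬p ∷ _)  (here q)  r = ¬p (C.∼.trans (inj₁ r) q)
        coarse (_ ∷ ¬ps) (there q) r = coarse ¬ps q r

      -- Edge zero is inserted at the first junction that jumps between the two halves of the merged
      -- class. Distinctness in the contraction, with the final vertex included, excludes a second
      -- jump.
      lift : ∀ u ds v → C.IsWalk S u ds v → Unique/ (v ∷ map C.start ds) → AllPairs _≢_ (map proj₂ ds) → Lift u ds v
      lift u [] v w _ _ with junction w
      ... | direct p = record
        { darts = [] ; walk = p ; starts = [] ∷ [] ; covered = [] ; edges = [] ; avoids = λ _ → [] }
      ... | detour b p q r m = record
        { darts   = (b , zero) ∷ []
        ; walk    = p , here , q
        ; starts  = ((λ x → r (∼.sym x)) ∷ []) ∷ [] ∷ []
        ; covered = here (inj₂ (start₀-merged b , m)) ∷ []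
        ; edges   = [] ∷ []
        ; avoids  = λ _ → (λ ()) ∷ [] }
      lift u (d ∷ ds) v (j , e∈ , w) ((v≁d ∷ v≁ds) ∷ d≁ds ∷ uds) (e≢ ∷ es) with junction j
      ... | direct p = record
        { darts   = raise d ∷ L.darts
        ; walk    = consWalk d L.darts p e∈ L.walk
        ; starts  = ((λ r → v≁d (inj₁ (≡.subst (v ∼_) (start-raise d) r))) ∷ headOf L.starts)
                    ∷ All.map (λ c r → coarse ((λ q → v≁d (C.∼.sym q)) ∷ d≁ds) c (≡.subst (_∼ _) (start-raise d) r)) L.covered
                    ∷ tailOf L.starts
        ; covered = ≡.subst (λ x → Any (C._∼_ x) (v ∷ C.start d ∷ map C.start ds)) (≡.sym (start-raise d)) (there (here C.∼.refl))
                    ∷ All.map skip L.covered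
        ; edges   = L.avoids e≢ ∷ L.edges
        ; avoids  = λ { (p ∷ ps) → (λ { ≡.refl → p ≡.refl }) ∷ L.avoids ps }
        }
        where
        module L = Lift (lift (C.end d) ds v w (v≁ds ∷ uds) es)
        headOf : ∀ {x xs} → Unique∼ (x ∷ xs) → All (λ y → ¬ x ∼ y) xs
        headOf (p ∷ _) = p
        tailOf : ∀ {x xs} → Unique∼ (x ∷ xs) → Unique∼ xs
        tailOf (_ ∷ p) = p
        skip : ∀ {x y z xs} → Any (C._∼_ x) (y ∷ xs) → Any (C._∼_ x) (y ∷ z ∷ xs)
        skip (here p)  = here p
        skip (there p) = there (there p)
      ... | detour b p q r m = record
        { darts   = (b , zero) ∷ raise d ∷ map raise ds
        ; walk    = p , here , consWalk d (map raise ds) q e∈ (raise-direct (C.end d) ds v ¬mv ¬mds w)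
        ; starts  = ≡.subst Unique∼ (≡.cong₂ (λ x xs → v ∷ start (b , zero) ∷ x ∷ xs) (≡.sym (start-raise d)) (≡.sym (raise-starts ds)))
            (((λ x → apart (start₀-merged b) ¬mv (∼.sym x)) ∷ (λ x → v≁d (inj₁ x)) ∷ All.map (λ ¬x x → ¬x (inj₁ x)) v≁ds)
             ∷ (r ∷ All.map (λ ¬m → apart (start₀-merged b) ¬m) ¬mds)
             ∷ All.map (λ ¬x x → ¬x (inj₁ x)) d≁ds
             ∷ finer uds)
        ; covered = ≡.subst (All _) (≡.cong₂ (λ x xs → start (b , zero) ∷ x ∷ xs) (≡.sym (start-raise d)) (≡.sym (raise-starts ds)))
            (there (here (inj₂ (start₀-merged b , m))) ∷ there (here C.∼.refl) ∷ selfCover (λ i → there (there i)))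
        ; edges   = ((λ ()) ∷ raise-avoids₀ ds) ∷ raise-avoids ds e≢ ∷ raise-unique ds es
        ; avoids  = λ ps → (λ ()) ∷ raise-avoids (d ∷ ds) ps
        }
        where
        ¬mv : ¬ Merged v
        ¬mv x = v≁d (inj₂ (x , m))
        ¬mds : All (λ x → ¬ Merged x) (map C.start ds)
        ¬mds = All.map (λ ¬x y → ¬x (inj₂ (m , y))) d≁ds
        finer : ∀ {xs} → Unique/ xs → Unique∼ xs
        finer []       = []
        finer (p ∷ ps) = All.map (λ ¬x x → ¬x (inj₁ x)) p ∷ finer ps
        selfCover : ∀ {xs ys} → (∀ {x} → Any (C._∼_ x) xs → Any (C._∼_ x) ys) → All (λ x → Any (C._∼_ x) ys) xs
        selfCover {[]}     f = []
        selfCover {x ∷ xs} f = f (here C.∼.refl) ∷ selfCover (λ i → f (there i))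

      cycle-inside : ∀ ds → C.IsCycle S ds → ∃ (IsCycle (inside ∷ S))
      cycle-inside [] (_ , ne , _) = ⊥-elim (ne ≡.refl)
      -- The base point is moved from `u` to the exact start of the first dart, so that a possible
      -- jump at the base point occurs at the end of the walk, where `lift` handles it.
      cycle-inside (d ∷ ds) ((u , p , e∈ , w) , ne , (e≢ ∷ es) , (d≁ ∷ uds)) =
          raise d ∷ L.darts
        , (C.start d , consWalk d L.darts ∼.refl e∈ L.walk)
        , (λ ())
        , L.avoids e≢ ∷ L.edges
        , ≡.subst (λ x → Unique∼ (x ∷ map start L.darts)) (≡.sym (start-raise d)) L.starts
        where
        walk-to : ∀ {u v v′} ds → C._∼_ v v′ → C.IsWalk S u ds v → C.IsWalk S u ds v′
        walk-to []       p w            = C.∼.trans w p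
        walk-to (d ∷ ds) p (q , e∈ , w) = q , e∈ , walk-to ds p w
        module L = Lift (lift (C.end d) ds (C.start d) (walk-to ds p w) (d≁ ∷ uds) es)

  acyclic⇒independent : ∀ {k} (M : Multigraph n k) S → Multigraph.Acyclic M S →
                        Independent (partition M) (included (ends M) S)
  acyclic⇒independent M [] _ = tt
  acyclic⇒independent M (outside ∷ S) ac =
    acyclic⇒independent (delete₀ M) S λ (ds , cyc) → ac (map raise ds , cycle-outside M S ds cyc)
  acyclic⇒independent M (inside ∷ S) ac =
    s≁t , acyclic⇒independent (contract₀ M) S λ (ds , cyc) → ac (cycle-inside M S s≁t ds cyc)
    where
    open Multigraph M
    s≁t : ¬ src zero ∼ tgt zero
    -- A loop is a cycle of length one.
    s≁t p = ac ((true , zero) ∷ [] , (src zero , ∼.refl , here , ∼.sym p) , (λ ()) , [] ∷ [] , [] ∷ [])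

  independent⇒acyclic : ∀ {k} (M : Multigraph n k) S → Independent (partition M) (included (ends M) S) →
                        Multigraph.Acyclic M S
  independent⇒acyclic M S i (ds , closed , ne , edges , _) =
    independent⇒no-trail M S i ds (closed , ne , edges)

-- Complex potentials

module SumProperties {c ℓ} (K : CommutativeRing c ℓ) where
  open CommutativeRing K hiding (zero)
  open IntegerSolver K
  open Sums rawRing public

  ∑-cong : ∀ {q} {f g : Subset q → Carrier} → (∀ I → f I ≈ g I) → ∑ f ≈ ∑ g
  ∑-cong {zero}  e = e []
  ∑-cong {suc q} e = +-cong (∑-cong λ I → e (outside ∷ I)) (∑-cong λ I → e (inside ∷ I))

  ∑-*ˡ : ∀ {q} x (f : Subset q → Carrier) → ∑ (λ I → x * f I) ≈ x * ∑ f
  ∑-*ˡ {zero}  x f = refl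
  ∑-*ˡ {suc q} x f = trans (+-cong (∑-*ˡ x (f ∘ (outside ∷_))) (∑-*ˡ x (f ∘ (inside ∷_)))) (sym (distribˡ x _ _))

  ∑-zero : ∀ {q} {f : Subset q → Carrier} → (∀ I → f I ≈ 0#) → ∑ f ≈ 0#
  ∑-zero {zero}  e = e []
  ∑-zero {suc q} e = trans (+-cong (∑-zero λ I → e (outside ∷ I)) (∑-zero λ I → e (inside ∷ I))) (+-identityˡ 0#)

module ComplexField {c ℓ₁ ℓ₂} (ℝ : RealField c ℓ₁ ℓ₂) where
  open RealField ℝ
  open OrderedField ℝ
  open Complex ℝ public
  open IntegerSolver commutativeRing

  -- The operations repeat those of `ℂ-rawRing`, so that sums over this ring and `evalℂ` agree
  -- definitionally.
  ℂ-commutativeRing : CommutativeRing c ℓ₁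
  ℂ-commutativeRing = record
    { Carrier = ℂ
    ; _≈_     = λ z w → (re z ≈ re w) × (im z ≈ im w)
    ; _+_     = λ z w → (re z + re w) +i (im z + im w)
    ; _*_     = λ z w → (re z * re w - im z * im w) +i (re z * im w + im z * re w)
    ; -_      = λ z → (- re z) +i (- im z)
    ; 0#      = fromℝ 0#
    ; 1#      = fromℝ 1#
    ; isCommutativeRing = record
      { isRing = record
        { +-isAbelianGroup = record
          { isGroup = record
            { isMonoid = record
              { isSemigroup = record
                { isMagma = record
                  { isEquivalence = record
                    { refl  = refl , refl
                    ; sym   = λ (p , q) → sym p , sym q
                    ; trans = λ (p , q) (r , s) → trans p r , trans q s }
                  ; ∙-cong = λ (p , q) (r , s) → +-cong p r , +-cong q s }
                ; assoc = λ _ _ _ → +-assoc _ _ _ , +-assoc _ _ _ }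
              ; identity = (λ _ → +-identityˡ _ , +-identityˡ _) , (λ _ → +-identityʳ _ , +-identityʳ _) }
            ; inverse = (λ _ → -‿inverseˡ _ , -‿inverseˡ _) , (λ _ → -‿inverseʳ _ , -‿inverseʳ _)
            ; ⁻¹-cong = λ (p , q) → -‿cong p , -‿cong q }
          ; comm = λ _ _ → +-comm _ _ , +-comm _ _ }
        ; *-cong = λ (p , q) (r , s) →
            +-cong (*-cong p r) (-‿cong (*-cong q s)) , +-cong (*-cong p s) (*-cong q r)
        ; *-assoc = λ x y z →
            solve 6 (λ a b c d e f → (a :* c :- b :* d) :* e :- (a :* d :+ b :* c) :* f
              := a :* (c :* e :- d :* f) :- b :* (c :* f :+ d :* e)) refl (re x) (im x) (re y) (im y) (re z) (im z)
          , solve 6 (λ a b c d e f → (a :* c :- b :* d) :* f :+ (a :* d :+ b :* c) :* e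
              := a :* (c :* f :+ d :* e) :+ b :* (c :* e :- d :* f)) refl (re x) (im x) (re y) (im y) (re z) (im z)
        ; *-identity = (λ x → one-*ˡ (re x) (im x)) , (λ x → one-*ʳ (re x) (im x))
        ; distrib = (λ x y z →
            solve 6 (λ a b c d e f → a :* (c :+ e) :- b :* (d :+ f)
              := (a :* c :- b :* d) :+ (a :* e :- b :* f)) refl (re x) (im x) (re y) (im y) (re z) (im z)
          , solve 6 (λ a b c d e f → a :* (d :+ f) :+ b :* (c :+ e)
              := (a :* d :+ b :* c) :+ (a :* f :+ b :* e)) refl (re x) (im x) (re y) (im y) (re z) (im z))
          , (λ x y z →
            solve 6 (λ a b c d e f → (c :+ e) :* a :- (d :+ f) :* b
              := (c :* a :- d :* b) :+ (e :* a :- f :* b)) refl (re x) (im x) (re y) (im y) (re z) (im z)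
          , solve 6 (λ a b c d e f → (c :+ e) :* b :+ (d :+ f) :* a
              := (c :* b :+ d :* a) :+ (e :* b :+ f :* a)) refl (re x) (im x) (re y) (im y) (re z) (im z))
        }
      ; *-comm = λ x y →
            solve 4 (λ a b c d → a :* c :- b :* d := c :* a :- d :* b) refl (re x) (im x) (re y) (im y)
          , solve 4 (λ a b c d → a :* d :+ b :* c := c :* b :+ d :* a) refl (re x) (im x) (re y) (im y)
      }
    }
    where
    one-*ˡ : ∀ a b → (1# * a - 0# * b ≈ a) × (1# * b + 0# * a ≈ b)
    one-*ˡ a b = solve 2 (λ a b → con (+ 1) :* a :- con (+ 0) :* b := a) refl a b
               , solve 2 (λ a b → con (+ 1) :* b :+ con (+ 0) :* a := b) refl a b
    one-*ʳ : ∀ a b → (a * 1# - b * 0# ≈ a) × (a * 0# + b * 1# ≈ b)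
    one-*ʳ a b = solve 2 (λ a b → a :* con (+ 1) :- b :* con (+ 0) := a) refl a b
               , solve 2 (λ a b → a :* con (+ 0) :+ b :* con (+ 1) := b) refl a b

  module ℂ′ = CommutativeRing ℂ-commutativeRing

  conj : ℂ → ℂ
  conj z = re z +i (- im z)

  ∣_∣² : ℂ → Carrier
  ∣ z ∣² = re z * re z + im z * im z

  ∣∣²-nonNeg : ∀ z → 0# ≤ ∣ z ∣²
  ∣∣²-nonNeg z = +-nonNeg (sq-nonNeg (re z)) (sq-nonNeg (im z))

  reciprocal : ∀ z → 0# < ∣ z ∣² → ℂ
  reciprocal z 0<n = (re z * inverse 0<n) +i (- (im z * inverse 0<n))

  reciprocalʳ : ∀ z (0<n : 0# < ∣ z ∣²) → z ℂ′.* reciprocal z 0<n ℂ′.≈ ℂ′.1#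
  reciprocalʳ z 0<n =
      trans (solve 3 (λ a b i → a :* (a :* i) :- b :* (:- (b :* i)) := i :* (a :* a :+ b :* b)) refl (re z) (im z) (inverse 0<n))
        (inverseˡ 0<n)
    , solve 3 (λ a b i → a :* (:- (b :* i)) :+ b :* (a :* i) := con (+ 0)) refl (re z) (im z) (inverse 0<n)

  abstract
    im-pos⇒∣∣²-pos : ∀ z → 0# < im z → 0# < ∣ z ∣²
    im-pos⇒∣∣²-pos z 0<im = +-nonNeg-pos (sq-nonNeg (re z)) (*-pos 0<im 0<im)

  Invertible : ℂ → Set (c ⊔ ℓ₁)
  Invertible z = ∃ λ i → i ℂ′.* z ℂ′.≈ ℂ′.1#

  -- Being different from 0 is weaker than being apart from it. Lack of an inverse would forbid a
  -- positive modulus, and a modulus that is not positive forces both coordinates to 0.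
  nonzero⇒invertible : ∀ z → ¬ (z ℂ′.≈ ℂ′.0#) → ¬ ¬ Invertible z
  nonzero⇒invertible z z≉0 k = z≉0 (square-zero (re z) re²≤0 , square-zero (im z) im²≤0)
    where
    n≤0 : ∣ z ∣² ≤ 0#
    n≤0 0<n = k (reciprocal z 0<n , ℂ′.trans (ℂ′.*-comm _ z) (reciprocalʳ z 0<n))
    re²≤0 : re z * re z ≤ 0#
    re²≤0 0<r = n≤0 (+-pos-nonNeg 0<r (sq-nonNeg (im z)))
    im²≤0 : im z * im z ≤ 0#
    im²≤0 0<i = n≤0 (+-nonNeg-pos (sq-nonNeg (re z)) 0<i)
    square-zero : ∀ x → x * x ≤ 0# → x ≈ 0#
    square-zero x x²≤0 = ≤-antisym (λ 0<x → x²≤0 (*-pos 0<x 0<x)) (λ x<0 → x²≤0 (*-negneg x<0 x<0))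

  *-cancel-nonzero : ∀ z w → ¬ (z ℂ′.≈ ℂ′.0#) → z ℂ′.* w ℂ′.≈ ℂ′.0# → ¬ ¬ (w ℂ′.≈ ℂ′.0#)
  *-cancel-nonzero z w z≉0 zw≈0 k = nonzero⇒invertible z z≉0 λ (i , iz≈1) → k (begin
    w               ≈⟨ ℂ′.*-identityˡ w ⟨
    ℂ′.1# ℂ′.* w      ≈⟨ ℂ′.*-congʳ iz≈1 ⟨
    i ℂ′.* z ℂ′.* w   ≈⟨ ℂ′.*-assoc i z w ⟩
    i ℂ′.* (z ℂ′.* w) ≈⟨ ℂ′.*-congˡ zw≈0 ⟩
    i ℂ′.* ℂ′.0#      ≈⟨ ℂ′.zeroʳ i ⟩
    ℂ′.0#            ∎)
    where open SetoidReasoning ℂ′.setoid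

  fromℝ-* : ∀ x y → fromℝ (x * y) ℂ′.≈ fromℝ x ℂ′.* fromℝ y
  fromℝ-* x y = solve 2 (λ x y → x :* y := x :* y :- con (+ 0) :* con (+ 0)) refl x y
              , solve 2 (λ x y → con (+ 0) := x :* con (+ 0) :+ con (+ 0) :* y) refl x y

  fromℝ-cong : ∀ {x y} → x ≈ y → fromℝ x ℂ′.≈ fromℝ y
  fromℝ-cong e = e , refl

-- Real networks with complex potentials

module Complexification {c ℓ₁ ℓ₂} (ℝ : RealField c ℓ₁ ℓ₂) {n : ℕ} where
  open RealField ℝ hiding (zero)
  open OrderedField ℝ
  open ComplexField ℝ
  open IntegerSolver commutativeRing
  private
    module Cℝ = Contraction commutativeRing {n}
    module Cℂ = Contraction ℂ-commutativeRing {n}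
    module Pℝ = Potential commutativeRing {n}
    module Pℂ = Potential ℂ-commutativeRing {n}
  open Partition using (_≟_) renaming (_∼_ to _⊢_∼_)

  module _ (Q : Pℝ.SymmetricForm) where
    open SetoidReasoning (CommutativeRing.setoid commutativeRing)
    private
      B = Pℝ.form Q

    abstract
      form-scale : ∀ x u w → B (λ i → x * u i) w ≈ x * B u w
      form-scale x u w = begin
        B (λ i → x * u i) w            ≈⟨ Pℝ.form-cong Q w (λ i → solve 2 (λ x u → x :* u := x :* u :+ con (+ 0) :* u) refl x (u i)) ⟩
        B (λ i → x * u i + 0# * u i) w ≈⟨ Pℝ.form-lin Q x u 0# u w ⟩
        x * B u w + 0# * B u w         ≈⟨ solve 2 (λ x q → x :* q :+ con (+ 0) :* q := x :* q) refl x (B u w) ⟩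
        x * B u w                      ∎

      form-neg : ∀ u w → B (λ i → - u i) w ≈ - B u w
      form-neg u w = begin
        B (λ i → - u i) w          ≈⟨ Pℝ.form-cong Q w (λ i → solve 1 (λ u → :- u := (:- con (+ 1)) :* u) refl (u i)) ⟩
        B (λ i → (- 1#) * u i) w   ≈⟨ form-scale (- 1#) u w ⟩
        (- 1#) * B u w             ≈⟨ solve 1 (λ q → (:- con (+ 1)) :* q := :- q) refl (B u w) ⟩
        - B u w                    ∎

      form-lin₄ : ∀ x y z t p q r s w →
        B (λ i → (x * p i - y * q i) + (z * r i - t * s i)) w
        ≈ (x * B p w - y * B q w) + (z * B r w - t * B s w)
      form-lin₄ x y z t p q r s w = begin
        B (λ i → (x * p i - y * q i) + (z * r i - t * s i)) w
          ≈⟨ Pℝ.form-cong Q w (λ i → solve 2 (λ a b → a :+ b := con (+ 1) :* a :+ con (+ 1) :* b) refl _ _) ⟩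
        B (λ i → 1# * (x * p i - y * q i) + 1# * (z * r i - t * s i)) w
          ≈⟨ Pℝ.form-lin Q 1# _ 1# _ w ⟩
        1# * B (λ i → x * p i - y * q i) w + 1# * B (λ i → z * r i - t * s i) w
          ≈⟨ +-cong (*-congˡ (difference x y p q)) (*-congˡ (difference z t r s)) ⟩
        1# * (x * B p w - y * B q w) + 1# * (z * B r w - t * B s w)
          ≈⟨ solve 2 (λ a b → con (+ 1) :* a :+ con (+ 1) :* b := a :+ b) refl _ _ ⟩
        (x * B p w - y * B q w) + (z * B r w - t * B s w) ∎
        where
        difference : ∀ x y p q → B (λ i → x * p i - y * q i) w ≈ x * B p w - y * B q w
        difference x y p q = trans
          (Pℝ.form-cong Q w (λ i → solve 4 (λ x y p q → x :* p :- y :* q := x :* p :+ (:- y) :* q) refl x y (p i) (q i)))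
          (trans (Pℝ.form-lin Q x p (- y) q w)
            (solve 4 (λ x y p q → x :* p :+ (:- y) :* q := x :* p :- y :* q) refl x y (B p w) (B q w)))

      form-lin₄⁺ : ∀ x y z t p q r s w →
        B (λ i → (x * p i + y * q i) + (z * r i + t * s i)) w
        ≈ (x * B p w + y * B q w) + (z * B r w + t * B s w)
      form-lin₄⁺ x y z t p q r s w = begin
        B (λ i → (x * p i + y * q i) + (z * r i + t * s i)) w
          ≈⟨ Pℝ.form-cong Q w (λ i → solve 2 (λ a b → a :+ b := con (+ 1) :* a :+ con (+ 1) :* b) refl _ _) ⟩
        B (λ i → 1# * (x * p i + y * q i) + 1# * (z * r i + t * s i)) w
          ≈⟨ Pℝ.form-lin Q 1# _ 1# _ w ⟩
        1# * B (λ i → x * p i + y * q i) w + 1# * B (λ i → z * r i + t * s i) w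
          ≈⟨ +-cong (*-congˡ (Pℝ.form-lin Q x p y q w)) (*-congˡ (Pℝ.form-lin Q z r t s w)) ⟩
        1# * (x * B p w + y * B q w) + 1# * (z * B r w + t * B s w)
          ≈⟨ solve 2 (λ a b → con (+ 1) :* a :+ con (+ 1) :* b := a :+ b) refl _ _ ⟩
        (x * B p w + y * B q w) + (z * B r w + t * B s w) ∎

    -- The bilinear extension, not the sesquilinear one: symmetry, and with it `reciprocity`, must
    -- persist. Conjugation enters only when the energy of a potential is formed.
    complexForm : (u w : Fin n → ℂ) → ℂ
    complexForm u w = (B (re ∘ u) (re ∘ w) - B (im ∘ u) (im ∘ w)) +i (B (re ∘ u) (im ∘ w) + B (im ∘ u) (re ∘ w))

    abstract
      complexForm-cong : ∀ {u v} w → (∀ i → u i ℂ′.≈ v i) → complexForm u w ℂ′.≈ complexForm v w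
      complexForm-cong w e =
          +-cong (Pℝ.form-cong Q (re ∘ w) (proj₁ ∘ e)) (-‿cong (Pℝ.form-cong Q (im ∘ w) (proj₂ ∘ e)))
        , +-cong (Pℝ.form-cong Q (im ∘ w) (proj₁ ∘ e)) (Pℝ.form-cong Q (re ∘ w) (proj₂ ∘ e))

      complexForm-sym : ∀ u w → complexForm u w ℂ′.≈ complexForm w u
      complexForm-sym u w =
          +-cong (Pℝ.form-sym Q _ _) (-‿cong (Pℝ.form-sym Q _ _))
        , trans (+-comm _ _) (+-cong (Pℝ.form-sym Q _ _) (Pℝ.form-sym Q _ _))

      complexForm-lin : ∀ x u y v w → complexForm (λ i → x ℂ′.* u i ℂ′.+ y ℂ′.* v i) w
                        ℂ′.≈ x ℂ′.* complexForm u w ℂ′.+ y ℂ′.* complexForm v w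
      complexForm-lin x u y v w =
          trans (+-cong (real (re ∘ w)) (-‿cong (imag (im ∘ w))))
            (solve 12 (λ a b c d p q r s p′ q′ r′ s′ →
              ((a :* p :- b :* q) :+ (c :* r :- d :* s)) :- ((a :* q′ :+ b :* p′) :+ (c :* s′ :+ d :* r′))
              := (a :* (p :- q′) :- b :* (p′ :+ q)) :+ (c :* (r :- s′) :- d :* (r′ :+ s)))
              refl a b a′ b′ (B (re ∘ u) (re ∘ w)) (B (im ∘ u) (re ∘ w)) (B (re ∘ v) (re ∘ w)) (B (im ∘ v) (re ∘ w))
                (B (re ∘ u) (im ∘ w)) (B (im ∘ u) (im ∘ w)) (B (re ∘ v) (im ∘ w)) (B (im ∘ v) (im ∘ w)))
        , trans (+-cong (real (im ∘ w)) (imag (re ∘ w)))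
            (solve 12 (λ a b c d p q r s p′ q′ r′ s′ →
              ((a :* p′ :- b :* q′) :+ (c :* r′ :- d :* s′)) :+ ((a :* q :+ b :* p) :+ (c :* s :+ d :* r))
              := (a :* (p′ :+ q) :+ b :* (p :- q′)) :+ (c :* (r′ :+ s) :+ d :* (r :- s′)))
              refl a b a′ b′ (B (re ∘ u) (re ∘ w)) (B (im ∘ u) (re ∘ w)) (B (re ∘ v) (re ∘ w)) (B (im ∘ v) (re ∘ w))
                (B (re ∘ u) (im ∘ w)) (B (im ∘ u) (im ∘ w)) (B (re ∘ v) (im ∘ w)) (B (im ∘ v) (im ∘ w)))
        where
        a b a′ b′ : Carrier
        a = re x
        b = im x
        a′ = re y
        b′ = im y
        real : ∀ w → B (λ i → re (x ℂ′.* u i ℂ′.+ y ℂ′.* v i)) w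
               ≈ (a * B (re ∘ u) w - b * B (im ∘ u) w) + (a′ * B (re ∘ v) w - b′ * B (im ∘ v) w)
        real w = form-lin₄ a b a′ b′ (re ∘ u) (im ∘ u) (re ∘ v) (im ∘ v) w
        imag : ∀ w → B (λ i → im (x ℂ′.* u i ℂ′.+ y ℂ′.* v i)) w
               ≈ (a * B (im ∘ u) w + b * B (re ∘ u) w) + (a′ * B (im ∘ v) w + b′ * B (re ∘ v) w)
        imag w = form-lin₄⁺ a b a′ b′ (im ∘ u) (re ∘ u) (im ∘ v) (re ∘ v) w

    complexify : Pℂ.SymmetricForm
    complexify = record
      { form = complexForm ; form-cong = complexForm-cong ; form-sym = complexForm-sym ; form-lin = complexForm-lin }

    -- The cross terms between real and imaginary parts cancel by symmetry, so real conductors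
    -- contribute real energy.
    complexify-im : ∀ u → im (complexForm u (conj ∘ u)) ≈ 0#
    complexify-im u = begin
      B (re ∘ u) (λ i → - im (u i)) + B (im ∘ u) (re ∘ u)  ≈⟨ +-cong (trans (Pℝ.form-sym Q _ _) (form-neg (im ∘ u) (re ∘ u))) refl ⟩
      - B (im ∘ u) (re ∘ u) + B (im ∘ u) (re ∘ u)          ≈⟨ -‿inverseˡ _ ⟩
      0#                                                   ∎

    module _ {Θ : Partition n → Carrier} where

      contracted-complex : ∀ π a b → Cℂ.contracted (fromℝ ∘ Θ) π a b ℂ′.≈ fromℝ (Cℝ.contracted Θ π a b)
      contracted-complex π a b = go (_≟_ π a b)
        where
        go : Dec (π ⊢ a ∼ b) → Cℂ.contracted (fromℝ ∘ Θ) π a b ℂ′.≈ fromℝ (Cℝ.contracted Θ π a b)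
        go (yes p) = ℂ′.trans (Cℂ.contracted-loop (fromℝ ∘ Θ) π p) (fromℝ-cong (sym (Cℝ.contracted-loop Θ π p)))
        go (no ¬p) = ℂ′.trans (Cℂ.contracted-link (fromℝ ∘ Θ) π ¬p) (fromℝ-cong (sym (Cℝ.contracted-link Θ π ¬p)))

      green-complexify : ∀ {π a b} → Pℝ.Green Θ Q π a b → Pℂ.Green (fromℝ ∘ Θ) complexify π a b
      green-complexify {π} {a} {b} G = record
        { potential = fromℝ ∘ u
        ; respects  = λ p → Pℝ.respects G p , refl
        ; weak      = λ w resp →
              trans (+-cong (Pℝ.weak G (re ∘ w) (proj₁ ∘ resp)) (-‿cong (Pℝ.form-zeroˡ Q _))) (solve 1 (λ x → x :- con (+ 0) := x) refl _)
            , trans (+-cong (Pℝ.weak G (im ∘ w) (proj₂ ∘ resp)) (Pℝ.form-zeroˡ Q _)) (+-identityʳ _)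
        ; drop      = ℂ′.trans
            ( solve 3 (λ T x y → T :* (x :- y) :- con (+ 0) :* (con (+ 0) :- con (+ 0)) := T :* (x :- y)) refl (Θ π) (u a) (u b)
            , solve 3 (λ T x y → T :* (con (+ 0) :- con (+ 0)) :+ con (+ 0) :* (x :- y) := con (+ 0)) refl (Θ π) (u a) (u b))
            (ℂ′.trans (fromℝ-cong (Pℝ.drop G)) (ℂ′.sym (contracted-complex π a b)))
        }
        where u = Pℝ.potential G

-- Ports with impedances in the upper half-plane

module HalfPlane {c ℓ₁ ℓ₂} (ℝ : RealField c ℓ₁ ℓ₂) {n : ℕ} where
  open RealField ℝ hiding (zero)
  open OrderedField ℝ
  open ComplexField ℝ
  open IntegerSolver commutativeRing
  open Contraction ℂ-commutativeRing {n}
  open Potential ℂ-commutativeRing {n}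
  private
    module Cℝ = Contraction commutativeRing {n}
    module Eℝ = Chain commutativeRing {n}
    module Xℂ = Complexification ℝ {n}
    module S = SumProperties ℂ-commutativeRing
  open Partition using (_≟_) renaming (_∼_ to _⊢_∼_)

  -- The invariant kept while ports are added. An impedance in the upper half-plane has its
  -- reciprocal, the admittance, in the lower one, whence the sign of `dissipation`. `green` is
  -- doubly negated because its construction inverts numbers known only to be nonzero.
  record Dissipative (Θ : Partition n → ℂ) (Q : SymmetricForm) : Set (lsuc 0ℓ ⊔ c ⊔ ℓ₁ ⊔ ℓ₂) where
    field
      congruent   : Congruent Θ
      nonzero     : ∀ π → ¬ (Θ π ℂ′.≈ ℂ′.0#)
      green       : ∀ π a b → ¬ ¬ Green Θ Q π a b
      dissipation : ∀ u → im (form Q u (conj ∘ u)) ≤ 0#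

  -- The tree sum sees the impedance `z` as the weight of deletion, the form sees the admittance
  -- `y`; `reciprocalʳ` is the relation between them that `green-link` asks for.
  module Step (Θ : Partition n → ℂ) (Q : SymmetricForm) (D : Dissipative Θ Q)
              (z : ℂ) (0<z : 0# < im z) (s t : Fin n) where
    open Dissipative D
    private
      0<n = im-pos⇒∣∣²-pos z 0<z
      y = reciprocal z 0<n
      Θ′ = extend Θ z ℂ′.1# s t
      Q′ = addEdge Q s t y

      z≉0 : ¬ (z ℂ′.≈ ℂ′.0#)
      z≉0 (_ , e) = <-irrefl (sym e) 0<z

      -- If z Θ π + Θ (π / st) vanished, the potential driven from s to t would
      -- have voltage drop - z, and its energy, the conjugate of the drop, would
      -- have positive imaginary part.
      no-resonance : ∀ π → Green Θ Q π s t → ¬ (Θ′ π ℂ′.≈ ℂ′.0#)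
      no-resonance π G e = *-cancel-nonzero (Θ π) (z ℂ′.+ r) (nonzero π) vanishes λ z+r≈0 →
        dissipation u (<-respʳ (im-energy z+r≈0) 0<z)
        where
        u = potential G
        r = u ⟨ s , t ⟩
        vanishes : Θ π ℂ′.* (z ℂ′.+ r) ℂ′.≈ ℂ′.0#
        vanishes = begin
          Θ π ℂ′.* (z ℂ′.+ r)            ≈⟨ ℂ′.distribˡ (Θ π) z r ⟩
          Θ π ℂ′.* z ℂ′.+ Θ π ℂ′.* r     ≈⟨ ℂ′.+-cong (ℂ′.*-comm (Θ π) z) (ℂ′.trans (drop G) (ℂ′.sym (ℂ′.*-identityˡ _))) ⟩
          Θ′ π                           ≈⟨ e ⟩
          ℂ′.0#                          ∎
          where open SetoidReasoning ℂ′.setoid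
        im-energy : z ℂ′.+ r ℂ′.≈ ℂ′.0# → im z ≈ im (form Q u (conj ∘ u))
        im-energy (_ , z+r≈0) = begin
          im z                          ≈⟨ solve 3 (λ z us ut → z := (z :+ (us :- ut)) :+ ((:- us) :- (:- ut))) refl (im z) (im (u s)) (im (u t)) ⟩
          (im z + (im (u s) - im (u t))) + ((- im (u s)) - (- im (u t)))
                                        ≈⟨ +-congʳ z+r≈0 ⟩
          0# + ((- im (u s)) - (- im (u t))) ≈⟨ +-identityˡ _ ⟩
          (- im (u s)) - (- im (u t))   ≈⟨ proj₂ (weak G (conj ∘ u) (λ p → proj₁ (respects G p) , -‿cong (proj₂ (respects G p)))) ⟨
          im (form Q u (conj ∘ u))      ∎
          where open SetoidReasoning (CommutativeRing.setoid commutativeRing)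

      nonzero′ : ∀ π → ¬ (Θ′ π ℂ′.≈ ℂ′.0#)
      nonzero′ π e = go (_≟_ π s t)
        where
        go : Dec (π ⊢ s ∼ t) → ⊥
        go (yes p) = *-cancel-nonzero z (Θ π) z≉0
          (ℂ′.trans (ℂ′.sym (ℂ′.trans (ℂ′.+-congˡ (ℂ′.trans (ℂ′.*-congˡ (contracted-loop Θ π p)) (ℂ′.zeroʳ ℂ′.1#))) (ℂ′.+-identityʳ _))) e)
          (nonzero π)
        go (no ¬p) = green π s t λ G → no-resonance π G e

      green′ : ∀ π a b → ¬ ¬ Green Θ′ Q′ π a b
      green′ π a b k = go (_≟_ π s t)
        where
        go : Dec (π ⊢ s ∼ t) → ⊥
        go (yes p) = green π a b λ G → k (green-loop {Θ} congruent Q π z ℂ′.1# y s t p G)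
        go (no ¬p) = green π a b λ G → green π s t λ E → green (contract π s t) a b λ G″ →
          nonzero⇒invertible (Θ′ π) (nonzero′ π) λ (i , iΘ′≈1) →
          k (green-link {Θ} congruent Q π z ℂ′.1# y s t ¬p (ℂ′.sym (reciprocalʳ z 0<n)) i iΘ′≈1 G E G″)

      dissipation′ : ∀ u → im (form Q′ u (conj ∘ u)) ≤ 0#
      dissipation′ u = ≤-resp refl (+-identityˡ 0#) (+-mono-≤ (dissipation u) edge)
        where
        i = inverse 0<n
        v = u ⟨ s , t ⟩
        -- The edge contributes `y` times the squared modulus of `v`, and the imaginary part of `y`
        -- is minus that of `z` over the squared modulus of `z`.
        edge : im (y ℂ′.* (v ℂ′.* (conj ∘ u) ⟨ s , t ⟩)) ≤ 0#
        edge = 0≤y-x⇒x≤y (≤-resp refl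
          (solve 7 (λ x y i us ut vs vt → (y :* i) :* ((us :- ut) :* (us :- ut) :+ (vs :- vt) :* (vs :- vt))
            := con (+ 0) :- ((x :* i) :* ((us :- ut) :* ((:- vs) :- (:- vt)) :+ (vs :- vt) :* (us :- ut))
                       :+ (:- (y :* i)) :* ((us :- ut) :* (us :- ut) :- (vs :- vt) :* ((:- vs) :- (:- vt)))))
            refl (re z) (im z) i (re (u s)) (re (u t)) (im (u s)) (im (u t)))
          (*-nonNeg (<⇒≤ (*-pos 0<z (inverse-pos 0<n))) (∣∣²-nonNeg v)))

    dissipative : Dissipative Θ′ Q′
    dissipative = record
      { congruent   = extend-cong {Θ} congruent z ℂ′.1# s t
      ; nonzero     = nonzero′
      ; green       = green′
      ; dissipation = dissipation′
      }

  -- The variable weights deletion, since a factor `z i` records that `i` lies in `I`, that is, that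
  -- the tree avoids the new edge `i`.
  portSum : (Partition n → ℂ) → ∀ {q} → (Fin q → Fin n × Fin n) → (Fin q → ℂ) → Partition n → ℂ
  portSum Θ {zero}  e z = Θ
  portSum Θ {suc q} e z =
    extend (portSum Θ (e ∘ suc) (z ∘ suc)) (z zero) ℂ′.1# (proj₁ (e zero)) (proj₂ (e zero))

  portForm : SymmetricForm → ∀ {q} → (Fin q → Fin n × Fin n) → (z : Fin q → ℂ) → (∀ i → 0# < im (z i)) → SymmetricForm
  portForm Q {zero}  e z 0<z = Q
  portForm Q {suc q} e z 0<z =
    addEdge (portForm Q (e ∘ suc) (z ∘ suc) (0<z ∘ suc)) (proj₁ (e zero)) (proj₂ (e zero))
      (reciprocal (z zero) (im-pos⇒∣∣²-pos (z zero) (0<z zero)))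

  portSum-dissipative : ∀ {Θ Q} → Dissipative Θ Q → ∀ {q} e (z : Fin q → ℂ) (0<z : ∀ i → 0# < im (z i)) →
                        Dissipative (portSum Θ e z) (portForm Q e z 0<z)
  portSum-dissipative D {zero}  e z 0<z = D
  portSum-dissipative {Θ} {Q} D {suc q} e z 0<z =
    Step.dissipative (portSum Θ (e ∘ suc) (z ∘ suc)) (portForm Q (e ∘ suc) (z ∘ suc) (0<z ∘ suc))
      (portSum-dissipative D (e ∘ suc) (z ∘ suc) (0<z ∘ suc)) (z zero) (0<z zero) _ _

  module _ (Θ : Partition n → Carrier) where
    portSum-∑ : ∀ {q} (e : Fin q → Fin n × Fin n) z π →
      S.∑ (λ I → fromℝ (Eℝ.chain Θ (omitted e I) π) ℂ′.* S.∏[ I ] z) ℂ′.≈ portSum (fromℝ ∘ Θ) e z π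
    portSum-∑ {zero}  e z π = ℂ′.*-identityʳ _
    portSum-∑ {suc q} e z π = ℂ′.trans (ℂ′.+-comm _ _) (ℂ′.+-cong chosen excluded)
      where
      open SetoidReasoning ℂ′.setoid
      e′ = e ∘ suc
      z′ = z ∘ suc
      a = proj₁ (e zero)
      b = proj₂ (e zero)
      f : Subset q → Partition n → Carrier
      f I = Eℝ.chain Θ (omitted e′ I)
      g : Partition n → Subset q → ℂ
      g π I = fromℝ (f I π) ℂ′.* S.∏[ I ] z′
      P = portSum (fromℝ ∘ Θ) e′ z′
      chosen : S.∑ (λ I → fromℝ (f I π) ℂ′.* S.∏[ inside ∷ I ] z) ℂ′.≈ z zero ℂ′.* P π
      chosen = begin
        S.∑ (λ I → fromℝ (f I π) ℂ′.* S.∏[ inside ∷ I ] z)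
          ≈⟨ S.∑-cong (λ I → ℂ′.trans (ℂ′.sym (ℂ′.*-assoc (fromℝ (f I π)) (z zero) (S.∏[ I ] z′)))
               (ℂ′.trans (ℂ′.*-congʳ (ℂ′.*-comm (fromℝ (f I π)) (z zero))) (ℂ′.*-assoc (z zero) (fromℝ (f I π)) (S.∏[ I ] z′)))) ⟩
        S.∑ (λ I → z zero ℂ′.* g π I)  ≈⟨ S.∑-*ˡ (z zero) (g π) ⟩
        z zero ℂ′.* S.∑ (g π)          ≈⟨ ℂ′.*-congˡ (portSum-∑ e′ z′ π) ⟩
        z zero ℂ′.* P π                ∎
      excluded : S.∑ (λ I → fromℝ (Cℝ.contracted (f I) π a b) ℂ′.* S.∏[ outside ∷ I ] z) ℂ′.≈ ℂ′.1# ℂ′.* contracted P π a b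
      excluded = ℂ′.trans (S.∑-cong (λ I → ℂ′.*-congˡ {fromℝ (Cℝ.contracted (f I) π a b)} (ℂ′.*-identityˡ (S.∏[ I ] z′))))
        (ℂ′.trans (go (_≟_ π a b)) (ℂ′.sym (ℂ′.*-identityˡ _)))
        where
        go : Dec (π ⊢ a ∼ b) → S.∑ (λ I → fromℝ (Cℝ.contracted (f I) π a b) ℂ′.* S.∏[ I ] z′) ℂ′.≈ contracted P π a b
        go (yes p) = ℂ′.trans
          (S.∑-zero λ I → ℂ′.trans (ℂ′.*-congʳ (fromℝ-cong (Cℝ.contracted-loop (f I) π p))) (ℂ′.zeroˡ _))
          (ℂ′.sym (contracted-loop P π p))
        go (no ¬p) = ℂ′.trans (S.∑-cong λ I → ℂ′.*-congʳ {S.∏[ I ] z′} (fromℝ-cong (Cℝ.contracted-link (f I) π ¬p)))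
          (ℂ′.trans (portSum-∑ e′ z′ (contract π a b)) (ℂ′.sym (contracted-link P π ¬p)))

  module _ (Θ : Partition n → Carrier) (cong : Cℝ.Congruent Θ) (Θ-pos : ∀ π → 0# < Θ π)
           (Q : Potential.SymmetricForm commutativeRing {n})
           (green : ∀ π a b → Potential.Green commutativeRing Θ Q π a b) where

    dissipative-real : Dissipative (fromℝ ∘ Θ) (Xℂ.complexify Q)
    dissipative-real = record
      { congruent   = λ π ρ p → fromℝ-cong (cong π ρ p)
      ; nonzero     = λ π (e , _) → <-irrefl (sym e) (Θ-pos π)
      ; green       = λ π a b k → k (Xℂ.green-complexify Q {Θ} (green π a b))
      ; dissipation = λ u → ≤-reflexive (Xℂ.complexify-im Q u)
      }

    chain-stable : ∀ {q} (e : Fin q → Fin n × Fin n) π →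
                   Stability.RealStable ℝ (λ I → Eℝ.chain Θ (omitted e I) π)
    chain-stable e π z 0<z p =
      Dissipative.nonzero (portSum-dissipative dissipative-real e z 0<z) π
        (ℂ′.trans (ℂ′.sym (portSum-∑ Θ e z π)) p)

-- Counting the classes of a partition

length-filter-remove : ∀ {A : Set} {p q} {P : U.Pred A p} {Q : U.Pred A q} (P? : U.Decidable P) (Q? : U.Decidable Q)
  (x : A) → P x → (∀ {y} → Q y → P y × y ≢ x) → (∀ {y} → P y → y ≢ x → Q y) →
  ∀ {xs} → Unique xs → x List.∈ xs → length (filter P? xs) ≡ suc (length (filter Q? xs))
length-filter-remove {P = P} {Q} P? Q? x Px to from = go
  where
  same : ∀ {xs} → All (x ≢_) xs → length (filter P? xs) ≡ length (filter Q? xs)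
  same []                        = ≡.refl
  same (_∷_ {y} {xs} x≢y x∉) with P? y | Q? y
  ... | yes _ | yes _ = ≡.cong suc (same x∉)
  ... | no  _ | no  _ = same x∉
  ... | yes p | no ¬q = contradiction (from p (λ e → x≢y (≡.sym e))) ¬q
  ... | no ¬p | yes q = contradiction (proj₁ (to q)) ¬p
  go : ∀ {xs} → Unique xs → x List.∈ xs → length (filter P? xs) ≡ suc (length (filter Q? xs))
  go (x∉ ∷ _) (here ≡.refl) with P? x | Q? x
  ... | yes _ | no _  = ≡.cong suc (same x∉)
  ... | yes _ | yes q = contradiction ≡.refl (proj₂ (to q))
  ... | no ¬p | _     = contradiction Px ¬p
  go (_∷_ {y} y∉ u) (there x∈) with P? y | Q? y
  ... | yes _ | yes _ = ≡.cong suc (go u x∈)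
  ... | no  _ | no  _ = go u x∈
  ... | yes p | no ¬q = contradiction (from p (All.lookup y∉ x∈)) ¬q
  ... | no ¬p | yes q = contradiction (proj₁ (to q)) ¬p

length-filter-⇔ : ∀ {A : Set} {p q} {P : U.Pred A p} {Q : U.Pred A q} (P? : U.Decidable P) (Q? : U.Decidable Q) →
  (∀ {y} → Q y → P y) → (∀ {y} → P y → Q y) → ∀ xs → length (filter P? xs) ≡ length (filter Q? xs)
length-filter-⇔ P? Q? to from xs = ≡.cong length (List.filter-≐ P? Q? (from , to) xs)

module _ {n : ℕ} where
  open Partition using (_≟_) renaming (_∼_ to _⊢_∼_)

  Least : Partition n → Fin n → Set
  Least π v = ∀ u → π ⊢ v ∼ u → v Fin.≤ u

  least? : ∀ π → U.Decidable (Least π)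
  least? π v = Fin.all? λ u → _≟_ π v u →-dec (v Fin.≤? u)

  -- Counting least representatives makes this agree definitionally with `componentCount` when the
  -- classes are the components of a forest.
  classCount : Partition n → ℕ
  classCount π = length (filter (least? π) (allFin n))

  least-unique : ∀ π {u v} → Least π u → Least π v → π ⊢ u ∼ v → u ≡ v
  least-unique π lu lv p = Fin.≤-antisym (lu _ p) (lv _ (Partition.sym π p))

  least-of : ∀ π a → ∃ λ x → π ⊢ a ∼ x × Least π x
  least-of π a = descend a (Fin.<-wellFounded a)
    where
    descend : ∀ a → Acc Fin._<_ a → ∃ λ x → π ⊢ a ∼ x × Least π x
    descend a (acc rec) with least? π a
    ... | yes l = a , Partition.refl π , l
    ... | no ¬l with Fin.¬∀⟶∃¬ n _ (λ u → _≟_ π a u →-dec (a Fin.≤? u)) ¬l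
    ... | u , ¬le with _≟_ π a u
    ... | no ¬p = ⊥-elim (¬le λ p → ⊥-elim (¬p p))
    ... | yes p with descend u (rec (ℕ.≰⇒> λ a≤u → ¬le λ _ → a≤u))
    ... | x , q , l = x , Partition.trans π p q , l

  classCount-cong : ∀ {π ρ} → π ≋ ρ → classCount π ≡ classCount ρ
  classCount-cong {π} {ρ} (p , q) = length-filter-⇔ (least? π) (least? ρ)
    (λ l u r → l u (p r)) (λ l u r → l u (q r)) (allFin n)

  private
    -- Among all least representatives, only the larger one, `b`, ceases to be least in its class.
    classCount-least : ∀ π {a b} → Least π a → Least π b → a Fin.< b → classCount π ≡ suc (classCount (contract π a b))
    classCount-least π {a} {b} la lb a<b =
      length-filter-remove (least? π) (least? (contract π a b)) b lb
        (λ l → (λ u p → l u (inj₁ p)) , λ { ≡.refl → ℕ.<⇒≱ a<b (l a (Partition.sym (contract π a b) (contract-joins π a b))) })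
        least-contract (Unique.allFin⁺ n) (∈-allFin b)
      where
      open Partition π using (sym)
      least-contract : ∀ {v} → Least π v → v ≢ b → Least (contract π a b) v
      least-contract lv v≢b u (inj₁ p) = lv u p
      least-contract lv v≢b u (inj₂ (inj₂ p , _)) = contradiction (least-unique π lv lb p) v≢b
      least-contract lv v≢b u (inj₂ (inj₁ p , q)) with least-unique π lv la p
      ... | ≡.refl with q
      ... | inj₁ r = la u (sym r)
      ... | inj₂ r = ℕ.≤-trans (ℕ.<⇒≤ a<b) (lb u (sym r))

  classCount-contract : ∀ π {a b} → ¬ π ⊢ a ∼ b → classCount π ≡ suc (classCount (contract π a b))
  classCount-contract π {a} {b} a≁b with least-of π a | least-of π b
  ... | x , a∼x , lx | y , b∼y , ly with Fin.<-cmp x y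
  ... | tri≈ _ ≡.refl _ = contradiction (Partition.trans π a∼x (Partition.sym π b∼y)) a≁b
  ... | tri< x<y _ _ = ≡.trans (classCount-least π lx ly x<y)
    (≡.cong suc (classCount-cong {contract π x y} {contract π a b} (repl a∼x b∼y , repl (π.sym a∼x) (π.sym b∼y))))
    where
    module π = Partition π
    repl : ∀ {a b x y} → π ⊢ a ∼ x → π ⊢ b ∼ y → contract π x y ⊑ contract π a b
    repl p q = contract-least π {contract π _ _} inj₁ (inj₂ (inj₁ (π.sym p) , inj₂ (π.sym q)))
  ... | tri> _ _ y<x = ≡.trans (classCount-least π ly lx y<x)
    (≡.cong suc (classCount-cong {contract π y x} {contract π a b} (repl a∼x b∼y , repl′)))
    where
    module π = Partition π
    repl : ∀ {a b x y} → π ⊢ a ∼ x → π ⊢ b ∼ y → contract π y x ⊑ contract π a b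
    repl p q = contract-least π {contract π _ _} inj₁ (inj₂ (inj₂ (π.sym q) , inj₁ (π.sym p)))
    repl′ : contract π a b ⊑ contract π y x
    repl′ = contract-least π {contract π y x} inj₁ (inj₂ (inj₂ a∼x , inj₁ b∼y))

  open Closure {n} {E = Fin n × Fin n} proj₁ proj₂

  classCount-closure : ∀ xs π → Independent π xs → classCount π ≡ length xs ℕ.+ classCount (closure π xs)
  classCount-closure []             π tt      = ≡.refl
  classCount-closure ((a , b) ∷ xs) π (p , i) =
    ≡.trans (classCount-contract π p) (≡.cong suc (classCount-closure xs (contract π a b) i))

-- The first argument rules out an empty vertex set, which would have no class at all.
classCount-total : ∀ {n} → Fin n → (π : Partition n) → Total π → classCount π ≡ 1
classCount-total {suc n} _ π tot = begin
  length (filter (least? π) (zero ∷ tabulate suc))  ≡⟨ ≡.cong length (List.filter-accept (least? π) {zero} (λ _ _ → ℕ.z≤n)) ⟩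
  suc (length (filter (least? π) (tabulate suc)))   ≡⟨ ≡.cong (suc ∘ length) (List.filter-none (least? π) (All.tabulate⁺ {f = suc} λ i l → ℕ.n≮0 (l zero (tot (suc i) zero)))) ⟩
  1 ∎
  where open ≡.≡-Reasoning

length-included : ∀ {q} {E : Set} (e : Fin q → E) S → length (included e S) ≡ ∣ S ∣
length-included e []            = ≡.refl
length-included e (inside  ∷ S) = ≡.cong suc (length-included (e ∘ suc) S)
length-included e (outside ∷ S) = length-included (e ∘ suc) S

omitted-⊤ : ∀ {q} {E : Set} (e : Fin q → E) → omitted e Subset.⊤ ≡ []
omitted-⊤ {zero}  e = ≡.refl
omitted-⊤ {suc q} e = omitted-⊤ (e ∘ suc)

omitted-⊥ : ∀ {q} {E : Set} (e : Fin q → E) → omitted e Subset.⊥ ≡ tabulate e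
omitted-⊥ {zero}  e = ≡.refl
omitted-⊥ {suc q} e = ≡.cong (e zero ∷_) (omitted-⊥ (e ∘ suc))

-- Expansion of tree sums over edge subsets

module SpanningTrees {c ℓ₁ ℓ₂} (ℝ : RealField c ℓ₁ ℓ₂) {n : ℕ} where
  open RealField ℝ hiding (zero)
  open IntegerSolver commutativeRing
  open Contraction commutativeRing {n}
  open Chain commutativeRing {n} public
  open TreeSum ℝ {n} using (resistor; totality; totality-yes; totality-no; treeSum; treeSum-cong) public
  open SumProperties commutativeRing public
  open Closure {n} {E = Fin n × Fin n} proj₁ proj₂
  open Partition using (_≟_) renaming (_∼_ to _⊢_∼_)

  module _ (Θ : Partition n → Carrier) where

    chain-independent : ∀ xs π → Independent π xs → chain Θ xs π ≈ Θ (closure π xs)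
    chain-independent []             π tt      = refl
    chain-independent ((a , b) ∷ xs) π (p , i) =
      trans (contracted-link (chain Θ xs) π p) (chain-independent xs (contract π a b) i)

    chain-dependent : ∀ xs π → ¬ Independent π xs → chain Θ xs π ≈ 0#
    chain-dependent []             π ¬i = ⊥-elim (¬i tt)
    chain-dependent ((a , b) ∷ xs) π ¬i = go (_≟_ π a b)
      where
      go : Dec (π ⊢ a ∼ b) → contracted (chain Θ xs) π a b ≈ 0#
      go (yes p) = contracted-loop (chain Θ xs) π p
      go (no ¬p) = trans (contracted-link (chain Θ xs) π ¬p)
        (chain-dependent xs (contract π a b) λ i → ¬i (¬p , i))

    chain-append : ∀ xs ys π → chain Θ (xs ++ ys) π ≈ chain (chain Θ ys) xs π
    chain-append []             ys π = refl
    chain-append ((a , b) ∷ xs) ys π = contracted-resp (chain-append xs ys) π a b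

  private
    total-closure : ∀ {k} (M : Multigraph n k) S → Multigraph.Connected M S → Total (closure (partition M) (included (ends M) S))
    total-closure M S conn u v = proj₁ (joined-closure M S) (conn u v)

  -- Together with `chain-non-tree`, this makes `chain totality` the indicator function of spanning
  -- trees: independence excludes cycles, `totality` of the closure tests connectedness.
  chain-tree : ∀ {k} (M : Multigraph n k) S → Multigraph.IsSpanningTree M S →
               chain totality (included (ends M) S) (partition M) ≈ 1#
  chain-tree M S (connected , acyclic) = trans
    (chain-independent totality (included (ends M) S) (partition M) (acyclic⇒independent M S acyclic))
    (totality-yes {closure (partition M) (included (ends M) S)} (total-closure M S connected))

  chain-non-tree : ∀ {k} (M : Multigraph n k) S → ¬ Multigraph.IsSpanningTree M S →
                   chain totality (included (ends M) S) (partition M) ≈ 0#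
  chain-non-tree M S ¬tree with independent? (partition M) (included (ends M) S)
  ... | no ¬i = chain-dependent totality (included (ends M) S) (partition M) ¬i
  ... | yes i = trans (chain-independent totality (included (ends M) S) (partition M) i)
    (totality-no {closure (partition M) (included (ends M) S)} λ tot →
      ¬tree ((λ u v → proj₂ (joined-closure M S) (tot u v)) , independent⇒acyclic M S i))

  contracted-∑ : ∀ {q} (x : Subset q → Carrier) (Θ : Subset q → Partition n → Carrier) π a b →
    contracted (λ π → ∑ (λ F → x F * Θ F π)) π a b ≈ ∑ (λ F → x F * contracted (Θ F) π a b)
  contracted-∑ x Θ π a b = go (_≟_ π a b)
    where
    Θ∑ = λ π → ∑ (λ F → x F * Θ F π)
    go : Dec (π ⊢ a ∼ b) → contracted Θ∑ π a b ≈ ∑ (λ F → x F * contracted (Θ F) π a b)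
    go (yes p) = trans (contracted-loop Θ∑ π p)
      (sym (∑-zero λ F → trans (*-congˡ (contracted-loop (Θ F) π p)) (solve 1 (λ x → x :* con (+ 0) := con (+ 0)) refl (x F))))
    go (no ¬p) = trans (contracted-link Θ∑ π ¬p) (∑-cong λ F → *-congˡ (sym (contracted-link (Θ F) π ¬p)))

  chain-∑ : ∀ {q} (x : Subset q → Carrier) (Θ : Subset q → Partition n → Carrier) xs π →
    chain (λ π → ∑ (λ F → x F * Θ F π)) xs π ≈ ∑ (λ F → x F * chain (Θ F) xs π)
  chain-∑ x Θ []             π = refl
  chain-∑ x Θ ((a , b) ∷ xs) π = trans (contracted-resp (chain-∑ x Θ xs) π a b)
    (contracted-∑ x (λ F → chain (Θ F) xs) π a b)

  treeSum-∑ : ∀ {m} (e : Fin m → Fin n × Fin n) (g : Fin m → Carrier) π →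
    treeSum (tabulate λ i → resistor (proj₁ (e i)) (proj₂ (e i)) (g i)) π
    ≈ ∑ (λ F → ∏[ F ] g * chain totality (included e F) π)
  treeSum-∑ {zero}  e g π = sym (*-identityˡ _)
  treeSum-∑ {suc m} e g π = +-cong excluded chosen
    where
    open SetoidReasoning (CommutativeRing.setoid commutativeRing)
    e′ = e ∘ suc
    g′ = g ∘ suc
    a = proj₁ (e zero)
    b = proj₂ (e zero)
    T = treeSum (tabulate λ i → resistor (proj₁ (e′ i)) (proj₂ (e′ i)) (g′ i))
    X : Subset m → Partition n → Carrier
    X F = chain totality (included e′ F)
    excluded : 1# * T π ≈ ∑ (λ F → ∏[ outside ∷ F ] g * X F π)
    excluded = begin
      1# * T π                              ≈⟨ *-identityˡ _ ⟩
      T π                                   ≈⟨ treeSum-∑ e′ g′ π ⟩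
      ∑ (λ F → ∏[ F ] g′ * X F π)           ≈⟨ ∑-cong (λ F → *-congʳ (sym (*-identityˡ (∏[ F ] g′)))) ⟩
      ∑ (λ F → ∏[ outside ∷ F ] g * X F π)  ∎
    chosen : g zero * contracted T π a b ≈ ∑ (λ F → ∏[ inside ∷ F ] g * contracted (X F) π a b)
    chosen = begin
      g zero * contracted T π a b                              ≈⟨ *-congˡ (contracted-resp (treeSum-∑ e′ g′) π a b) ⟩
      g zero * contracted (λ π → ∑ (λ F → ∏[ F ] g′ * X F π)) π a b ≈⟨ *-congˡ (contracted-∑ (λ F → ∏[ F ] g′) X π a b) ⟩
      g zero * ∑ (λ F → ∏[ F ] g′ * contracted (X F) π a b)    ≈⟨ ∑-*ˡ (g zero) (λ F → ∏[ F ] g′ * contracted (X F) π a b) ⟨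
      ∑ (λ F → g zero * (∏[ F ] g′ * contracted (X F) π a b))  ≈⟨ ∑-cong (λ F → sym (*-assoc (g zero) (∏[ F ] g′) _)) ⟩
      ∑ (λ F → ∏[ inside ∷ F ] g * contracted (X F) π a b)     ∎

-- The numerators as coefficients of the enlarged network

module _ {c ℓ₁ ℓ₂} (ℝ : RealField c ℓ₁ ℓ₂) (𝒢 : Network ℝ) where
  open RealField ℝ hiding (zero)
  open Network 𝒢
  private module SG = Multigraph G
  open IntegerSolver commutativeRing
  open SpanningTrees ℝ {n}
  open Closure {n} {E = Fin n × Fin n} proj₁ proj₂
  open Partition using (_≟_) renaming (_∼_ to _⊢_∼_)

  portEdge : Fin n → Fin n × Fin n
  portEdge x = r x , x

  port-edges : Fin q → Fin n × Fin n
  port-edges j = portEdge (nonRoot j)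

  omitted-none : omitted port-edges Subset.⊥ ≡ map portEdge N
  omitted-none = ≡.trans (omitted-⊥ port-edges)
    (≡.trans (≡.sym (List.map-tabulate nonRoot portEdge)) (≡.cong (map portEdge) (List.tabulate-lookup N)))

  r-port : ∀ {x a} → port x ≡ just a → r x ≡ root a
  r-port {x} p rewrite p = ≡.refl

  nonRoot≢root : ∀ {x} → NonRoot x → ∀ b → x ≢ root b
  nonRoot≢root (a , pa , x≢a) b ≡.refl with just-injective (≡.trans (≡.sym pa) (root∈ b))
  ... | ≡.refl = x≢a ≡.refl

  -- g witnesses independence: it separates each remaining nonroot from its
  -- root, and is corrected by sending the nonroot just linked to its root.
  star-independent : ∀ xs (g : Fin n → Fin n) π → Unique xs → All NonRoot xs → All (λ x → g x ≡ x) xs →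
    (∀ a → g (root a) ≡ root a) → π ⊑ kernel Fin._≟_ g → Independent π (map portEdge xs)
  star-independent []       g π _ _ _ _ _ = tt
  star-independent (x ∷ xs) g π (x∉ ∷ uniq) (nr@(a , pa , x≢a) ∷ nrs) (gx ∷ gxs) groot π⊑g =
      (λ p → x≢a (≡.trans (≡.sym gx) (≡.trans (≡.sym (π⊑g p)) (≡.trans (≡.cong g rx) (groot a)))))
    , star-independent xs (σ ∘ g) (contract π (r x) x) uniq nrs
        (All.zipWith (λ (x≢y , gy) → ≡.trans (≡.cong σ gy) (σ-other λ y≡x → x≢y (≡.sym y≡x))) (x∉ , gxs))
        (λ b → ≡.trans (≡.cong σ (groot b)) (σ-root b))
        (contract-least π {kernel Fin._≟_ (σ ∘ g)} (λ p → ≡.cong σ (π⊑g p)) joins)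
    where
    rx : r x ≡ root a
    rx = r-port pa
    σ : Fin n → Fin n
    σ y = if does (y Fin.≟ x) then root a else y
    σ-other : ∀ {y} → y ≢ x → σ y ≡ y
    σ-other {y} y≢x rewrite dec-false (y Fin.≟ x) y≢x = ≡.refl
    σ-x : σ x ≡ root a
    σ-x rewrite dec-true (x Fin.≟ x) ≡.refl = ≡.refl
    σ-root : ∀ b → σ (root b) ≡ root b
    σ-root b = σ-other λ e → nonRoot≢root nr b (≡.sym e)
    joins : σ (g (r x)) ≡ σ (g x)
    joins = ≡.trans (≡.cong σ (≡.trans (≡.cong g rx) (groot a)))
      (≡.trans (σ-root a) (≡.trans (≡.sym σ-x) (≡.cong σ (≡.sym gx))))

  N-nonRoot : All NonRoot N
  N-nonRoot = All.all-filter nonRoot? (allFin n)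

  N-independent : Independent (partition G) (map portEdge N)
  N-independent = star-independent N (λ x → x) (partition G) (Unique.filter⁺ nonRoot? (Unique.allFin⁺ n))
    N-nonRoot (All.map (λ _ → ≡.refl) N-nonRoot) (λ _ → ≡.refl) (λ p → p)

  -- The new edges form a star around the root inside each superport, so contracting all of them
  -- identifies exactly the vertices of that superport.
  N-closure : closure (partition G) (map portEdge N) ≋ partition quotient
  N-closure = closure-least (map portEdge N) {partition G} (partition quotient) (λ { ≡.refl → same })
                (All.map⁺ (All.map (λ (a , pa , _) → glue a (≡.trans (≡.cong port (r-port pa)) (root∈ a)) pa) N-nonRoot))
            , λ { same → J.refl ; (glue a px py) → J.trans (to-root px) (J.sym (to-root py)) }
    where
    J = closure (partition G) (map portEdge N)
    module J = Partition J
    to-root : ∀ {x a} → port x ≡ just a → J ⊢ x ∼ root a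
    to-root {x} {a} px with x Fin.≟ root a
    ... | yes ≡.refl = J.refl
    ... | no x≢a = J.sym (≡.subst (λ y → J ⊢ y ∼ x) (r-port px)
      (All.lookup (All.map⁻ (closure-edges (map portEdge N) (partition G)))
        (∈-filter⁺ nonRoot? (∈-allFin x) (a , px , x≢a))))

  conductors = tabulate λ i → resistor (src i) (tgt i) (conductance i)

  treeWeight : Partition n → Carrier
  treeWeight = treeSum conductors

  private
    -- The indicator that `F` and the new edges outside `I` form a spanning tree of the enlarged
    -- network. Contracting `F` first leads to trees of `H F`; contracting the new edges first, for
    -- empty `I`, leads to trees of `quotient`.
    value : Subset q → Subset m → Carrier
    value I F = chain totality (omitted port-edges I ++ included (ends G) F) (partition G)

    totality-cong : Contraction.Congruent commutativeRing totality
    totality-cong = treeSum-cong []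

    value-by-forest : ∀ I F → value I F ≈ chain (chain totality (omitted port-edges I)) (included (ends G) F) (partition G)
    value-by-forest I F = trans
      (chain-↭ totality-cong (++-comm (omitted port-edges I) (included (ends G) F)) (partition G))
      (chain-append totality (included (ends G) F) (omitted port-edges I) (partition G))

    value-acyclic : ∀ I F → IsForest F → value I F ≈ chain totality (included (ends (H F)) (∁ I)) (partition (H F))
    value-acyclic I F ac = trans (value-by-forest I F) (trans
      (chain-independent (chain totality (omitted port-edges I)) (included (ends G) F) (partition G) (acyclic⇒independent G F ac))
      (chain-cong totality-cong (omitted port-edges I) _ _ (proj₂ (joined-closure G F) , proj₁ (joined-closure G F))))

    -- A tree has one vertex more than it has edges; here the vertices are the components of `F` and
    -- the edges are the elements of `∁ I`.
    component-count : ∀ I F → Multigraph.IsSpanningTree (H F) (∁ I) → SG.componentCount F ≡ q ℕ.∸ ∣ I ∣ ℕ.+ 1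
    component-count I F (connected , acyclic) = ≡.trans
      (classCount-closure (included (ends (H F)) (∁ I)) (partition (H F)) (acyclic⇒independent (H F) (∁ I) acyclic))
      (≡.cong₂ ℕ._+_ (≡.trans (length-included (ends (H F)) (∁ I)) (Subset.∣∁p∣≡n∸∣p∣ I))
        (classCount-total (proj₁ boundary) (closure (partition (H F)) (included (ends (H F)) (∁ I))) λ u v → proj₁ (joined-closure (H F) (∁ I)) (connected u v)))

    value-counted : ∀ I F → IsCounted I F → value I F ≈ 1#
    value-counted I F ((ac , _) , tree) = trans (value-acyclic I F ac) (chain-tree (H F) (∁ I) tree)

    value-uncounted : ∀ I F → ¬ IsCounted I F → value I F ≈ 0#
    value-uncounted I F ¬counted with independent? (partition G) (included (ends G) F)
    ... | no ¬i = trans (value-by-forest I F) (chain-dependent (chain totality (omitted port-edges I)) (included (ends G) F) (partition G) ¬i)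
    ... | yes i = trans (value-acyclic I F ac)
      (chain-non-tree (H F) (∁ I) λ tree → ¬counted ((ac , component-count I F tree) , tree))
      where ac = independent⇒acyclic G F i

    value-∅ : ∀ F → value Subset.⊥ F ≈ chain totality (included (ends quotient) F) (partition quotient)
    value-∅ F = trans (chain-append totality (omitted port-edges Subset.⊥) (included (ends G) F) (partition G))
      (≡.subst (λ xs → chain f xs (partition G) ≈ f (partition quotient)) (≡.sym omitted-none)
        (trans (chain-independent f (map portEdge N) (partition G) N-independent)
          (chain-cong totality-cong (included (ends G) F) _ _ N-closure)))
      where f = chain totality (included (ends G) F)

    value-valid : ∀ F → IsValid F → value Subset.⊥ F ≈ 1#
    value-valid F (_ , tree) = trans (value-∅ F) (chain-tree quotient F tree)

    value-invalid : ∀ F → ¬ IsValid F → value Subset.⊥ F ≈ 0#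
    value-invalid F ¬valid = trans (value-∅ F) (chain-non-tree quotient F λ tree →
      -- Edges independent over the quotient are independent over the finer partition of `G`, which
      -- supplies the forest condition of `IsValid`.
      ¬valid (independent⇒acyclic G F (independent-mono (included (ends G) F) {partition G} {partition quotient} (λ { ≡.refl → same })
        (acyclic⇒independent quotient F (proj₂ tree))) , tree))

    select : ∀ {p} {P : Set p} (P? : Dec P) x {y} → (P → y ≈ 1#) → (¬ P → y ≈ 0#) → (if does P? then x else 0#) ≈ x * y
    select (yes p) x y≈1 y≈0 = sym (trans (*-congˡ (y≈1 p)) (*-identityʳ x))
    select (no ¬p) x y≈1 y≈0 = sym (trans (*-congˡ (y≈0 ¬p)) (solve 1 (λ x → x :* con (+ 0) := con (+ 0)) refl x))

  chain-treeWeight : ∀ I → chain treeWeight (omitted port-edges I) (partition G) ≈ ∑ (λ F → weight F * value I F)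
  chain-treeWeight I = begin
    chain treeWeight (omitted port-edges I) (partition G)
      ≈⟨ chain-resp (treeSum-∑ (ends G) conductance) (omitted port-edges I) (partition G) ⟩
    chain (λ π → ∑ (λ F → weight F * chain totality (included (ends G) F) π)) (omitted port-edges I) (partition G)
      ≈⟨ chain-∑ weight (λ F → chain totality (included (ends G) F)) (omitted port-edges I) (partition G) ⟩
    ∑ (λ F → weight F * chain (chain totality (included (ends G) F)) (omitted port-edges I) (partition G))
      ≈⟨ ∑-cong (λ F → *-congˡ (sym (chain-append totality (omitted port-edges I) (included (ends G) F) (partition G)))) ⟩
    ∑ (λ F → weight F * value I F) ∎
    where
    open SetoidReasoning (CommutativeRing.setoid commutativeRing)
    chain-resp : ∀ {Θ Θ′} → (∀ π → Θ π ≈ Θ′ π) → ∀ xs π → chain Θ xs π ≈ chain Θ′ xs π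
    chain-resp e []             π = e π
    chain-resp e ((a , b) ∷ xs) π = contracted-resp (chain-resp e xs) π a b

  -- The empty set has its own clause in the definition of `Ψ`, so it is matched through valid
  -- forests and all other sets through `H F`.
  Ψ-chain : ∀ I → Ψ I ≈ chain treeWeight (omitted port-edges I) (partition G)
  Ψ-chain I with Subset.nonempty? I
  ... | yes _ = trans (∑-cong λ F → select (isCounted? I F) (weight F) (value-counted I F) (value-uncounted I F))
                  (sym (chain-treeWeight I))
  ... | no ¬ne with Subset.Empty-unique ¬ne
  ...   | ≡.refl = trans (∑-cong λ F → select (isValid? F) (weight F) (value-valid F) (value-invalid F))
                    (sym (chain-treeWeight Subset.⊥))

-- Positivity, normalisation and the conclusions

module Positivity {c ℓ₁ ℓ₂} (ℝ : RealField c ℓ₁ ℓ₂) where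
  open RealField ℝ hiding (zero)
  open OrderedField ℝ
  open SumProperties commutativeRing

  ∑-nonNeg : ∀ {q} {f : Subset q → Carrier} → (∀ I → 0# ≤ f I) → 0# ≤ ∑ f
  ∑-nonNeg {zero}  p = p []
  ∑-nonNeg {suc q} p = +-nonNeg (∑-nonNeg λ I → p (outside ∷ I)) (∑-nonNeg λ I → p (inside ∷ I))

  ∑-pos : ∀ {q} {f : Subset q → Carrier} → (∀ I → 0# ≤ f I) → ∀ J → 0# < f J → 0# < ∑ f
  ∑-pos p []            0<f = 0<f
  ∑-pos p (outside ∷ J) 0<f = +-pos-nonNeg (∑-pos (λ I → p (outside ∷ I)) J 0<f) (∑-nonNeg λ I → p (inside ∷ I))
  ∑-pos p (inside  ∷ J) 0<f = +-nonNeg-pos (∑-nonNeg λ I → p (outside ∷ I)) (∑-pos (λ I → p (inside ∷ I)) J 0<f)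

  ∏-one : ∀ {q} (I : Subset q) → ∏[ I ] (λ _ → 1#) ≈ 1#
  ∏-one []            = refl
  ∏-one (outside ∷ I) = trans (*-identityˡ _) (∏-one I)
  ∏-one (inside  ∷ I) = trans (*-identityˡ _) (∏-one I)

module _ {c ℓ₁ ℓ₂} (ℝ : RealField c ℓ₁ ℓ₂) (𝒢 : Network ℝ) where
  open RealField ℝ hiding (zero)
  open OrderedField ℝ
  open Network 𝒢
  open Stability ℝ
  open ComplexField ℝ
  open Positivity ℝ
  open SumProperties commutativeRing using (∑; ∑-cong; ∑-*ˡ)
  open Chain commutativeRing {n}
  private
    module T = TreeSum ℝ {n}
    module P = Potential commutativeRing {n}
    module ℂ∑ = SumProperties ℂ-commutativeRing

    es = conductors ℝ 𝒢
    f = treeWeight ℝ 𝒢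
    e = port-edges ℝ 𝒢
    Ψ′ : Subset q → Carrier
    Ψ′ I = chain f (omitted e I) (partition G)

    positive : All (λ e → 0# < T.conductance e) es
    positive = All.tabulate⁺ conductance-pos

    total : ∀ π → Total (T.closure π es)
    total π u v = EqClosure.fold J.isEquivalence
      (λ { (Multigraph.same ≡.refl) → J.refl
         ; (Multigraph.edge {i} _)  → All.tabulate⁻ (T.closure-edges es π) i })
      (connected u v)
      where module J = Partition (T.closure π es)

    f-pos : ∀ π → 0# < f π
    f-pos π = proj₁ (T.treeSum-green es positive π (total π))

    f-green : ∀ π a b → P.Green f (T.energy es) π a b
    f-green π = proj₂ (T.treeSum-green es positive π (total π))

    module R = Rayleigh ℝ {n}

    Ψ-nonNeg : ∀ I → 0# ≤ Ψ I
    Ψ-nonNeg I = ≤-resp refl (sym (Ψ-chain ℝ 𝒢 I))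
      (R.chain-nonNeg f (T.treeSum-cong es) f-pos (T.energy es) (R.energy-nonNeg es positive) f-green (omitted e I) (partition G))

    -- For the full set no new edge is contracted, and the numerator is the tree sum of the
    -- connected network itself. This one term makes the normalising constant positive.
    Ψ⊤-pos : 0# < Ψ Subset.⊤
    Ψ⊤-pos = <-respʳ (sym (trans (Ψ-chain ℝ 𝒢 Subset.⊤)
      (reflexive (≡.cong (λ xs → chain f xs (partition G)) (omitted-⊤ e))))) (f-pos (partition G))

    ∑Ψ : 𝒫[1,…,1] ≈ ∑ Ψ
    ∑Ψ = ∑-cong λ I → trans (*-congˡ (∏-one I)) (*-identityʳ (Ψ I))

  lattice-condition : ∀ I J → Ψ I * Ψ J ≥ Ψ (I ∪ J) * Ψ (I ∩ J)
  lattice-condition I J = ≤-resp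
    (sym (*-cong (Ψ-chain ℝ 𝒢 (I ∪ J)) (Ψ-chain ℝ 𝒢 (I ∩ J))))
    (sym (*-cong (Ψ-chain ℝ 𝒢 I) (Ψ-chain ℝ 𝒢 J)))
    (R.omitted-submodular f (T.treeSum-cong es) f-pos (T.energy es) (R.energy-nonNeg es positive) f-green e I J [] [] (partition G))

  normalisation-pos : 0# < 𝒫[1,…,1]
  normalisation-pos = <-respʳ (sym ∑Ψ) (∑-pos Ψ-nonNeg Subset.⊤ Ψ⊤-pos)

  normalised-total : ∑ (normalised normalisation-pos) ≈ 1#
  normalised-total = trans (∑-cong λ I → *-comm (Ψ I) _)
    (trans (∑-*ˡ (inverse normalisation-pos) Ψ) (trans (*-congˡ (sym ∑Ψ)) (inverseˡ normalisation-pos)))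

  normalised-stable : RealStable (normalised normalisation-pos)
  -- A zero of the normalised polynomial is, up to double negation, a zero of the unnormalised one,
  -- because the scaling factor is nonzero.
  normalised-stable z 0<z p = *-cancel-nonzero (fromℝ i) (evalℂ Ψ′ z) i≉0
    (ℂ′.trans (ℂ′.sym scaled) p) (HalfPlane.chain-stable ℝ {n} f (T.treeSum-cong es) f-pos (T.energy es) f-green e (partition G) z 0<z)
    where
    i = inverse normalisation-pos
    i≉0 : ¬ (fromℝ i ℂ′.≈ ℂ′.0#)
    i≉0 (i≈0 , _) = <-irrefl (sym i≈0) (inverse-pos normalisation-pos)
    scaled : evalℂ (normalised normalisation-pos) z ℂ′.≈ fromℝ i ℂ′.* evalℂ Ψ′ z
    scaled = ℂ′.trans
      (ℂ∑.∑-cong λ I → ℂ′.trans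
        (ℂ′.*-congʳ {ℂ∑.∏[ I ] z} (ℂ′.trans (fromℝ-cong (trans (*-comm (Ψ I) i) (*-congˡ (Ψ-chain ℝ 𝒢 I)))) (fromℝ-* i (Ψ′ I))))
        (ℂ′.*-assoc (fromℝ i) (fromℝ (Ψ′ I)) (ℂ∑.∏[ I ] z)))
      (ℂ∑.∑-*ˡ (fromℝ i) (λ I → fromℝ (Ψ′ I) ℂ′.* ℂ∑.∏[ I ] z))

  normalised-stronglyRayleigh : IsStronglyRayleigh (normalised normalisation-pos)
  normalised-stronglyRayleigh = record
    { isProbabilityMeasure = record
      { nonNegative = λ I → *-nonNeg (Ψ-nonNeg I) (<⇒≤ (inverse-pos normalisation-pos))
      ; total       = normalised-total }
    ; realStable = normalised-stable
    }

corollary5p5 : ∀ {c ℓ₁ ℓ₂} (ℝ : RealField c ℓ₁ ℓ₂) (𝒢 : Network ℝ) →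
    let open RealField ℝ
        open Network 𝒢
        open Stability ℝ
    in ((I J : Subset q) → Ψ I * Ψ J ≥ Ψ (I ∪ J) * Ψ (I ∩ J))
       × Σ (0# < 𝒫[1,…,1]) (λ pos → IsStronglyRayleigh (normalised pos))
corollary5p5 ℝ 𝒢 = lattice-condition ℝ 𝒢 , normalisation-pos ℝ 𝒢 , normalised-stronglyRayleigh ℝ 𝒢
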